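{- The problem $M3 \mid prpt, (n-1,1) \mid C_{\max}$ is NP-hard if the unique open-shop job is larger than any flow-shop job; that is, computing the minimum makespan is NP-hard when restricted to the instances with $q_n>p_1$.
   Context: Problem $M3 \mid prpt, (n-1,1) \mid C_{\max}$. There are three machines $M_1,M_2,M_3$ and $n$ jobs: flow-shop jobs $\mathcal{F}=\{J_1,\dots,J_{n-1}\}$ and a single open-shop job $J_n$. Each $J_i\in\mathcal{F}$ must be processed non-preemptively on $M_1$, then $M_2$, then $M_3$, with processing time $p_i$ on each machine. The job $J_n$ must be processed non-preemptively on each of the three machines, in any machine order, with processing time $q_n$ on each machine. At every time a job is processed by at most one machine and a machine processes at most one job. The makespan of a feasible schedule (starting at time $0$) is the maximum completion time of a job; the goal is to minimize the makespan. Jobs are indexed so that $p_1\ge p_2\ge\dots\ge p_{n-1}$. As usual for (ordinary) NP-hardness, the processing times are positive integers encoded in binary; NP-hardness of the minimization problem means NP-hardness of the associated decision problem: given an instance and a threshold $T$, is there a feasible schedule of makespan at most $T$? -}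

module Defs where

open import Data.Bool using (Bool; true; false)
open import Data.Nat using (ℕ; zero; suc; _+_; _*_; _^_; _≤_; _<_; _≥_)
open import Data.Nat.Properties using (+-suc)
open import Data.Integer using (+_)
import Data.Rational as ℚ
open ℚ using (ℚ; 0ℚ)
open import Data.Fin using (Fin; zero; suc)
open import Data.List using (List; []; _∷_; _++_; map; foldr; length; lookup; allFin; concatMap)
open import Data.List.Properties using (∷-injectiveʳ; ∷-injective)
open import Data.List.NonEmpty using (List⁺; head; toList) renaming (_∷_ to _∷⁺_)
open import Data.List.Membership.Propositional using (_∈_)
open import Data.List.Relation.Unary.All using (All)
open import Data.List.Relation.Unary.Linked using (Linked)
open import Data.Vec as Vec using (Vec; []; _∷_)
open import Data.Product using (Σ; ∃-syntax; _×_; _,_)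
open import Data.Sum using (_⊎_)
open import Function using (_∘_; _⇔_)
open import Function.Definitions using (Injective)
open import Relation.Binary.PropositionalEquality
  using (_≡_; _≢_; refl; sym; trans; cong; cong₂)

------------------------------------------------------------------------
-- Multi-tape Turing machines

data Symbol (m : ℕ) : Set where
  blank : Symbol m
  bit   : Bool → Symbol m
  mark  : Fin m → Symbol m

data Move : Set where
  left stay right : Move

-- A two-way infinite tape: `before` lists the cells to the left of the head,
-- nearest first, `after` those to its right; all cells not listed are blank.
record Tape (m : ℕ) : Set where
  constructor tape
  field
    before  : List (Symbol m)
    scanned : Symbol m
    after   : List (Symbol m)

open Tape public

blankTape : ∀ {m} → Tape m
blankTape = tape [] blank []

inputTape : ∀ {m} → List Bool → Tape m
inputTape []       = blankTape
inputTape (b ∷ bs) = tape [] (bit b) (map bit bs)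

write : ∀ {m} → Symbol m → Tape m → Tape m
write s (tape ls _ rs) = tape ls s rs

move : ∀ {m} → Move → Tape m → Tape m
move left  (tape []       s rs)       = tape [] blank (s ∷ rs)
move left  (tape (l ∷ ls) s rs)       = tape ls l (s ∷ rs)
move stay  t                          = t
move right (tape ls       s [])       = tape (s ∷ ls) blank []
move right (tape ls       s (r ∷ rs)) = tape (s ∷ ls) r rs

leadingBits : ∀ {m} → List (Symbol m) → List Bool
leadingBits []           = []
leadingBits (blank  ∷ _) = []
leadingBits (mark _ ∷ _) = []
leadingBits (bit b ∷ ss) = b ∷ leadingBits ss

-- The word starting at the head and extending right to the first non-bit.
outputWord : ∀ {m} → Tape m → List Bool
outputWord (tape _ s rs) = leadingBits (s ∷ rs)

-- A machine with `suc workTapes` tapes; the first one carries the input and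
-- the output.  `δ q as` lists the possible actions in state `q` when the
-- symbols `as` are scanned; the machine halts when there is none.
record TM : Set where
  field
    workTapes marks states : ℕ
    start accept : Fin states
    δ : Fin states → Vec (Symbol marks) (suc workTapes) →
        List (Fin states × Vec (Symbol marks × Move) (suc workTapes))

Deterministic : TM → Set
Deterministic M = ∀ q as → length (δ q as) ≤ 1
  where open TM M

module _ (M : TM) where
  open TM M

  record Config : Set where
    constructor config
    field
      state : Fin states
      tapes : Vec (Tape marks) (suc workTapes)

  open Config

  initial : List Bool → Config
  initial x = config start (inputTape x ∷ Vec.replicate workTapes blankTape)

  act : Symbol marks × Move → Tape marks → Tape marks
  act (s , d) = move d ∘ write s

  successors : Config → List Config
  successors (config q ts) =
    map (λ (q′ , actions) → config q′ (Vec.zipWith act actions ts))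
        (δ q (Vec.map scanned ts))

  data Run : Config → ℕ → Config → Set where
    done : ∀ {c} → Run c 0 c
    step : ∀ {c c′ c″ t} → c′ ∈ successors c → Run c′ t c″ → Run c (suc t) c″

  AcceptsWithin : List Bool → ℕ → Set
  AcceptsWithin x bound =
    ∃[ t ] ∃[ c ] t ≤ bound × Run (initial x) t c × state c ≡ accept

  ComputesWithin : List Bool → List Bool → ℕ → Set
  ComputesWithin x y bound =
    ∃[ t ] ∃[ c ] t ≤ bound × Run (initial x) t c × successors c ≡ []
                × outputWord (Vec.head (tapes c)) ≡ y

------------------------------------------------------------------------
-- NP and NP-hardness

-- Every polynomial in n is dominated by one of these.
poly : ℕ → ℕ → ℕ → ℕ
poly a k n = a * n ^ k + a

NP : (List Bool → Set) → Set
NP L = ∃[ M ] ∃[ a ] ∃[ k ] ∀ x → L x ⇔ AcceptsWithin M x (poly a k (length x))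

PolyTime : (List Bool → List Bool) → Set
PolyTime f = ∃[ M ] ∃[ a ] ∃[ k ] Deterministic M ×
  (∀ x → ComputesWithin M x (f x) (poly a k (length x)))

-- `Admissible` singles out the data that are instances of the problem.
record DecisionProblem : Set₁ where
  field
    Instance         : Set
    Admissible       : Instance → Set
    Yes              : Instance → Set
    encode           : Instance → List Bool
    encode-injective : Injective _≡_ _≡_ encode

restrict : (P : DecisionProblem) → (DecisionProblem.Instance P → Set) → DecisionProblem
restrict P R = record
  { Instance         = Instance
  ; Admissible       = λ i → Admissible i × R i
  ; Yes              = Yes
  ; encode           = encode
  ; encode-injective = encode-injective
  }
  where open DecisionProblem P

-- Hardness under polynomial-time many-one reductions, which must map every
-- word to the encoding of an admissible instance.
NP-hard : DecisionProblem → Set₁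
NP-hard P = (L : List Bool → Set) → NP L →
  ∃[ f ] PolyTime f ×
    (∀ x → ∃[ i ] f x ≡ encode i × Admissible i × (L x ⇔ Yes i))
  where open DecisionProblem P

------------------------------------------------------------------------
-- Binary encoding

increment : List Bool → List Bool
increment []           = true ∷ []
increment (false ∷ bs) = true ∷ bs
increment (true  ∷ bs) = false ∷ increment bs

-- Least significant bit first, without superfluous zeros.
binary : ℕ → List Bool
binary zero    = []
binary (suc n) = increment (binary n)

-- Self-delimiting: every bit is preceded by `true`, the end marked by `false`.
delimit : List Bool → List Bool
delimit []       = false ∷ []
delimit (b ∷ bs) = true ∷ b ∷ delimit bs

encodeℕs : List ℕ → List Bool
encodeℕs = concatMap (delimit ∘ binary)

private
  value : List Bool → ℕ
  value []           = 0
  value (false ∷ bs) = value bs + value bs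
  value (true  ∷ bs) = suc (value bs + value bs)

  value-increment : ∀ bs → value (increment bs) ≡ suc (value bs)
  value-increment []           = refl
  value-increment (false ∷ bs) = refl
  value-increment (true  ∷ bs) rewrite value-increment bs =
    cong suc (+-suc (value bs) (value bs))

  value-binary : ∀ n → value (binary n) ≡ n
  value-binary zero    = refl
  value-binary (suc n) =
    trans (value-increment (binary n)) (cong suc (value-binary n))

  delimit-++-injective : ∀ bs cs {xs ys} → delimit bs ++ xs ≡ delimit cs ++ ys →
                         bs ≡ cs × xs ≡ ys
  delimit-++-injective []       []       refl = refl , refl
  delimit-++-injective []       (_ ∷ _)  ()
  delimit-++-injective (_ ∷ _)  []       ()
  delimit-++-injective (b ∷ bs) (c ∷ cs) eq with ∷-injective (∷-injectiveʳ eq)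
  ... | refl , eq′ with delimit-++-injective bs cs eq′
  ...   | refl , eq″ = refl , eq″

encodeℕs-injective : Injective _≡_ _≡_ encodeℕs
encodeℕs-injective {[]}     {[]}     _  = refl
encodeℕs-injective {[]}     {n ∷ ns} eq with binary n
encodeℕs-injective {[]}     {n ∷ ns} () | []
encodeℕs-injective {[]}     {n ∷ ns} () | _ ∷ _
encodeℕs-injective {m ∷ ms} {[]}     eq with binary m
encodeℕs-injective {m ∷ ms} {[]}     () | []
encodeℕs-injective {m ∷ ms} {[]}     () | _ ∷ _
encodeℕs-injective {m ∷ ms} {n ∷ ns} eq
  with delimit-++-injective (binary m) (binary n) eq
... | bm≡bn , eq′ = cong₂ _∷_
  (trans (sym (value-binary m)) (trans (cong value bm≡bn) (value-binary n)))
  (encodeℕs-injective eq′)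

------------------------------------------------------------------------
-- The scheduling problem M3 | prpt, (n-1,1) | C_max

-- `flowTimes` is p₁, …, pₙ₋₁ and `openTime` is qₙ.
record ShopInstance : Set where
  constructor shop
  field
    flowTimes : List⁺ ℕ
    openTime  : ℕ

  largestFlowTime : ℕ
  largestFlowTime = head flowTimes

data Machine : Set where
  M₁ M₂ M₃ : Machine

machines : List Machine
machines = M₁ ∷ M₂ ∷ M₃ ∷ []

WellFormed : ShopInstance → Set
WellFormed (shop ps q) =
  All (0 <_) (toList ps) × Linked _≥_ (toList ps) × 0 < q

-- Used for completion times only, which are nonnegative in feasible schedules.
maximum : List ℚ → ℚ
maximum = foldr ℚ._⊔_ 0ℚ

module _ (I : ShopInstance) where
  open ShopInstance I

  FlowIndex : Set
  FlowIndex = Fin (length (toList flowTimes))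

  data Job : Set where
    flowJob : FlowIndex → Job
    openJob : Job

  jobs : List Job
  jobs = openJob ∷ map flowJob (allFin _)

  time : Job → ℕ
  time (flowJob i) = lookup (toList flowTimes) i
  time openJob     = openTime

  -- Starting times of the uninterrupted operations; all data are integral, so
  -- allowing only rational times does not affect the optimum.
  Schedule : Set
  Schedule = Job → Machine → ℚ

  module _ (S : Schedule) where

    completion : Job → Machine → ℚ
    completion j μ = S j μ ℚ.+ (+ time j ℚ./ 1)

    record Feasible : Set where
      field
        nonNegative : ∀ j μ → 0ℚ ℚ.≤ S j μ
        flow₁₂ : ∀ i → completion (flowJob i) M₁ ℚ.≤ S (flowJob i) M₂
        flow₂₃ : ∀ i → completion (flowJob i) M₂ ℚ.≤ S (flowJob i) M₃
        oneMachinePerJob : ∀ j {μ ν} → μ ≢ ν →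
          completion j μ ℚ.≤ S j ν ⊎ completion j ν ℚ.≤ S j μ
        oneJobPerMachine : ∀ μ {j k} → j ≢ k →
          completion j μ ℚ.≤ S k μ ⊎ completion k μ ℚ.≤ S j μ

    jobCompletion : Job → ℚ
    jobCompletion j = maximum (map (completion j) machines)

    makespan : ℚ
    makespan = maximum (map jobCompletion jobs)

-- An instance paired with a threshold T: is there a feasible schedule of
-- makespan at most T?
MixedShop : DecisionProblem
MixedShop = record
  { Instance         = ShopInstance × ℕ
  ; Admissible       = λ (I , T) → WellFormed I
  ; Yes              = λ (I , T) →
      Σ (Schedule I) λ S → Feasible I S × makespan I S ℚ.≤ (+ T ℚ./ 1)
  ; encode           = λ (shop ps q , T) → encodeℕs (T ∷ q ∷ toList ps)
  ; encode-injective = injective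
  }
  where
  injective : Injective _≡_ _≡_
    (λ ((shop ps q , T) : ShopInstance × ℕ) → encodeℕs (T ∷ q ∷ toList ps))
  injective {shop (p ∷⁺ ps) q , T} {shop (p′ ∷⁺ ps′) q′ , T′} eq
    with refl ← encodeℕs-injective {T ∷ q ∷ p ∷ ps} {T′ ∷ q′ ∷ p′ ∷ ps′} eq = refl

OpenJobLargest : ShopInstance × ℕ → Set
OpenJobLargest (I , _) = largestFlowTime < openTime
  where open ShopInstance I

{-# OPTIONS --safe #-}

-- Acceptance by a nondeterministic machine is reduced directly to scheduling.
--
-- A computation is a tiling of a rectangle with matching edge colours. Winding the rows up into a
-- helix, cell i only has to match cell i + 1 (to its right) and cell i + C (below it).
--
-- Tilings become subset sums: in a large base, cell i owns three digits, and the number of a tile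
-- placed there puts 1, its left and its top colour on them, and K minus its right and bottom
-- colours on the digits of the cells i + 1 and i + C. There are no carries, so a sum with digits
-- 1, K, K everywhere (up to boundary terms) picks one tile per cell, with matching colours.
--
-- Subset sums become schedules: let the items have total tA + tB, let L₁ ≥ L₂ > tA be two further
-- flow-shop jobs, and q = 2 L₁ + tA = 2 L₂ + tB. Makespan 3 q forces the open-shop job to visit
-- M₃, M₂, M₁ without a pause, since in every other order some machine would have to process all
-- flow-shop jobs during a window of length q. A set of jobs that uses M₂ before (or after) the
-- open-shop job and contains a job of length L needs at least its total length plus L, at most q.
-- So L₁ and L₂ are separated, and the items split into the sums tA and tB.
--
-- The numbers are written by a machine which just sweeps over copies of the input and unary counters.

module Submission where

open import Defs
open import Data.Bool using (Bool; true; false; if_then_else_; T)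
open import Data.Empty using (⊥; ⊥-elim)
open import Data.Fin as Fin using (Fin; zero; suc; toℕ)
open import Data.Fin.Properties using (toℕ<n; toℕ-injective)
open import Data.Integer as ℤ using (ℤ)
import Data.Integer.Properties as ℤ
open import Data.List
  using (List; []; _∷_; _++_; _∷ʳ_; _ʳ++_; [_]; map; length; lookup; allFin; concat; concatMap; drop; replicate; reverse)
open import Data.List.Base using (initLast; _∷ʳ′_)
open import Data.List.Membership.Propositional using (_∈_; lose)
open import Data.List.Membership.Propositional.Properties
  using (∈-lookup; ∈-length; ∈-map⁺; ∈-map⁻; ∈-allFin; ∈-concatMap⁺; ∈-++⁺ˡ; ∈-++⁺ʳ)
open import Data.List.Membership.Setoid.Properties using (index-injective)
open import Data.List.NonEmpty using (List⁺; toList) renaming (_∷_ to _∷⁺_)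
open import Data.List.Properties
  using (map-tabulate; tabulate-lookup; map-++; map-∘; map-replicate; length-map; length-++; length-replicate; length-reverse;
         ++-assoc; ++-identityʳ; ++-ʳ++; ∷-injectiveˡ; concatMap-++; concatMap-map; reverse-involutive; unfold-reverse)
open import Data.List.Relation.Binary.Permutation.Propositional using (↭-sym)
open import Data.List.Relation.Binary.Permutation.Propositional.Properties using (↭-length; ∈-resp-↭)
open import Data.List.Relation.Ternary.Interleaving.Propositional using (Interleaving; consˡ; consʳ; []; swap)
open import Data.List.Relation.Unary.All as All using (All; []; _∷_)
import Data.List.Relation.Unary.All.Properties as All
open import Data.List.Relation.Unary.AllPairs as AllPairs using (AllPairs; []; _∷_)
import Data.List.Relation.Unary.AllPairs.Properties as AllPairs
open import Data.List.Relation.Unary.Any as Any using (here; there)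
open import Data.List.Relation.Unary.Any.Properties using (lookup-index)
open import Data.List.Relation.Unary.Linked using (_∷_)
import Data.List.Relation.Unary.Linked.Properties as Linked
import Data.List.Relation.Unary.Unique.Propositional.Properties as Unique
import Data.List.Sort
open import Data.Maybe as Maybe using (Maybe; just; nothing; maybe′)
open import Data.Nat using (ℕ; zero; suc; _+_; _*_; _^_; _∸_; _≤_; _<_; _≥_; z≤n; s≤s)
open import Data.Nat.ListAction using (sum)
open import Data.Nat.ListAction.Properties using (sum-++)
open import Data.Nat.Properties
open import Data.Nat.Tactic.RingSolver using (solve-∀)
open import Data.Product using (Σ; ∃; ∃₂; _×_; _,_; proj₁; proj₂)
open import Data.Rational as ℚ using (ℚ; 0ℚ)
import Data.Rational.Properties as ℚ
import Data.Rational.Unnormalised as ℚᵘ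
import Data.Rational.Unnormalised.Properties as ℚᵘ
open import Data.Sum as Sum using (_⊎_; inj₁; inj₂)
open import Data.Unit using (⊤; tt)
open import Data.Vec as Vec using (Vec; []; _∷_; _[_]≔_)
open import Data.Vec.Properties
  using (lookup-replicate; lookup-map; lookup-zipWith; lookup∘tabulate; tabulate∘lookup; tabulate-cong;
         lookup∘update; lookup∘update′; []≔-lookup; []≔-idempotent; []≔-commutes)
open import Function using (_∘_; id; const; _⇔_; mk⇔)
open import Function.Definitions using (Injective)
import Function.Properties.Equivalence as ⇔
open import Relation.Binary.Definitions using (Tri; tri<; tri≈; tri>)
import Relation.Binary.Construct.Flip.EqAndOrd as Flip
import Relation.Binary.Construct.On as On
open import Relation.Binary.PropositionalEquality
  using (_≡_; _≢_; refl; sym; trans; cong; cong₂; subst; subst₂; module ≡-Reasoning)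
open import Relation.Binary.PropositionalEquality.Properties using (setoid)
open import Relation.Nullary using (¬_; contradiction; yes; no)

-- Scheduling

-- Thanks to the helix all cells own the same item numbers up to a shift. The turn from one row to
-- the next is made by tiles of a margin column, which also choose the next transition. Let D be the
-- target and S the sum of all items, before doubling. With tA = 2 D and tB = 2 (S - D), the
-- condition 2 L₁ + tA = 2 L₂ + tB is solved without subtraction by L₁ = S + y and L₂ = 2 D + y,
-- where y is at least every item. Then L₂ ≤ L₁ means 2 D ≤ S, which is why every tile occurs many
-- times. The processing times have to be listed in descending order, by a machine that does no
-- arithmetic. The most significant digit of an item lies C cells ahead of its cell, so items of
-- later cells are larger; within a cell, the order of the tiles does not depend on the input and is
-- fixed together with the machine. The base is a power of two that leaves room for all digitwise
-- sums, up to those of the threshold 3 q. So every number is a concatenation of constant words,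
-- repeated as often as the unary counters say.

ι : ℕ → ℚ
ι n = ℤ.+ n ℚ./ 1

private
  ιᵘ : ∀ n → ℚ.toℚᵘ (ι n) ℚᵘ.≃ ℚᵘ.mkℚᵘ (ℤ.+ n) 0
  ιᵘ n = ℚ.toℚᵘ-fromℚᵘ (ℚᵘ.mkℚᵘ (ℤ.+ n) 0)

ι-+ : ∀ m n → ι (m + n) ≡ ι m ℚ.+ ι n
ι-+ m n = ℚ.toℚᵘ-injective (begin
  ℚ.toℚᵘ (ι (m + n))                                  ≈⟨ ιᵘ (m + n) ⟩
  ℚᵘ.mkℚᵘ (ℤ.+ (m + n)) 0                             ≈⟨ ℚᵘ.*≡* (cong (ℤ._* ℤ.+ 1) (trans (ℤ.pos-+ m n) (sym (cong₂ ℤ._+_ (ℤ.*-identityʳ (ℤ.+ m)) (ℤ.*-identityʳ (ℤ.+ n)))))) ⟩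
  ℚᵘ.mkℚᵘ (ℤ.+ m) 0 ℚᵘ.+ ℚᵘ.mkℚᵘ (ℤ.+ n) 0            ≈⟨ ℚᵘ.+-cong (ιᵘ m) (ιᵘ n) ⟨
  ℚ.toℚᵘ (ι m) ℚᵘ.+ ℚ.toℚᵘ (ι n)                      ≈⟨ ℚ.toℚᵘ-homo-+ (ι m) (ι n) ⟨
  ℚ.toℚᵘ (ι m ℚ.+ ι n)                                ∎)
  where open ℚᵘ.≃-Reasoning

ι-mono : ∀ {m n} → m ≤ n → ι m ℚ.≤ ι n
ι-mono {m} {n} m≤n = ℚ.toℚᵘ-cancel-≤ (begin
  ℚ.toℚᵘ (ι m)        ≃⟨ ιᵘ m ⟩
  ℚᵘ.mkℚᵘ (ℤ.+ m) 0   ≤⟨ ℚᵘ.*≤* (ℤ.*-monoʳ-≤-nonNeg (ℤ.+ 1) (ℤ.+≤+ m≤n)) ⟩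
  ℚᵘ.mkℚᵘ (ℤ.+ n) 0   ≃⟨ ιᵘ n ⟨
  ℚ.toℚᵘ (ι n)        ∎)
  where open ℚᵘ.≤-Reasoning

ι-cancel : ∀ {m n} → ι m ℚ.≤ ι n → m ≤ n
ι-cancel {m} {n} ιm≤ιn with ℚᵘ.≤-respˡ-≃ (ιᵘ m) (ℚᵘ.≤-respʳ-≃ (ιᵘ n) (ℚ.toℚᵘ-mono-≤ ιm≤ιn))
... | ℚᵘ.*≤* le with ℤ.*-cancelʳ-≤-pos (ℤ.+ m) (ℤ.+ n) (ℤ.+ 1) le
...   | ℤ.+≤+ m≤n = m≤n

-- Every constraint on a schedule is a gap of integral length. Gaps compose by adding lengths, so a
-- chain from 0 to the deadline turns into an inequality of natural numbers.
record Gap (n : ℕ) (x y : ℚ) : Set where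
  constructor apart
  field ungap : x ℚ.+ ι n ℚ.≤ y

gap-refl : ∀ n x → Gap n x (x ℚ.+ ι n)
gap-refl n x = apart ℚ.≤-refl

gap-trans : ∀ {m n x y z} → Gap m x y → Gap n y z → Gap (m + n) x z
gap-trans {m} {n} {x} {y} {z} (apart xy) (apart yz) = apart (begin
  x ℚ.+ ι (m + n)          ≡⟨ cong (x ℚ.+_) (ι-+ m n) ⟩
  x ℚ.+ (ι m ℚ.+ ι n)      ≡⟨ ℚ.+-assoc x (ι m) (ι n) ⟨
  x ℚ.+ ι m ℚ.+ ι n        ≤⟨ ℚ.+-monoˡ-≤ (ι n) xy ⟩
  y ℚ.+ ι n                ≤⟨ yz ⟩
  z                        ∎)
  where open ℚ.≤-Reasoning

gap-weaken : ∀ {m n x y} → m ≤ n → Gap n x y → Gap m x y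
gap-weaken {x = x} m≤n (apart g) = apart (ℚ.≤-trans (ℚ.+-monoʳ-≤ x (ι-mono m≤n)) g)

gap-forget : ∀ {n x y} → Gap n x y → Gap 0 x y
gap-forget = gap-weaken z≤n

≤⇒gap : ∀ {x y} → x ℚ.≤ y → Gap 0 x y
≤⇒gap {x} {y} x≤y = apart (subst (ℚ._≤ y) (sym (ℚ.+-identityʳ x)) x≤y)

gap-shift : ∀ {n x y} → Gap n x y → Gap 0 (x ℚ.+ ι n) y
gap-shift (apart g) = ≤⇒gap g

gap-bound : ∀ {m n} → Gap m 0ℚ (ι n) → m ≤ n
gap-bound {m} {n} (apart g) = ι-cancel (subst (ℚ._≤ ι n) (ℚ.+-identityˡ (ι m)) g)

gap-irrefl : ∀ {n x} → 0 < n → ¬ Gap n x x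
gap-irrefl {n} {x} 0<n (apart loop) = <⇒≱ 0<n (ι-cancel (begin
    ι n                          ≡⟨ ℚ.+-identityˡ (ι n) ⟨
    0ℚ ℚ.+ ι n                   ≡⟨ cong (ℚ._+ ι n) (ℚ.+-inverseˡ x) ⟨
    ℚ.- x ℚ.+ x ℚ.+ ι n          ≡⟨ ℚ.+-assoc (ℚ.- x) x (ι n) ⟩
    ℚ.- x ℚ.+ (x ℚ.+ ι n)        ≤⟨ ℚ.+-monoʳ-≤ (ℚ.- x) loop ⟩
    ℚ.- x ℚ.+ x                  ≡⟨ ℚ.+-inverseˡ x ⟩
    0ℚ                           ∎))
  where open ℚ.≤-Reasoning

-- Splitting a list in two

interleaving-map : ∀ {X Y : Set} (f : X → Y) {ls rs xs} → Interleaving ls rs xs →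
                   Interleaving (map f ls) (map f rs) (map f xs)
interleaving-map f []        = []
interleaving-map f (consˡ i) = consˡ (interleaving-map f i)
interleaving-map f (consʳ i) = consʳ (interleaving-map f i)

interleaving-sum : ∀ {ls rs xs} → Interleaving ls rs xs → sum ls + sum rs ≡ sum xs
interleaving-sum []                   = refl
interleaving-sum {l ∷ ls} {rs} (consˡ i) =
  trans (+-assoc l (sum ls) (sum rs)) (cong (l +_) (interleaving-sum i))
interleaving-sum {ls} {r ∷ rs} (consʳ i) =
  trans (shuffle (sum ls) r (sum rs)) (cong (r +_) (interleaving-sum i))
  where
  shuffle : ∀ a b c → a + (b + c) ≡ b + (a + c)
  shuffle = solve-∀

module _ {X : Set} where

  total : (X → ℕ) → List X → ℕ
  total p xs = sum (map p xs)

  interleaving-All : ∀ {P : X → Set} {ls rs xs} → Interleaving ls rs xs → All P xs → All P ls × All P rs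
  interleaving-All []        []       = [] , []
  interleaving-All (consˡ i) (q ∷ qs) = let a , b = interleaving-All i qs in q ∷ a , b
  interleaving-All (consʳ i) (q ∷ qs) = let a , b = interleaving-All i qs in a , q ∷ b

  interleaving-AllPairs : ∀ {R : X → X → Set} {ls rs xs} → Interleaving ls rs xs →
                          AllPairs R xs → AllPairs R ls × AllPairs R rs
  interleaving-AllPairs []        []       = [] , []
  interleaving-AllPairs (consˡ i) (q ∷ qs) =
    let a , b = interleaving-AllPairs i qs in proj₁ (interleaving-All i q) ∷ a , b
  interleaving-AllPairs (consʳ i) (q ∷ qs) =
    let a , b = interleaving-AllPairs i qs in a , proj₂ (interleaving-All i q) ∷ b

  separate : ∀ {P Q : X → Set} {xs} → All (λ x → P x ⊎ Q x) xs →
             ∃₂ λ ls rs → Interleaving ls rs xs × All P ls × All Q rs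
  separate []            = [] , [] , [] , [] , []
  separate (inj₁ a ∷ as) = let _ , _ , i , ps , qs = separate as in _ , _ , consˡ i , a ∷ ps , qs
  separate (inj₂ a ∷ as) = let _ , _ , i , ps , qs = separate as in _ , _ , consʳ i , ps , a ∷ qs

  interleaving-length : ∀ {ls rs xs : List X} → Interleaving ls rs xs →
                        length ls ≤ length xs × length rs ≤ length xs
  interleaving-length []        = z≤n , z≤n
  interleaving-length (consˡ i) = let a , b = interleaving-length i in s≤s a , m≤n⇒m≤1+n b
  interleaving-length (consʳ i) = let a , b = interleaving-length i in m≤n⇒m≤1+n a , s≤s b

-- Packing jobs into a time window

module _ {X : Set} (p : X → ℕ) where

  Disjoint : (X → ℚ) → X → X → Set
  Disjoint s j k = Gap (p j) (s j) (s k) ⊎ Gap (p k) (s k) (s j)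

  -- As in quicksort, the first job is a pivot: the jobs before it fill the window up to its start,
  -- those after it the window from its end on. The two parts are not structurally smaller than the
  -- list, so the recursion runs on a bound on the length.
  window : ∀ (s : X → ℚ) {α β} (js : List X) → Gap 0 α β →
           All (λ j → Gap 0 α (s j)) js → All (λ j → Gap (p j) (s j) β) js →
           AllPairs (Disjoint s) js → Gap (total p js) α β
  window s js = go (length js) js ≤-refl
    where
    go : ∀ n {α β} (js : List X) → length js ≤ n → Gap 0 α β →
         All (λ j → Gap 0 α (s j)) js → All (λ j → Gap (p j) (s j) β) js →
         AllPairs (Disjoint s) js → Gap (total p js) α β
    go _       []       _         αβ _         _         _        = αβ
    go (suc n) {α} {β} (j ∷ js) (s≤s len) αβ (α≤ ∷ α≤s) (≤β ∷ ≤βs) (d ∷ ds)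
      with bs , cs , i , before , after ← separate (All.map Sum.swap d)
      with b≤ , c≤ ← interleaving-length i
      with αb , αc ← interleaving-All i α≤s
      with βb , βc ← interleaving-All i ≤βs
      with db , dc ← interleaving-AllPairs i ds
      = subst (λ n → Gap n α β) eq (gap-trans early (gap-trans (gap-refl (p j) (s j)) late))
      where
      early : Gap (total p bs) α (s j)
      early = go n bs (≤-trans b≤ len) α≤ αb before db

      late : Gap (total p cs) (s j ℚ.+ ι (p j)) β
      late = go n cs (≤-trans c≤ len) (gap-shift ≤β) (All.map gap-shift after) βc dc

      eq : total p bs + (p j + total p cs) ≡ p j + total p js
      eq = trans (+-comm (total p bs) _) (trans (+-assoc (p j) _ _)
             (cong (p j +_) (trans (+-comm (total p cs) _) (interleaving-sum (interleaving-map p i)))))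

  -- The jobs before J on the first machine precede J there, the others follow J on the second one.
  two-machine-window :
    ∀ (u v : X → ℚ) {α β} J (js : List X) → let xs = J ∷ js in
    All (λ j → Gap 0 α (u j)) xs → All (λ j → Gap (p j) (u j) (v j)) xs →
    All (λ j → Gap (p j) (v j) β) xs →
    AllPairs (Disjoint u) xs → AllPairs (Disjoint v) xs →
    Gap (p J + (p J + total p js)) α β
  two-machine-window u v {α} {β} J js (αJ ∷ αs) (uvJ ∷ uvs) (βJ ∷ βs) (duJ ∷ du) (dvJ ∷ dv)
    with bs , cs , i , before , after ← separate (All.map Sum.swap duJ)
    with αb , _ ← interleaving-All i αs
    with _ , uvc ← interleaving-All i uvs
    with _ , βc ← interleaving-All i βs
    with dub , _ ← interleaving-AllPairs i du
    with _ , dvc ← interleaving-AllPairs i dv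
    with _ , dvJc ← interleaving-All i dvJ
    = subst (λ n → Gap n α β) eq (gap-trans early (gap-trans (gap-refl (p J) (u J)) late))
    where
    early : Gap (total p bs) α (u J)
    early = window u bs αJ αb before dub

    late : Gap (p J + total p cs) (u J ℚ.+ ι (p J)) β
    late = window v (J ∷ cs) (gap-trans (gap-shift uvJ) (gap-forget βJ))
      (gap-shift uvJ ∷ All.zipWith (λ (a , b) → gap-trans (gap-shift a) (gap-forget b)) (after , uvc))
      (βJ ∷ βc) (dvJc ∷ dvc)

    shuffle : ∀ b J c → b + (J + (J + c)) ≡ J + (J + (b + c))
    shuffle = solve-∀

    eq : total p bs + (p J + (p J + total p cs)) ≡ p J + (p J + total p js)
    eq = trans (shuffle (total p bs) (p J) (total p cs))
           (cong (λ n → p J + (p J + n)) (interleaving-sum (interleaving-map p i)))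

maximum-≤⁻ : ∀ xs {z} → maximum xs ℚ.≤ z → All (ℚ._≤ z) xs
maximum-≤⁻ []       _ = []
maximum-≤⁻ (x ∷ xs) h =
  ℚ.≤-trans (ℚ.p≤p⊔q x (maximum xs)) h ∷ maximum-≤⁻ xs (ℚ.≤-trans (ℚ.p≤q⊔p x (maximum xs)) h)

map-lookup-allFin : ∀ {A : Set} (xs : List A) → map (lookup xs) (allFin (length xs)) ≡ xs
map-lookup-allFin xs = trans (map-tabulate id (lookup xs)) (tabulate-lookup xs)

-- The bound of `two-machine-window` with the head as the distinguished job. The head is enough
-- because the instance lists its two large jobs first.
HeadFits : ℕ → List ℕ → Set
HeadFits q xs = ∀ x xs′ → xs ≡ x ∷ xs′ → x + (x + sum xs′) ≤ q

-- Lower bound: a makespan of 3 q splits the flow-shop jobs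

module LowerBound
  (ps : List⁺ ℕ) (q : ℕ) (positive : All (0 <_) (toList ps)) (0<q : 0 < q)
  (S : Schedule (shop ps q)) (feasible : Feasible (shop ps q) S)
  (short : makespan (shop ps q) S ℚ.≤ ι (q + (q + q))) where

  open Feasible feasible

  private
    E : ℚ
    E = ι (q + (q + q))

    F : Set
    F = FlowIndex (shop ps q)

    p : F → ℕ
    p = lookup (toList ps)

    s : Machine → F → ℚ
    s μ i = S (flowJob i) μ

    o : Machine → ℚ
    o = S openJob

    fs : List F
    fs = allFin _

    starts : ∀ j μ → Gap 0 0ℚ (S j μ)
    starts j μ = ≤⇒gap (nonNegative j μ)

    ends : ∀ j μ → Gap (time _ j) (S j μ) E
    ends j μ = apart (machine-bound μ (maximum-≤⁻ (map (completion _ S j) machines) (job-bound j)))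
      where
      job-bounds : All (λ j → jobCompletion _ S j ℚ.≤ E) (jobs _)
      job-bounds = All.map⁻ (maximum-≤⁻ (map (jobCompletion _ S) (jobs _)) short)

      job-bound : ∀ j → jobCompletion _ S j ℚ.≤ E
      job-bound openJob     = All.head job-bounds
      job-bound (flowJob i) = All.lookup job-bounds (there (∈-map⁺ flowJob (∈-allFin i)))

      machine-bound : ∀ μ → All (ℚ._≤ E) (map (completion _ S j) machines) → completion _ S j μ ℚ.≤ E
      machine-bound M₁ (h ∷ _)         = h
      machine-bound M₂ (_ ∷ h ∷ _)     = h
      machine-bound M₃ (_ ∷ _ ∷ h ∷ _) = h

    s₁₂ : ∀ i → Gap (p i) (s M₁ i) (s M₂ i)
    s₁₂ i = apart (flow₁₂ i)

    s₂₃ : ∀ i → Gap (p i) (s M₂ i) (s M₃ i)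
    s₂₃ i = apart (flow₂₃ i)

    disjoint : ∀ μ → AllPairs (Disjoint p (s μ)) fs
    disjoint μ = AllPairs.map
      (λ i≢k → Sum.map apart apart (oneJobPerMachine μ (λ { refl → i≢k refl })))
      (Unique.allFin⁺ _)

    open-order : ∀ {μ ν} → μ ≢ ν → Gap q (o μ) (o ν) ⊎ Gap q (o ν) (o μ)
    open-order μ≢ν = Sum.map apart apart (oneMachinePerJob openJob μ≢ν)

    open-flow : ∀ μ i → Gap (p i) (s μ i) (o μ) ⊎ Gap q (o μ) (s μ i)
    open-flow μ i = Sum.map apart apart (oneJobPerMachine μ (λ ()))

    0<p : ∀ i → 0 < p i
    0<p i = All.lookup positive (∈-lookup i)

    -- The exclusions below are chains of the three operations of the open-shop job and one positive
    -- flow-shop operation; the primed variants differ in the position of the latter.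
    overfull : ∀ {n} → 0 < n → ¬ Gap (n + (q + (q + q))) 0ℚ E
    overfull {n} 0<n g = <⇒≱ 0<n (+-cancelʳ-≤ (q + (q + q)) n 0 (gap-bound g))

    overfull′ : ∀ {n} → 0 < n → ¬ Gap (q + (q + (q + n))) 0ℚ E
    overfull′ {n} 0<n g = overfull 0<n (subst (λ m → Gap m 0ℚ E) (shuffle q n) g)
      where
      shuffle : ∀ q n → q + (q + (q + n)) ≡ n + (q + (q + q))
      shuffle = solve-∀

    overfull″ : ∀ {n} → 0 < n → ¬ Gap (q + (q + (n + q))) 0ℚ E
    overfull″ {n} 0<n g = overfull′ 0<n (subst (λ m → Gap (q + (q + m)) 0ℚ E) (+-comm n q) g)

    middle : ∀ {n x y} → Gap q 0ℚ x → Gap n x y → Gap q y E → n ≤ q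
    middle {n} a b c = +-cancelʳ-≤ q n q (+-cancelˡ-≤ q _ _ (gap-bound (gap-trans a (gap-trans b c))))

    -- Covers the orders 123, 132 and 213 of the open-shop job. A flow-shop job before it on `a`
    -- would precede all its three operations, one after it on `b` would follow all three; both
    -- exceed 3 q. So on `b` all flow-shop jobs run between its first and its last operation, a time
    -- of at most q.
    first-last : ∀ {a b c} → (∀ i → Gap 0 (s a i) (s b i)) →
                 Gap q (o a) (o c) → Gap q (o c) (o b) → total p fs ≤ q
    first-last {a} {b} {c} flow ac cb =
      middle (gap-trans (starts openJob a) (gap-refl q (o a)))
        (window p (s b) fs (gap-trans (gap-shift ac) (gap-forget cb))
          (All.tabulate⁺ {f = id} λ i → gap-trans (gap-shift (follows i)) (flow i))
          (All.tabulate⁺ {f = id} precedes) (disjoint b))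
        (ends openJob b)
      where
      follows : ∀ i → Gap q (o a) (s a i)
      follows i with open-flow a i
      ... | inj₂ g = g
      ... | inj₁ g = ⊥-elim (overfull (0<p i)
        (gap-trans (starts (flowJob i) a) (gap-trans g (gap-trans ac (gap-trans cb (ends openJob b))))))

      precedes : ∀ i → Gap (p i) (s b i) (o b)
      precedes i with open-flow b i
      ... | inj₁ g = g
      ... | inj₂ g = ⊥-elim (overfull′ (0<p i)
        (gap-trans (starts openJob a) (gap-trans ac (gap-trans cb (gap-trans g (ends (flowJob i) b))))))

    -- On M₂ every job comes after the open-shop job. Hence on M₃ as well: otherwise the job would
    -- run there between the first two operations of the open-shop job, which have no pause to
    -- spare. So M₃ has only the last q units of time for all jobs.
    order-231 : Gap q (o M₂) (o M₃) → Gap q (o M₃) (o M₁) → total p fs ≤ q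
    order-231 g₂₃ g₃₁ = +-cancelˡ-≤ q _ _ (+-cancelˡ-≤ q _ _ (gap-bound
      (gap-trans (starts openJob M₂) (gap-trans g₂₃ (gap-trans (gap-refl q (o M₃))
        (window p (s M₃) fs (gap-trans (gap-shift g₃₁) (gap-forget (ends openJob M₁)))
          (All.tabulate⁺ {f = id} (gap-shift ∘ follows₃))
          (All.tabulate⁺ {f = id} λ i → ends (flowJob i) M₃) (disjoint M₃)))))))
      where
      follows₂ : ∀ i → Gap q (o M₂) (s M₂ i)
      follows₂ i with open-flow M₂ i
      ... | inj₂ g = g
      ... | inj₁ g = ⊥-elim (overfull (0<p i) (gap-trans (starts (flowJob i) M₂)
        (gap-trans g (gap-trans g₂₃ (gap-trans g₃₁ (ends openJob M₁))))))

      follows₃ : ∀ i → Gap q (o M₃) (s M₃ i)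
      follows₃ i with open-flow M₃ i
      ... | inj₂ g = g
      ... | inj₁ g = ⊥-elim (overfull (0<p i) (subst (λ m → Gap m 0ℚ E) (shuffle q (p i))
        (gap-trans (starts openJob M₂) (gap-trans (follows₂ i) (gap-trans (gap-forget (s₂₃ i))
          (gap-trans g (gap-trans g₃₁ (ends openJob M₁))))))))
        where
        shuffle : ∀ q n → q + (n + (q + q)) ≡ n + (q + (q + q))
        shuffle = solve-∀

    -- `order-231` with time reversed and M₁ and M₃ exchanged.
    order-312 : Gap q (o M₃) (o M₁) → Gap q (o M₁) (o M₂) → total p fs ≤ q
    order-312 g₃₁ g₁₂ = +-cancelʳ-≤ (q + q) _ _ (gap-bound (gap-trans
      (window p (s M₁) fs (starts openJob M₁)
        (All.tabulate⁺ {f = id} λ i → starts (flowJob i) M₁)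
        (All.tabulate⁺ {f = id} precedes₁) (disjoint M₁))
      (gap-trans g₁₂ (ends openJob M₂))))
      where
      precedes₂ : ∀ i → Gap (p i) (s M₂ i) (o M₂)
      precedes₂ i with open-flow M₂ i
      ... | inj₁ g = g
      ... | inj₂ g = ⊥-elim (overfull′ (0<p i) (gap-trans (starts openJob M₃)
        (gap-trans g₃₁ (gap-trans g₁₂ (gap-trans g (ends (flowJob i) M₂))))))

      precedes₁ : ∀ i → Gap (p i) (s M₁ i) (o M₁)
      precedes₁ i with open-flow M₁ i
      ... | inj₁ g = g
      ... | inj₂ g = ⊥-elim (overfull″ (0<p i) (gap-trans (starts openJob M₃)
        (gap-trans g₃₁ (gap-trans g (gap-trans (gap-forget (s₁₂ i))
          (gap-trans (precedes₂ i) (ends openJob M₂)))))))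

    -- A job before the open-shop job on M₂ passes M₁ and M₂ before the last two operations of the
    -- open-shop job; a job after it passes M₂ and M₃ after the first two. Either way two operations
    -- of length q take up the rest of 3 q.
    order-321 : Gap q (o M₃) (o M₂) → Gap q (o M₂) (o M₁) →
      ∃₂ λ xs ys → Interleaving xs ys (toList ps) × HeadFits q xs × HeadFits q ys
    order-321 g₃₂ g₂₁
      with is , js , mix , precedes , follows ← separate (All.tabulate⁺ {f = id} (open-flow M₂))
      = map p is , map p js
      , subst (Interleaving _ _) (map-lookup-allFin (toList ps)) (interleaving-map p mix)
      , fits-early is precedes (disjoints M₁ .proj₁) (disjoints M₂ .proj₁)
      , fits-late js follows (disjoints M₂ .proj₂) (disjoints M₃ .proj₂)
      where
      disjoints : ∀ μ → AllPairs (Disjoint p (s μ)) _ × AllPairs (Disjoint p (s μ)) _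
      disjoints μ = interleaving-AllPairs mix (disjoint μ)

      fits-early : ∀ is → All (λ i → Gap (p i) (s M₂ i) (o M₂)) is →
                   AllPairs (Disjoint p (s M₁)) is → AllPairs (Disjoint p (s M₂)) is →
                   HeadFits q (map p is)
      fits-early (i ∷ is) early d₁ d₂ _ _ refl = +-cancelʳ-≤ (q + q) _ _ (gap-bound (gap-trans
        (two-machine-window p (s M₁) (s M₂) i is
          (All.universal (λ k → starts (flowJob k) M₁) _) (All.universal s₁₂ _) early d₁ d₂)
        (gap-trans g₂₁ (ends openJob M₁))))

      fits-late : ∀ js → All (λ j → Gap q (o M₂) (s M₂ j)) js →
                  AllPairs (Disjoint p (s M₂)) js → AllPairs (Disjoint p (s M₃)) js →
                  HeadFits q (map p js)
      fits-late (j ∷ js) late d₂ d₃ _ _ refl = +-cancelˡ-≤ q _ _ (+-cancelˡ-≤ q _ _ (gap-bound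
        (gap-trans (starts openJob M₃) (gap-trans g₃₂ (gap-trans (gap-refl q (o M₂))
          (two-machine-window p (s M₂) (s M₃) j js
            (All.map gap-shift late) (All.universal s₂₃ _)
            (All.universal (λ k → ends (flowJob k) M₃) _) d₂ d₃))))))

    cycle : ∀ {x y z} → Gap q x y → Gap q y z → Gap q z x → ⊥
    cycle xy yz zx = gap-irrefl (≤-trans 0<q (m≤m+n q (q + q))) (gap-trans xy (gap-trans yz zx))

  -- Of the eight combinations of pairwise precedences two are cyclic, five force all jobs into a
  -- time q on one machine, and one gives the split.
  halves : q < sum (toList ps) →
           ∃₂ λ xs ys → Interleaving xs ys (toList ps) × HeadFits q xs × HeadFits q ys
  halves q<sum = cases (open-order (λ ())) (open-order (λ ())) (open-order (λ ()))
    where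
    crowded : ∀ {A : Set} → total p fs ≤ q → A
    crowded h = ⊥-elim (<⇒≱ q<sum (subst (_≤ q) (cong sum (map-lookup-allFin (toList ps))) h))

    cases : Gap q (o M₁) (o M₂) ⊎ Gap q (o M₂) (o M₁) →
            Gap q (o M₁) (o M₃) ⊎ Gap q (o M₃) (o M₁) →
            Gap q (o M₂) (o M₃) ⊎ Gap q (o M₃) (o M₂) → _
    cases (inj₁ g₁₂) (inj₁ g₁₃) (inj₁ g₂₃) =
      crowded (first-last (λ i → gap-forget (gap-trans (s₁₂ i) (s₂₃ i))) g₁₂ g₂₃)
    cases (inj₁ g₁₂) (inj₁ g₁₃) (inj₂ g₃₂) = crowded (first-last (gap-forget ∘ s₁₂) g₁₃ g₃₂)
    cases (inj₁ g₁₂) (inj₂ g₃₁) (inj₁ g₂₃) = ⊥-elim (cycle g₁₂ g₂₃ g₃₁)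
    cases (inj₁ g₁₂) (inj₂ g₃₁) (inj₂ g₃₂) = crowded (order-312 g₃₁ g₁₂)
    cases (inj₂ g₂₁) (inj₁ g₁₃) (inj₁ g₂₃) = crowded (first-last (gap-forget ∘ s₂₃) g₂₁ g₁₃)
    cases (inj₂ g₂₁) (inj₁ g₁₃) (inj₂ g₃₂) = ⊥-elim (cycle g₃₂ g₂₁ g₁₃)
    cases (inj₂ g₂₁) (inj₂ g₃₁) (inj₁ g₂₃) = crowded (order-231 g₂₃ g₃₁)
    cases (inj₂ g₂₁) (inj₂ g₃₁) (inj₂ g₃₂) = order-321 g₃₂ g₂₁

-- Upper bound: a schedule from a split

data Side : Set where
  early late : Side

pick : Side → ℕ → ℕ → ℕ
pick early a b = a
pick late  a b = b

module _ {A : Set} where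

  side : ∀ {ls rs xs : List A} → Interleaving ls rs xs → Fin (length xs) → Side
  side (consˡ _) zero    = early
  side (consʳ _) zero    = late
  side (consˡ i) (suc k) = side i k
  side (consʳ i) (suc k) = side i k

-- The sum of the preceding entries on the same side; a and b are those of the entries seen before.
offset : ∀ {ls rs xs : List ℕ} → Interleaving ls rs xs → ℕ → ℕ → Fin (length xs) → ℕ
offset (consˡ _)     a b zero    = a
offset (consʳ _)     a b zero    = b
offset {l ∷ _} (consˡ i) a b (suc k) = offset i (a + l) b k
offset {_} {r ∷ _} (consʳ i) a b (suc k) = offset i a (b + r) k

offset-lower : ∀ {ls rs xs : List ℕ} (i : Interleaving ls rs xs) a b k →
               pick (side i k) a b ≤ offset i a b k
offset-lower (consˡ _) a b zero = ≤-refl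
offset-lower (consʳ _) a b zero = ≤-refl
offset-lower {l ∷ _} (consˡ i) a b (suc k) with side i k | offset-lower i (a + l) b k
... | early | h = ≤-trans (m≤m+n a l) h
... | late  | h = h
offset-lower {_} {r ∷ _} (consʳ i) a b (suc k) with side i k | offset-lower i a (b + r) k
... | early | h = h
... | late  | h = ≤-trans (m≤m+n b r) h

offset-upper : ∀ {ls rs xs : List ℕ} (i : Interleaving ls rs xs) a b k →
               offset i a b k + lookup xs k ≤ pick (side i k) (a + sum ls) (b + sum rs)
offset-upper {l ∷ ls} (consˡ _) a b zero = +-monoʳ-≤ a (m≤m+n l (sum ls))
offset-upper {_} {r ∷ rs} (consʳ _) a b zero = +-monoʳ-≤ b (m≤m+n r (sum rs))
offset-upper {l ∷ ls} (consˡ i) a b (suc k) with side i k | offset-upper i (a + l) b k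
... | early | h = ≤-trans h (≤-reflexive (+-assoc a l (sum ls)))
... | late  | h = h
offset-upper {_} {r ∷ rs} (consʳ i) a b (suc k) with side i k | offset-upper i a (b + r) k
... | early | h = h
... | late  | h = ≤-trans h (≤-reflexive (+-assoc b r (sum rs)))

offset-disjoint : ∀ {ls rs xs : List ℕ} (i : Interleaving ls rs xs) a b {j k} → j ≢ k → side i j ≡ side i k →
                  offset i a b j + lookup xs j ≤ offset i a b k ⊎
                  offset i a b k + lookup xs k ≤ offset i a b j
offset-disjoint {xs = _ ∷ _} i a b {zero} {zero}  j≢k _ = contradiction refl j≢k
offset-disjoint {l ∷ _} (consˡ i) a b {zero} {suc k} _ eq with side i k | offset-lower i (a + l) b k
offset-disjoint (consˡ i) a b {zero} {suc k} _ refl | early | h = inj₁ h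
offset-disjoint {_} {r ∷ _} (consʳ i) a b {zero} {suc k} _ eq with side i k | offset-lower i a (b + r) k
offset-disjoint (consʳ i) a b {zero} {suc k} _ refl | late | h = inj₁ h
offset-disjoint {l ∷ _} (consˡ i) a b {suc j} {zero} _ eq with side i j | offset-lower i (a + l) b j
offset-disjoint (consˡ i) a b {suc j} {zero} _ refl | early | h = inj₂ h
offset-disjoint {_} {r ∷ _} (consʳ i) a b {suc j} {zero} _ eq with side i j | offset-lower i a (b + r) j
offset-disjoint (consʳ i) a b {suc j} {zero} _ refl | late | h = inj₂ h
offset-disjoint (consˡ i) a b {suc j} {suc k} j≢k eq = offset-disjoint i _ b (j≢k ∘ cong suc) eq
offset-disjoint (consʳ i) a b {suc j} {suc k} j≢k eq = offset-disjoint i a _ (j≢k ∘ cong suc) eq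

lookup-pick-≤ : ∀ {ls rs xs : List ℕ} (i : Interleaving ls rs xs) {Λ M} →
                All (_≤ Λ) ls → All (_≤ M) rs → ∀ k → lookup xs k ≤ pick (side i k) Λ M
lookup-pick-≤ (consˡ i) (h ∷ _) rs zero = h
lookup-pick-≤ (consʳ i) ls (h ∷ _) zero = h
lookup-pick-≤ (consˡ i) (_ ∷ ls) rs (suc k) = lookup-pick-≤ i ls rs k
lookup-pick-≤ (consʳ i) ls (_ ∷ rs) (suc k) = lookup-pick-≤ i ls rs k

maximum-≤⁺ : ∀ {xs z} → 0ℚ ℚ.≤ z → All (ℚ._≤ z) xs → maximum xs ℚ.≤ z
maximum-≤⁺ 0≤z []       = 0≤z
maximum-≤⁺ 0≤z (h ∷ hs) = ℚ.⊔-lub h (maximum-≤⁺ 0≤z hs)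

module UpperBound
  (ps : List⁺ ℕ) (q : ℕ) {ls rs : List ℕ} (mix : Interleaving ls rs (toList ps))
  {Λ M : ℕ} (ls≤Λ : All (_≤ Λ) ls) (rs≤M : All (_≤ M) rs)
  (ls-fit : sum ls + Λ ≤ q) (rs-fit : sum rs + M ≤ q) where

  private
    F : Set
    F = FlowIndex (shop ps q)

    p : F → ℕ
    p = lookup (toList ps)

    -- Each side runs as one batch, with the same offsets on every machine. Where a batch has to
    -- pass two machines within one window of length q, it is shifted by the bound `Λ` or `M` on its
    -- jobs, so that each job has left the one machine when it is due on the other.
    delay : Side → Machine → ℕ
    delay early M₁ = 0
    delay early M₂ = Λ
    delay early M₃ = q
    delay late  M₁ = q
    delay late  M₂ = q + q
    delay late  M₃ = M + (q + q)

    σ : F → Side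
    σ = side mix

    off : F → ℕ
    off = offset mix 0 0

    start : Job (shop ps q) → Machine → ℕ
    start (flowJob i) μ  = off i + delay (σ i) μ
    start openJob     M₁ = q + q
    start openJob     M₂ = q
    start openJob     M₃ = 0

    schedule : Schedule (shop ps q)
    schedule j μ = ι (start j μ)

    finishes-by : ∀ j μ c → start j μ + time _ j ≤ c → completion _ schedule j μ ℚ.≤ ι c
    finishes-by j μ c h = subst (ℚ._≤ ι c) (ι-+ (start j μ) (time _ j)) (ι-mono h)

    precedes : ∀ j μ k ν → start j μ + time _ j ≤ start k ν → completion _ schedule j μ ℚ.≤ schedule k ν
    precedes j μ k ν = finishes-by j μ (start k ν)

    off≤ : ∀ i → off i + p i ≤ pick (σ i) (sum ls) (sum rs)
    off≤ = offset-upper mix 0 0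

    M≤q : M ≤ q
    M≤q = ≤-trans (m≤n+m M (sum rs)) rs-fit

    ls≤q : sum ls ≤ q
    ls≤q = ≤-trans (m≤m+n (sum ls) Λ) ls-fit

    rs≤q : sum rs ≤ q
    rs≤q = ≤-trans (m≤m+n (sum rs) M) rs-fit

    delay₁₂ : ∀ i → p i + delay (σ i) M₁ ≤ delay (σ i) M₂
    delay₁₂ i with σ i | lookup-pick-≤ mix ls≤Λ rs≤M i
    ... | early | h = ≤-trans (≤-reflexive (+-identityʳ (p i))) h
    ... | late  | h = +-monoˡ-≤ q (≤-trans h M≤q)

    delay₂₃ : ∀ i → p i + delay (σ i) M₂ ≤ delay (σ i) M₃
    delay₂₃ i with σ i | lookup-pick-≤ mix ls≤Λ rs≤M i | off≤ i
    ... | early | _ | h = ≤-trans (+-monoˡ-≤ Λ (≤-trans (m≤n+m (p i) (off i)) h)) ls-fit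
    ... | late  | h | _ = +-monoˡ-≤ (q + q) h

    advance : ∀ i {μ ν} → p i + delay (σ i) μ ≤ delay (σ i) ν →
              start (flowJob i) μ + p i ≤ start (flowJob i) ν
    advance i {μ} {ν} h = begin
      off i + delay (σ i) μ + p i     ≡⟨ +-assoc (off i) _ _ ⟩
      off i + (delay (σ i) μ + p i)   ≡⟨ cong (off i +_) (+-comm _ (p i)) ⟩
      off i + (p i + delay (σ i) μ)   ≤⟨ +-monoʳ-≤ (off i) h ⟩
      off i + delay (σ i) ν           ∎
      where open ≤-Reasoning

    start₁₂ : ∀ i → start (flowJob i) M₁ + p i ≤ start (flowJob i) M₂
    start₁₂ i = advance i (delay₁₂ i)

    start₂₃ : ∀ i → start (flowJob i) M₂ + p i ≤ start (flowJob i) M₃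
    start₂₃ i = advance i (delay₂₃ i)

    start₁₃ : ∀ i → start (flowJob i) M₁ + p i ≤ start (flowJob i) M₃
    start₁₃ i = ≤-trans (start₁₂ i) (≤-trans (m≤m+n _ (p i)) (start₂₃ i))

    finish : ∀ i μ → start (flowJob i) μ + p i ≤ pick (σ i) (sum ls) (sum rs) + delay (σ i) μ
    finish i μ = begin
      off i + delay (σ i) μ + p i     ≡⟨ +-assoc (off i) _ _ ⟩
      off i + (delay (σ i) μ + p i)   ≡⟨ cong (off i +_) (+-comm _ (p i)) ⟩
      off i + (p i + delay (σ i) μ)   ≡⟨ +-assoc (off i) _ _ ⟨
      off i + p i + delay (σ i) μ     ≤⟨ +-monoˡ-≤ (delay (σ i) μ) (off≤ i) ⟩
      pick (σ i) (sum ls) (sum rs) + delay (σ i) μ   ∎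
      where open ≤-Reasoning

    early-before-late : ∀ μ → sum ls + delay early μ ≤ delay late μ
    early-before-late M₁ = ≤-trans (≤-reflexive (+-identityʳ (sum ls))) ls≤q
    early-before-late M₂ = ≤-trans ls-fit (m≤m+n q q)
    early-before-late M₃ = ≤-trans (+-monoˡ-≤ q ls≤q) (m≤n+m (q + q) M)

    shifted : ∀ i k {d} → off i + p i ≤ off k → off i + d + p i ≤ off k + d
    shifted i k {d} h = ≤-trans (≤-reflexive (swap-last (off i) d (p i))) (+-monoˡ-≤ d h)
      where
      swap-last : ∀ a b c → a + b + c ≡ a + c + b
      swap-last = solve-∀

    flow-disjoint : ∀ μ {i k} → i ≢ k → start (flowJob i) μ + p i ≤ start (flowJob k) μ ⊎
                                        start (flowJob k) μ + p k ≤ start (flowJob i) μ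
    flow-disjoint μ {i} {k} i≢k with σ i in σi | σ k in σk | finish i μ | finish k μ
    ... | early | late  | h | _ = inj₁ (≤-trans h (≤-trans (early-before-late μ) (m≤n+m _ (off k))))
    ... | late  | early | _ | h = inj₂ (≤-trans h (≤-trans (early-before-late μ) (m≤n+m _ (off i))))
    ... | early | early | _ | _ = Sum.map (shifted i k) (shifted k i) (offset-disjoint mix 0 0 i≢k (trans σi (sym σk)))
    ... | late  | late  | _ | _ = Sum.map (shifted i k) (shifted k i) (offset-disjoint mix 0 0 i≢k (trans σi (sym σk)))

    flow-open : ∀ μ i → start (flowJob i) μ + p i ≤ start openJob μ ⊎ start openJob μ + q ≤ start (flowJob i) μ
    flow-open M₁ i with σ i | finish i M₁
    ... | early | h = inj₁ (≤-trans h (+-mono-≤ ls≤q z≤n))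
    ... | late  | h = inj₁ (≤-trans h (+-monoˡ-≤ q rs≤q))
    flow-open M₂ i with σ i | finish i M₂
    ... | early | h = inj₁ (≤-trans h ls-fit)
    ... | late  | _ = inj₂ (m≤n+m (q + q) (off i))
    flow-open M₃ i with σ i
    ... | early = inj₂ (m≤n+m q (off i))
    ... | late  = inj₂ (≤-trans (≤-trans (m≤m+n q q) (m≤n+m (q + q) M)) (m≤n+m _ (off i)))

    feasible : Feasible (shop ps q) schedule
    feasible = record
      { nonNegative = λ j μ → ι-mono {0} {start j μ} z≤n
      ; flow₁₂ = λ i → precedes (flowJob i) M₁ (flowJob i) M₂ (start₁₂ i)
      ; flow₂₃ = λ i → precedes (flowJob i) M₂ (flowJob i) M₃ (start₂₃ i)
      ; oneMachinePerJob = λ j {μ} {ν} μ≢ν →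
          Sum.map (precedes j μ j ν) (precedes j ν j μ) (one-machine j μ≢ν)
      ; oneJobPerMachine = λ μ {j} {k} j≢k →
          Sum.map (precedes j μ k μ) (precedes k μ j μ) (one-job μ j≢k)
      }
      where
      one-machine : ∀ j {μ ν} → μ ≢ ν → start j μ + time _ j ≤ start j ν ⊎ start j ν + time _ j ≤ start j μ
      one-machine j           {M₁} {M₁} μ≢ν = contradiction refl μ≢ν
      one-machine j           {M₂} {M₂} μ≢ν = contradiction refl μ≢ν
      one-machine j           {M₃} {M₃} μ≢ν = contradiction refl μ≢ν
      one-machine (flowJob i) {M₁} {M₂} _ = inj₁ (start₁₂ i)
      one-machine (flowJob i) {M₁} {M₃} _ = inj₁ (start₁₃ i)
      one-machine (flowJob i) {M₂} {M₃} _ = inj₁ (start₂₃ i)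
      one-machine (flowJob i) {M₂} {M₁} _ = inj₂ (start₁₂ i)
      one-machine (flowJob i) {M₃} {M₁} _ = inj₂ (start₁₃ i)
      one-machine (flowJob i) {M₃} {M₂} _ = inj₂ (start₂₃ i)
      one-machine openJob     {M₁} {M₂} _ = inj₂ ≤-refl
      one-machine openJob     {M₁} {M₃} _ = inj₂ (m≤m+n q q)
      one-machine openJob     {M₂} {M₃} _ = inj₂ ≤-refl
      one-machine openJob     {M₂} {M₁} _ = inj₁ ≤-refl
      one-machine openJob     {M₃} {M₁} _ = inj₁ (m≤m+n q q)
      one-machine openJob     {M₃} {M₂} _ = inj₁ ≤-refl

      one-job : ∀ μ {j k} → j ≢ k → start j μ + time _ j ≤ start k μ ⊎ start k μ + time _ k ≤ start j μ
      one-job μ {flowJob i} {flowJob k} j≢k = flow-disjoint μ (j≢k ∘ cong flowJob)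
      one-job μ {flowJob i} {openJob}   _   = flow-open μ i
      one-job μ {openJob}   {flowJob k} _   = Sum.swap (flow-open μ k)
      one-job μ {openJob}   {openJob}   j≢k = contradiction refl j≢k

    ends : ∀ j μ → start j μ + time _ j ≤ q + (q + q)
    ends (flowJob i) M₁ = ≤-trans (start₁₃ i) (≤-trans (m≤m+n _ (p i)) (ends (flowJob i) M₃))
    ends (flowJob i) M₂ = ≤-trans (start₂₃ i) (≤-trans (m≤m+n _ (p i)) (ends (flowJob i) M₃))
    ends (flowJob i) M₃ with σ i | finish i M₃
    ... | early | h = ≤-trans h (+-mono-≤ ls≤q (m≤m+n q q))
    ... | late  | h = ≤-trans h (≤-trans (≤-reflexive (sym (+-assoc (sum rs) M (q + q)))) (+-monoˡ-≤ (q + q) rs-fit))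
    ends openJob M₁ = ≤-reflexive (+-comm (q + q) q)
    ends openJob M₂ = m≤n+m (q + q) q
    ends openJob M₃ = m≤m+n q (q + q)

    job-ends : ∀ j → jobCompletion _ schedule j ℚ.≤ ι (q + (q + q))
    job-ends j = maximum-≤⁺ {xs = map (completion _ schedule j) machines} (ι-mono {0} {q + (q + q)} z≤n)
      (ends′ M₁ ∷ ends′ M₂ ∷ ends′ M₃ ∷ [])
      where
      ends′ : ∀ μ → completion _ schedule j μ ℚ.≤ ι (q + (q + q))
      ends′ μ = finishes-by j μ _ (ends j μ)

  scheduled : Σ (Schedule (shop ps q)) λ S → Feasible (shop ps q) S × makespan (shop ps q) S ℚ.≤ ι (q + (q + q))
  scheduled = schedule , feasible
    , maximum-≤⁺ {xs = map (jobCompletion _ schedule) (jobs _)} (ι-mono {0} {q + (q + q)} z≤n)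
        (All.map⁺ (All.universal job-ends (jobs _)))

-- Splits with a prescribed sum as scheduling instances

module BalancedShop
  (L₁ L₂ q tA tB : ℕ) (as : List ℕ)
  (q≡A : q ≡ L₁ + (L₁ + tA)) (q≡B : q ≡ L₂ + (L₂ + tB)) (tA+tB : tA + tB ≡ sum as)
  (0<tA : 0 < tA) (tA<L₂ : tA < L₂) (L₂≤L₁ : L₂ ≤ L₁)
  (as≤L₂ : All (_≤ L₂) as) (0<as : All (0 <_) as) where

  instanceOf : ShopInstance × ℕ
  instanceOf = shop (L₁ ∷⁺ L₂ ∷ as) q , q + (q + q)

  private
    0<L₂ : 0 < L₂
    0<L₂ = ≤-<-trans z≤n tA<L₂

    0<L₁ : 0 < L₁
    0<L₁ = <-≤-trans 0<L₂ L₂≤L₁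

    0<ps : All (0 <_) (L₁ ∷ L₂ ∷ as)
    0<ps = 0<L₁ ∷ 0<L₂ ∷ 0<as

    -- The items sum up to tA + tB, so neither of the two upper bounds can be strict.
    exact : ∀ {A B} → Interleaving A B as → L₁ + (L₁ + sum A) ≤ q → L₂ + (L₂ + sum B) ≤ q → sum A ≡ tA
    exact {A} {B} i a b = ≤-antisym A≤ (+-cancelʳ-≤ tB tA (sum A) (begin
        tA + tB          ≡⟨ trans tA+tB (sym (interleaving-sum i)) ⟩
        sum A + sum B    ≤⟨ +-monoʳ-≤ (sum A) B≤ ⟩
        sum A + tB       ∎))
      where
      open ≤-Reasoning
      A≤ : sum A ≤ tA
      A≤ = +-cancelˡ-≤ L₁ _ _ (+-cancelˡ-≤ L₁ _ _ (subst (L₁ + (L₁ + sum A) ≤_) q≡A a))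

      B≤ : sum B ≤ tB
      B≤ = +-cancelˡ-≤ L₂ _ _ (+-cancelˡ-≤ L₂ _ _ (subst (L₂ + (L₂ + sum B) ≤_) q≡B b))

    -- Next to two copies of L₁ only tA < L₂ is left of q.
    not-both : ∀ {n} → ¬ L₁ + (L₁ + (L₂ + n)) ≤ q
    not-both {n} h = <⇒≱ (<-≤-trans tA<L₂ (m≤m+n L₂ n))
      (+-cancelˡ-≤ L₁ _ _ (+-cancelˡ-≤ L₁ _ _ (subst (L₁ + (L₁ + (L₂ + n)) ≤_) q≡A h)))

  largest : L₁ < q
  largest = subst (L₁ <_) (sym q≡A) (m<m+n L₁ (<-≤-trans 0<L₁ (m≤m+n L₁ tA)))

  0<q : 0 < q
  0<q = ≤-<-trans z≤n largest

  splits : (Σ (Schedule (shop (L₁ ∷⁺ L₂ ∷ as) q)) λ S → Feasible _ S × makespan _ S ℚ.≤ ι (q + (q + q))) →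
           ∃₂ λ A B → Interleaving A B as × sum A ≡ tA
  splits (S , feasible , short) with LowerBound.halves (L₁ ∷⁺ L₂ ∷ as) q 0<ps 0<q S feasible short overloaded
    where
    open ≤-Reasoning
    overloaded : q < L₁ + (L₂ + sum as)
    overloaded = begin-strict
      q                         ≡⟨ q≡B ⟩
      L₂ + (L₂ + tB)            ≤⟨ +-monoˡ-≤ (L₂ + tB) L₂≤L₁ ⟩
      L₁ + (L₂ + tB)            <⟨ +-monoˡ-< (L₁ + (L₂ + tB)) 0<tA ⟩
      tA + (L₁ + (L₂ + tB))     ≡⟨ shuffle′ tA L₁ L₂ tB ⟩
      L₁ + (L₂ + (tA + tB))     ≡⟨ cong (λ n → L₁ + (L₂ + n)) tA+tB ⟩
      L₁ + (L₂ + sum as)        ∎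
      where
      shuffle′ : ∀ t a b c → t + (a + (b + c)) ≡ a + (b + (t + c))
      shuffle′ = solve-∀
  ... | _ , _ , consˡ (consˡ _) , fits , _ = ⊥-elim (not-both (fits _ _ refl))
  ... | _ , _ , consʳ (consʳ _) , _ , fits = ⊥-elim (not-both (fits _ _ refl))
  ... | _ , _ , consˡ (consʳ i) , fitsA , fitsB = _ , _ , i , exact i (fitsA _ _ refl) (fitsB _ _ refl)
  ... | _ , _ , consʳ (consˡ i) , fitsB , fitsA = _ , _ , swap i , exact (swap i) (fitsA _ _ refl) (fitsB _ _ refl)

  schedulable : ∀ {A B} → Interleaving A B as → sum A ≡ tA →
                Σ (Schedule (shop (L₁ ∷⁺ L₂ ∷ as) q)) λ S → Feasible _ S × makespan _ S ℚ.≤ ι (q + (q + q))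
  schedulable {A} {B} i A≡ = UpperBound.scheduled (L₁ ∷⁺ L₂ ∷ as) q (consˡ (consʳ i))
    (≤-refl ∷ All.map (λ h → ≤-trans h L₂≤L₁) (proj₁ (interleaving-All i as≤L₂)))
    (≤-refl ∷ proj₂ (interleaving-All i as≤L₂))
    (≤-reflexive (fit L₁ A≡ q≡A)) (≤-reflexive (fit L₂ B≡ q≡B))
    where
    B≡ : sum B ≡ tB
    B≡ = +-cancelˡ-≡ tA _ _ (trans (cong (_+ sum B) (sym A≡)) (trans (interleaving-sum i) (sym tA+tB)))

    fit : ∀ L {s t} → s ≡ t → q ≡ L + (L + t) → L + s + L ≡ q
    fit L {s} refl q≡ = trans (+-comm (L + s) L) (sym q≡)

  correct : (∃₂ λ A B → Interleaving A B as × sum A ≡ tA) ⇔ DecisionProblem.Yes MixedShop instanceOf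
  correct = mk⇔ (λ (_ , _ , mix , eq) → schedulable mix eq) splits

-- Finite types and polynomial bounds

-- Repetitions in `elements` are harmless: the membership proof `complete a` singles out the
-- position that codes `a`.
record Finite (A : Set) : Set where
  field
    elements : List A
    complete : ∀ a → a ∈ elements

  size : ℕ
  size = length elements

  code : A → Fin size
  code a = Any.index (complete a)

  decode : Fin size → A
  decode = lookup elements

  decode-code : ∀ a → decode (code a) ≡ a
  decode-code a = sym (lookup-index (complete a))

open Finite

finite-⊤ : Finite ⊤
finite-⊤ = record { elements = tt ∷ [] ; complete = λ _ → here refl }

finite-Fin : ∀ n → Finite (Fin n)
finite-Fin n = record { elements = allFin n ; complete = ∈-allFin }

finite-Σ : ∀ {A : Set} {B : A → Set} → Finite A → (∀ a → Finite (B a)) → Finite (Σ A B)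
finite-Σ FA FB = record
  { elements = concatMap (λ a → map (a ,_) (elements (FB a))) (elements FA)
  ; complete = λ (a , b) → ∈-concatMap⁺ _ (lose (complete FA a) (∈-map⁺ (a ,_) (complete (FB a) b)))
  }

finite-× : ∀ {A B : Set} → Finite A → Finite B → Finite (A × B)
finite-× FA FB = finite-Σ FA (const FB)

finite-⊎ : ∀ {A B : Set} → Finite A → Finite B → Finite (A ⊎ B)
finite-⊎ FA FB = record
  { elements = map inj₁ (elements FA) ++ map inj₂ (elements FB)
  ; complete = λ { (inj₁ a) → ∈-++⁺ˡ (∈-map⁺ inj₁ (complete FA a))
                 ; (inj₂ b) → ∈-++⁺ʳ _ (∈-map⁺ inj₂ (complete FB b)) }
  }

finite-Maybe : ∀ {A : Set} → Finite A → Finite (Maybe A)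
finite-Maybe FA = record
  { elements = nothing ∷ map just (elements FA)
  ; complete = λ { nothing → here refl ; (just a) → there (∈-map⁺ just (complete FA a)) }
  }

finite-image : ∀ {A B : Set} (f : A → B) (g : B → A) → (∀ b → f (g b) ≡ b) → Finite A → Finite B
finite-image f g fg FA = record
  { elements = map f (elements FA)
  ; complete = λ b → subst (_∈ map f (elements FA)) (fg b) (∈-map⁺ f (complete FA (g b)))
  }

finite-Bool : Finite Bool
finite-Bool = record
  { elements = false ∷ true ∷ []
  ; complete = λ { false → here refl ; true → there (here refl) }
  }

finite-Vec : ∀ {A : Set} → Finite A → ∀ n → Finite (Vec A n)
finite-Vec FA zero    = record { elements = [] ∷ [] ; complete = λ { [] → here refl } }
finite-Vec FA (suc n) = finite-image (λ (a , as) → a ∷ as) (λ { (a ∷ as) → a , as }) (λ { (_ ∷ _) → refl })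
  (finite-× FA (finite-Vec FA n))

finite-Symbol : ∀ m → Finite (Symbol m)
finite-Symbol m = finite-image
  (λ { nothing → blank ; (just (inj₁ b)) → bit b ; (just (inj₂ i)) → mark i })
  (λ { blank → nothing ; (bit b) → just (inj₁ b) ; (mark i) → just (inj₂ i) })
  (λ { blank → refl ; (bit _) → refl ; (mark _) → refl })
  (finite-Maybe (finite-⊎ finite-Bool (finite-Fin m)))

*-^ : ∀ m n k → (m * n) ^ k ≡ m ^ k * n ^ k
*-^ m n zero    = refl
*-^ m n (suc k) = trans (cong (m * n *_) (*-^ m n k)) (shuffle m n (m ^ k) (n ^ k))
  where
  shuffle : ∀ a b c d → a * b * (c * d) ≡ a * c * (b * d)
  shuffle = solve-∀

-- Unlike `poly`, this form is visibly closed under products.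
PolyBounded : (ℕ → ℕ) → Set
PolyBounded f = ∃₂ λ c k → ∀ n → f n ≤ c * suc n ^ k

private
  pow-mono : ∀ n {j k} → j ≤ k → suc n ^ j ≤ suc n ^ k
  pow-mono n = ^-monoʳ-≤ (suc n)

poly-const : ∀ c → PolyBounded (const c)
poly-const c = c , 0 , λ _ → ≤-reflexive (sym (*-identityʳ c))

poly-id : PolyBounded id
poly-id = 1 , 1 , λ n → ≤-trans (n≤1+n n) (≤-reflexive (sym (trans (*-identityˡ _) (*-identityʳ _))))

poly-+ : ∀ {f g} → PolyBounded f → PolyBounded g → PolyBounded (λ n → f n + g n)
poly-+ (c , j , f≤) (d , k , g≤) = c + d , j + k , λ n → ≤-trans
  (+-mono-≤ (≤-trans (f≤ n) (*-monoʳ-≤ c (pow-mono n (m≤m+n j k))))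
            (≤-trans (g≤ n) (*-monoʳ-≤ d (pow-mono n (m≤n+m k j)))))
  (≤-reflexive (sym (*-distribʳ-+ (suc n ^ (j + k)) c d)))

poly-* : ∀ {f g} → PolyBounded f → PolyBounded g → PolyBounded (λ n → f n * g n)
poly-* (c , j , f≤) (d , k , g≤) = c * d , j + k , λ n → ≤-trans
  (*-mono-≤ (f≤ n) (g≤ n))
  (≤-reflexive (trans (shuffle c (suc n ^ j) d (suc n ^ k)) (cong (c * d *_) (sym (^-distribˡ-+-* (suc n) j k)))))
  where
  shuffle : ∀ a b c d → a * b * (c * d) ≡ a * c * (b * d)
  shuffle = solve-∀

-- For n ≥ 1, n + 1 ≤ 2 n costs a factor `2 ^ k`; for n = 0 the additive constant of `poly` is
-- enough.
PolyBounded⇒poly : ∀ {f} → PolyBounded f → ∃₂ λ a k → ∀ n → f n ≤ poly a k n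
PolyBounded⇒poly (c , k , h) = c * 2 ^ k , k , λ n → ≤-trans (h n) (bound n)
  where
  open ≤-Reasoning
  bound : ∀ n → c * suc n ^ k ≤ poly (c * 2 ^ k) k n
  bound zero = begin
    c * 1 ^ k                              ≤⟨ *-monoʳ-≤ c (^-monoˡ-≤ k {1} {2} (s≤s z≤n)) ⟩
    c * 2 ^ k                              ≤⟨ m≤n+m _ _ ⟩
    c * 2 ^ k * 0 ^ k + c * 2 ^ k          ∎
  bound n@(suc m) = begin
    c * suc n ^ k                          ≤⟨ *-monoʳ-≤ c (^-monoˡ-≤ k (+-mono-≤ (s≤s z≤n) (m≤m+n n 0))) ⟩
    c * (2 * n) ^ k                        ≡⟨ cong (c *_) (*-^ 2 n k) ⟩
    c * (2 ^ k * n ^ k)                    ≡⟨ *-assoc c (2 ^ k) (n ^ k) ⟨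
    c * 2 ^ k * n ^ k                      ≤⟨ m≤m+n _ _ ⟩
    c * 2 ^ k * n ^ k + c * 2 ^ k          ∎

-- Programs for Turing machines

module Programs (workTapes : ℕ) where

  n : ℕ
  n = suc workTapes

  Sym : Set
  Sym = Symbol 0

  Tapes : Set
  Tapes = Vec (Tape 0) n

  apply : Sym × Move → Tape 0 → Tape 0
  apply (s , d) t = move d (write s t)

  -- Structured programs, so that effects and running times are found by composition. Each test and
  -- each write concerns a single tape.
  data Program : Set where
    update   : Fin n → (Sym → Sym) → Move → Program
    _⨾_   : Program → Program → Program
    branch : Fin n → (Sym → Bool) → Program → Program → Program
    while : Fin n → (Sym → Bool) → Program → Program

  infixr 5 _⨾_

  data Exec : Program → Tapes → ℕ → Tapes → Set where
    update    : ∀ {X f d ts} → Exec (update X f d) ts 1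
               (ts [ X ]≔ apply (f (scanned (Vec.lookup ts X)) , d) (Vec.lookup ts X))
    _⨾_    : ∀ {P Q ts k ts′ l ts″} → Exec P ts k ts′ → Exec Q ts′ l ts″ → Exec (P ⨾ Q) ts (k + l) ts″
    taken  : ∀ {X c P Q ts k ts′} → c (scanned (Vec.lookup ts X)) ≡ true →
             Exec P ts k ts′ → Exec (branch X c P Q) ts (suc k) ts′
    missed : ∀ {X c P Q ts k ts′} → c (scanned (Vec.lookup ts X)) ≡ false →
             Exec Q ts k ts′ → Exec (branch X c P Q) ts (suc k) ts′
    exit   : ∀ {X c P ts} → c (scanned (Vec.lookup ts X)) ≡ false → Exec (while X c P) ts 1 ts
    repeat : ∀ {X c P ts k ts′ l ts″} → c (scanned (Vec.lookup ts X)) ≡ true →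
             Exec P ts k ts′ → Exec (while X c P) ts′ l ts″ → Exec (while X c P) ts (suc (k + l)) ts″

  -- Points of control; in a `branch` or `while`, `nothing` is the point of its test.
  Location : Program → Set
  Location (update _ _ _)   = ⊤
  Location (P ⨾ Q)       = Location P ⊎ Location Q
  Location (branch _ _ P Q)  = Maybe (Location P ⊎ Location Q)
  Location (while _ _ P) = Maybe (Location P)

  finite-Location : ∀ P → Finite (Location P)
  finite-Location (update _ _ _)   = finite-⊤
  finite-Location (P ⨾ Q)       = finite-⊎ (finite-Location P) (finite-Location Q)
  finite-Location (branch _ _ P Q)  = finite-Maybe (finite-⊎ (finite-Location P) (finite-Location Q))
  finite-Location (while _ _ P) = finite-Maybe (finite-Location P)

  entry : ∀ P → Location P
  entry (update _ _ _)   = tt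
  entry (P ⨾ Q)       = inj₁ (entry P)
  entry (branch _ _ P Q)  = nothing
  entry (while _ _ P) = nothing

  Actions : Set
  Actions = Vec (Sym × Move) n

  idle : Vec Sym n → Actions
  idle = Vec.map (_, stay)

  -- `nothing` is the location after the end of the program.
  next : ∀ P → Location P → Vec Sym n → Maybe (Location P) × Actions
  next (update X f d) _ v = nothing , idle v [ X ]≔ (f (Vec.lookup v X) , d)
  next (P ⨾ Q) (inj₁ p) v =
    let r , as = next P p v in just (maybe′ inj₁ (inj₂ (entry Q)) r) , as
  next (P ⨾ Q) (inj₂ q) v =
    let r , as = next Q q v in Maybe.map inj₂ r , as
  next (branch X c P Q) nothing v =
    just (just (if c (Vec.lookup v X) then inj₁ (entry P) else inj₂ (entry Q))) , idle v
  next (branch X c P Q) (just (inj₁ p)) v =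
    let r , as = next P p v in Maybe.map (just ∘ inj₁) r , as
  next (branch X c P Q) (just (inj₂ q)) v =
    let r , as = next Q q v in Maybe.map (just ∘ inj₂) r , as
  next (while X c P) nothing v =
    (if c (Vec.lookup v X) then just (just (entry P)) else nothing) , idle v
  next (while X c P) (just p) v =
    let r , as = next P p v in just r , as

  data Path (P : Program) : Maybe (Location P) → Tapes → ℕ → Maybe (Location P) → Tapes → Set where
    stop : ∀ {r ts} → Path P r ts 0 r ts
    go   : ∀ {p ts r as k r′ ts′} → next P p (Vec.map scanned ts) ≡ (r , as) →
           Path P r (Vec.zipWith apply as ts) k r′ ts′ → Path P (just p) ts (suc k) r′ ts′

  append : ∀ {P r ts k r′ ts′ l r″ ts″} →
           Path P r ts k r′ ts′ → Path P r′ ts′ l r″ ts″ → Path P r ts (k + l) r″ ts″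
  append stop     π = π
  append (go e ρ) π = go e (append ρ π)

  -- Carries a run of `P`, as a part of `R`, over to `R`: `h` embeds the points of control, and `g`
  -- also says where `R` continues once `P` has ended.
  lift : ∀ {P R} (g : Maybe (Location P) → Maybe (Location R)) (h : Location P → Location R) →
         (∀ p → g (just p) ≡ just (h p)) →
         (∀ p v {r as} → next P p v ≡ (r , as) → next R (h p) v ≡ (g r , as)) →
         ∀ {r ts k r′ ts′} → Path P r ts k r′ ts′ → Path R (g r) ts k (g r′) ts′
  lift g h g≡h commutes stop = stop
  lift g h g≡h commutes (go {p} e π) rewrite g≡h p = go (commutes p _ e) (lift g h g≡h commutes π)

  apply-idle : ∀ {m} (ts : Vec (Tape 0) m) → Vec.zipWith apply (Vec.map (_, stay) (Vec.map scanned ts)) ts ≡ ts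
  apply-idle []       = refl
  apply-idle (t ∷ ts) = cong (t ∷_) (apply-idle ts)

  apply-act : ∀ {m} (ts : Vec (Tape 0) m) X a →
              Vec.zipWith apply (Vec.map (_, stay) (Vec.map scanned ts) [ X ]≔ a) ts ≡
              ts [ X ]≔ apply a (Vec.lookup ts X)
  apply-act (t ∷ ts) zero    a = cong (apply a t ∷_) (apply-idle ts)
  apply-act (t ∷ ts) (suc X) a = cong (t ∷_) (apply-act ts X a)

  lookup-scanned : ∀ {m} (ts : Vec (Tape 0) m) X → Vec.lookup (Vec.map scanned ts) X ≡ scanned (Vec.lookup ts X)
  lookup-scanned (t ∷ ts) zero    = refl
  lookup-scanned (t ∷ ts) (suc X) = lookup-scanned ts X

  private
    stop-at : ∀ {P r ts ts′} → ts ≡ ts′ → Path P r ts 0 r ts′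
    stop-at refl = stop

    go-idle : ∀ {P p ts r k r′ ts′} → next P p (Vec.map scanned ts) ≡ (r , idle (Vec.map scanned ts)) →
              Path P r ts k r′ ts′ → Path P (just p) ts (suc k) r′ ts′
    go-idle {P} {r = r} {k = k} {r′} {ts′} e π = go e (subst (λ ts → Path P r ts k r′ ts′) (sym (apply-idle _)) π)

    test : ∀ {A : Set} (X : Fin n) (c : Sym → Bool) (ts : Tapes) {b} {x y : A} → c (scanned (Vec.lookup ts X)) ≡ b →
             (if c (Vec.lookup (Vec.map scanned ts) X) then x else y) ≡ (if b then x else y)
    test X c ts {x = x} {y} e =
      cong (if_then x else y) (trans (cong c (lookup-scanned ts X)) e)

  path : ∀ {P ts k ts′} → Exec P ts k ts′ → Path P (just (entry P)) ts k nothing ts′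
  path {update X f d} {ts} update = go refl (stop-at
    (trans (apply-act ts X _)
      (cong (λ s → ts [ X ]≔ apply (f s , d) (Vec.lookup ts X)) (lookup-scanned ts X))))
  path {P ⨾ Q} (e ⨾ e′) = append
    (lift (λ r → just (maybe′ inj₁ (inj₂ (entry Q)) r)) inj₁ (λ _ → refl) (λ { p v eq → cong (λ (r , as) → just (maybe′ inj₁ (inj₂ (entry Q)) r) , as) eq }) (path e))
    (lift (Maybe.map inj₂) inj₂ (λ _ → refl) (λ { p v eq → cong (λ (r , as) → Maybe.map inj₂ r , as) eq }) (path e′))
  path {branch X c P Q} {ts} (taken h e) = go-idle
    (cong (λ l → just (just l) , idle _) (test X c ts h))
    (lift (Maybe.map (just ∘ inj₁)) (just ∘ inj₁) (λ _ → refl) (λ { p v eq → cong (λ (r , as) → Maybe.map (just ∘ inj₁) r , as) eq }) (path e))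
  path {branch X c P Q} {ts} (missed h e) = go-idle
    (cong (λ l → just (just l) , idle _) (test X c ts h))
    (lift (Maybe.map (just ∘ inj₂)) (just ∘ inj₂) (λ _ → refl) (λ { p v eq → cong (λ (r , as) → Maybe.map (just ∘ inj₂) r , as) eq }) (path e))
  path {while X c P} {ts} (exit h) = go-idle (cong (_, idle _) (test X c ts h)) stop
  path {while X c P} {ts} (repeat h e e′) = go-idle (cong (_, idle _) (test X c ts h))
    (append (lift just just (λ _ → refl) (λ { p v eq → cong (λ (r , as) → just r , as) eq }) (path e)) (path e′))

  module _ (P : Program) where

    private
      locations : Finite (Maybe (Location P))
      locations = finite-Maybe (finite-Location P)

      transition : Maybe (Location P) → Vec Sym n → List (Fin (size locations) × Actions)
      transition nothing  v = []
      transition (just p) v = let r , as = next P p v in (code locations r , as) ∷ []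

    compile : TM
    compile = record
      { workTapes = workTapes
      ; marks     = 0
      ; states    = size locations
      ; start     = code locations (just (entry P))
      ; accept    = code locations nothing
      ; δ         = transition ∘ decode locations
      }

    compile-deterministic : Deterministic compile
    compile-deterministic q v with decode locations q
    ... | nothing = z≤n
    ... | just _  = ≤-refl

    private
      at : Maybe (Location P) → Tapes → Config compile
      at r ts = config (code locations r) ts

      runs : ∀ {r ts k r′ ts′} → Path P r ts k r′ ts′ → Run compile (at r ts) k (at r′ ts′)
      runs stop = done
      runs {just p} {ts} (go {as = as} e π) = step
        (subst (λ r → at _ (Vec.zipWith apply as ts) ∈ map (λ (q , as) → config q (Vec.zipWith apply as ts)) (transition r (Vec.map scanned ts))) (sym (decode-code locations (just p)))
          (here (cong (λ (r , as) → at r (Vec.zipWith apply as ts)) (sym e))))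
        (runs π)

    compile-computes : ∀ x {k ts′} → Exec P (inputTape x ∷ Vec.replicate workTapes blankTape) k ts′ →
                       ComputesWithin compile x (outputWord (Vec.head ts′)) k
    compile-computes x {ts′ = ts} e = _ , _ , ≤-refl , runs (path e)
      , cong (map (λ (q , as) → config q (Vec.zipWith apply as ts)) ∘ (λ r → transition r (Vec.map scanned ts)))
          (decode-code locations nothing)
      , refl

-- Tapes that hold words

module Generators (workTapes : ℕ) where
  open Programs workTapes

  -- To the left of a word there is nothing or a blank; this is where rewinding stops.
  data Sealed : List Sym → Set where
    []     : Sealed []
    blank∷ : ∀ ss → Sealed (blank ∷ ss)

  -- The head is on the first letter of w, or right after the last letter of u if w is empty.
  data Holds (u w : List Bool) : Tape 0 → Set where
    holds : ∀ {ss t s rs} k → Sealed ss → t ≡ map bit u ++ ss → s ∷ rs ≡ map bit w ++ replicate k blank →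
            Holds u w (tape t s rs)

  isBit isTrue : Sym → Bool
  isBit (bit _) = true
  isBit _       = false

  isTrue (bit true) = true
  isTrue _          = false

  scanned-∷ : ∀ {u b w t} → Holds u (b ∷ w) t → scanned t ≡ bit b
  scanned-∷ (holds k _ _ e) = ∷-injectiveˡ e

  scanned-[] : ∀ {u t} → Holds u [] t → scanned t ≡ blank
  scanned-[] (holds (suc k) _ _ e) = ∷-injectiveˡ e

  holds-right : ∀ {u b w t} → Holds u (b ∷ w) t → Holds (b ∷ u) w (apply (scanned t , right) t)
  holds-right {w = []} (holds zero sl refl refl) = holds 1 sl refl refl
  holds-right {w = []} (holds (suc k) sl refl refl) = holds (suc k) sl refl refl
  holds-right {w = b ∷ w} (holds k sl refl refl) = holds k sl refl refl

  -- The erased letter becomes the blank that seals the rest of the word.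
  holds-pop : ∀ {b w t} → Holds [] (b ∷ w) t → Holds [] w (apply (blank , right) t)
  holds-pop {w = []} (holds zero sl refl refl) = holds 1 (blank∷ _) refl refl
  holds-pop {w = []} (holds (suc k) sl refl refl) = holds (suc k) (blank∷ _) refl refl
  holds-pop {w = b ∷ w} (holds k sl refl refl) = holds k (blank∷ _) refl refl

  holds-emit : ∀ {u t} b → Holds u [] t → Holds (b ∷ u) [] (apply (bit b , right) t)
  holds-emit b (holds (suc zero) sl refl refl) = holds 1 sl refl refl
  holds-emit b (holds (suc (suc k)) sl refl refl) = holds (suc k) sl refl refl

  holds-left : ∀ {b u w t} → Holds (b ∷ u) w t → Holds u (b ∷ w) (apply (scanned t , left) t)
  holds-left (holds k sl refl e) = holds k sl refl (cong (bit _ ∷_) e)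

  holds-ends : ∀ {w t} → Holds [] w t → let t′ = apply (scanned t , left) t in
               scanned t′ ≡ blank × Holds [] w (apply (scanned t′ , right) t′)
  holds-ends (holds k []          refl e) = refl , holds k (blank∷ _) refl e
  holds-ends (holds k (blank∷ ss) refl e) = refl , holds k (blank∷ _) refl e

  holds-input : ∀ x → Holds [] x (inputTape x)
  holds-input []       = holds 1 [] refl refl
  holds-input (b ∷ bs) = holds 0 [] refl (sym (cong (bit b ∷_) (++-identityʳ _)))

  leadingBits-bits : ∀ w k → leadingBits {0} (map bit w ++ replicate k blank) ≡ w
  leadingBits-bits []      zero    = refl
  leadingBits-bits []      (suc k) = refl
  leadingBits-bits (b ∷ w) k       = cong (b ∷_) (leadingBits-bits w k)

  holds-output : ∀ {u w t} → Holds u w t → outputWord t ≡ w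
  holds-output {w = w} (holds k _ _ e) = trans (cong leadingBits e) (leadingBits-bits w k)

  Words : Set
  Words = Vec (List Bool) n

  -- On each tape, `us` has the letters to the left of the head, nearest first, and `ws` the word
  -- from the head on.
  record State (us ws : Words) (ts : Tapes) : Set where
    constructor state
    field at : ∀ j → Holds (Vec.lookup us j) (Vec.lookup ws j) (Vec.lookup ts j)

  open State

  private
    update-at : ∀ {m} {ts : Vec (Tape 0) m} {us ws : Vec (List Bool) m} X {t u w} →
      (∀ j → Holds (Vec.lookup us j) (Vec.lookup ws j) (Vec.lookup ts j)) → Holds u w t →
      ∀ j → Holds (Vec.lookup (us [ X ]≔ u) j) (Vec.lookup (ws [ X ]≔ w) j) (Vec.lookup (ts [ X ]≔ t) j)
    update-at {ts = _ ∷ _} {_ ∷ _} {_ ∷ _} zero    r h zero    = h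
    update-at {ts = _ ∷ _} {_ ∷ _} {_ ∷ _} zero    r h (suc j) = r (suc j)
    update-at {ts = _ ∷ _} {_ ∷ _} {_ ∷ _} (suc X) r h zero    = r zero
    update-at {ts = _ ∷ ts} {_ ∷ us} {_ ∷ ws} (suc X) r h (suc j) = update-at {ts = ts} {us} {ws} X (r ∘ suc) h j

  state-update : ∀ {ts us ws} X {t u w} → State us ws ts → Holds u w t →
                 State (us [ X ]≔ u) (ws [ X ]≔ w) (ts [ X ]≔ t)
  state-update {ts} {us} {ws} X r h = state (update-at {ts = ts} {us} {ws} X (at r) h)

  skip : Program
  skip = update zero id stay

  right-on pop rewind : Fin n → Program
  right-on X = update X id right
  pop X = update X (const blank) right
  -- The head may stand on the blank behind the word, where the loop would end at once; hence a
  -- first step to the left. The loop overshoots to the blank in front of the word.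
  rewind X = update X id left ⨾ while X isBit (update X id left) ⨾ right-on X

  emits : Fin n → List Bool → Program
  emits Z []       = skip
  emits Z (b ∷ bs) = update Z (const (bit b)) right ⨾ emits Z bs

  -- A Hoare triple for total correctness with a time bound.
  Effect : Program → ℕ → Words → Words → Words → Words → Set
  Effect P bound us ws us′ ws′ =
    ∀ {ts} → State us ws ts → ∃₂ λ k ts′ → k ≤ bound × Exec P ts k ts′ × State us′ ws′ ts′

  effect-⨾ : ∀ {P Q j k us ws us′ ws′ us″ ws″} →
             Effect P j us ws us′ ws′ → Effect Q k us′ ws′ us″ ws″ → Effect (P ⨾ Q) (j + k) us ws us″ ws″
  effect-⨾ p q r with _ , _ , j≤ , e , r′ ← p r with _ , _ , k≤ , e′ , r″ ← q r′
    = _ , _ , +-mono-≤ j≤ k≤ , e ⨾ e′ , r″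

  effect-weaken : ∀ {P j k us ws us′ ws′} → j ≤ k → Effect P j us ws us′ ws′ → Effect P k us ws us′ ws′
  effect-weaken j≤k p r with k , ts , h , e , r′ ← p r = k , ts , ≤-trans h j≤k , e , r′

  effect-≡ : ∀ {P k us ws us′ ws′ us″ ws″} → us′ ≡ us″ → ws′ ≡ ws″ →
             Effect P k us ws us′ ws′ → Effect P k us ws us″ ws″
  effect-≡ refl refl p = p

  effect-update : ∀ X f d {us ws u w} →
    (∀ {t} → Holds (Vec.lookup us X) (Vec.lookup ws X) t → Holds u w (apply (f (scanned t) , d) t)) →
    Effect (update X f d) 1 us ws (us [ X ]≔ u) (ws [ X ]≔ w)
  effect-update X f d h r = _ , _ , ≤-refl , update , state-update X r (h (at r X))

  effect-skip : ∀ {us ws} → Effect skip 1 us ws us ws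
  effect-skip {us} {ws} = effect-≡ ([]≔-lookup us zero) ([]≔-lookup ws zero)
    (effect-update zero id stay id)

  effect-right : ∀ X {us ws b w} → Vec.lookup ws X ≡ b ∷ w →
                 Effect (right-on X) 1 us ws (us [ X ]≔ (b ∷ Vec.lookup us X)) (ws [ X ]≔ w)
  effect-right X eq = effect-update X id right (λ h → holds-right (subst (λ w → Holds _ w _) eq h))

  effect-pop : ∀ X {us ws b w} → Vec.lookup us X ≡ [] → Vec.lookup ws X ≡ b ∷ w →
               Effect (pop X) 1 us ws us (ws [ X ]≔ w)
  effect-pop X {us} equ eqw = effect-≡ (trans (cong (us [ X ]≔_) (sym equ)) ([]≔-lookup us X)) refl
    (effect-update X (const blank) right (λ h → holds-pop (subst₂ (λ u w → Holds u w _) equ eqw h)))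

  effect-emits : ∀ Z bs {us ws} → Vec.lookup ws Z ≡ [] →
                 Effect (emits Z bs) (suc (length bs)) us ws (us [ Z ]≔ (bs ʳ++ Vec.lookup us Z)) ws
  effect-emits Z [] {us} eq = effect-≡ (sym ([]≔-lookup us Z)) refl effect-skip
  effect-emits Z (b ∷ bs) {us} {ws} eq = effect-≡
    (trans ([]≔-idempotent us Z) (cong (λ u → us [ Z ]≔ (bs ʳ++ u)) (lookup∘update Z us _))) refl
    (effect-⨾ (effect-≡ refl (trans (cong (ws [ Z ]≔_) (sym eq)) ([]≔-lookup ws Z))
                (effect-update Z (const (bit b)) right (λ h → holds-emit b (subst (λ w → Holds _ w _) eq h))))
              (effect-emits Z bs eq))

  effect-exit : ∀ X {P us ws} → Vec.lookup ws X ≡ [] → Effect (while X isBit P) 1 us ws us ws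
  effect-exit X eq r = _ , _ , ≤-refl
    , exit (cong isBit (scanned-[] (subst (λ w → Holds _ w _) eq (at r X)))) , r

  effect-repeat : ∀ X {P j k us ws b w us′ ws′ us″ ws″} → Vec.lookup ws X ≡ b ∷ w →
                  Effect P j us ws us′ ws′ → Effect (while X isBit P) k us′ ws′ us″ ws″ →
                  Effect (while X isBit P) (suc (j + k)) us ws us″ ws″
  effect-repeat X eq p q r with _ , _ , j≤ , e , r′ ← p r with _ , _ , k≤ , e′ , r″ ← q r′
    = _ , _ , s≤s (+-mono-≤ j≤ k≤)
    , repeat (cong isBit (scanned-∷ (subst (λ w → Holds _ w _) eq (at r X)))) e e′ , r″

  effect-branch : ∀ X c {P Q k us ws us′ ws′} b →
                  (∀ {t} → Holds (Vec.lookup us X) (Vec.lookup ws X) t → c (scanned t) ≡ b) →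
                  Effect (if b then P else Q) k us ws us′ ws′ →
                  Effect (branch X c P Q) (suc k) us ws us′ ws′
  effect-branch X c true h p r with _ , _ , k≤ , e , r′ ← p r = _ , _ , s≤s k≤ , taken (h (at r X)) e , r′
  effect-branch X c false h p r with _ , _ , k≤ , e , r′ ← p r = _ , _ , s≤s k≤ , missed (h (at r X)) e , r′

  -- While rewinding, the head may rest on the blank to the left of the word; State does not cover that.
  effect-rewind : ∀ X {us ws} → Effect (rewind X) (4 + 2 * length (Vec.lookup us X)) us ws
                    (us [ X ]≔ []) (ws [ X ]≔ (Vec.lookup us X ʳ++ Vec.lookup ws X))
  effect-rewind X {us} {ws} {ts} r =
    let k , t , k≤ , e , h = rewound (Vec.lookup us X) (at r X) in
    _ , _ , k≤ , subst (λ ts′ → Exec _ ts′ k (ts [ X ]≔ t)) ([]≔-lookup ts X) e , state-update X r h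
    where
    at-update : ∀ {f d} t → Exec (update X f d) (ts [ X ]≔ t) 1 (ts [ X ]≔ apply (f (scanned t) , d) t)
    at-update {f} {d} t = subst (Exec _ _ 1)
      (trans ([]≔-idempotent ts X) (cong (λ t → ts [ X ]≔ apply (f (scanned t) , d) t) (lookup∘update X ts t))) update

    scans : ∀ {t s b} → isBit s ≡ b → scanned t ≡ s → isBit (scanned (Vec.lookup (ts [ X ]≔ t) X)) ≡ b
    scans {t} s≡b t≡s = trans (cong (isBit ∘ scanned) (lookup∘update X ts t)) (trans (cong isBit t≡s) s≡b)

    back : ∀ u {b w t} → Holds u (b ∷ w) t →
           ∃₂ λ k t′ → k ≤ 3 + 2 * length u × Exec (while X isBit (update X id left)) (ts [ X ]≔ t) k (ts [ X ]≔ t′)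
                     × Holds [] (u ʳ++ b ∷ w) (apply (scanned t′ , right) t′)
    back [] {t = t} h with blank! , h′ ← holds-ends h =
      3 , _ , ≤-refl , repeat (scans refl (scanned-∷ h)) (at-update t) (exit (scans refl blank!)) , h′
    back (c ∷ u) {t = t} h with k , t′ , k≤ , e , h′ ← back u (holds-left h) =
      suc (suc k) , t′ , ≤-trans (s≤s (s≤s k≤)) (≤-reflexive (cong (3 +_) (sym (*-suc 2 (length u)))))
      , repeat (scans refl (scanned-∷ h)) (at-update t) e , h′

    rewound : ∀ u {w t} → Holds u w t →
              ∃₂ λ k t′ → k ≤ 4 + 2 * length u × Exec (rewind X) (ts [ X ]≔ t) k (ts [ X ]≔ t′) × Holds [] (u ʳ++ w) t′
    rewound [] {t = t} h with blank! , h′ ← holds-ends h =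
      3 , _ , n≤1+n 3 , at-update t ⨾ exit (scans refl blank!) ⨾ at-update _ , h′
    rewound (c ∷ u) {t = t} h with k , t′ , k≤ , e , h′ ← back u (holds-left h) =
      suc (k + 1) , _ , bound , at-update t ⨾ e ⨾ at-update t′ , h′
      where
      open ≤-Reasoning
      bound : suc (k + 1) ≤ 4 + 2 * suc (length u)
      bound = begin
        suc (k + 1)                  ≤⟨ s≤s (+-monoˡ-≤ 1 k≤) ⟩
        4 + (2 * length u + 1)       ≤⟨ +-monoʳ-≤ 4 (+-monoʳ-≤ (2 * length u) (n≤1+n 1)) ⟩
        4 + (2 * length u + 2)       ≡⟨ cong (4 +_) (trans (+-comm (2 * length u) 2) (sym (*-suc 2 (length u)))) ⟩
        4 + 2 * suc (length u)       ∎

-- Generators: nested sweeps that write one tape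

module Stages (workTapes : ℕ) where
  open Programs workTapes
  open Generators workTapes

  LengthsBelow : ℕ → Words → Set
  LengthsBelow ℓ ws = ∀ j → length (Vec.lookup ws j) ≤ ℓ

  -- `for X g` runs `g` once per letter of tape X, so nested sweeps multiply unary numbers. `peek`
  -- has one branch each for an empty word, a letter `false` and a letter `true` at the head.
  data Gen : Set where
    emit : List Bool → Gen
    _∙_  : Gen → Gen → Gen
    for  : Fin n → Gen → Gen
    peek : Fin n → Gen → Gen → Gen → Gen

  infixr 5 _∙_

  mutual
    -- The body of a sweep over X finds on X the suffix that starts with the current letter.
    output : Gen → Words → List Bool
    output (emit bs)      ws = bs
    output (g ∙ h)        ws = output g ws ++ output h ws
    output (for X g)      ws = sweep X g ws (Vec.lookup ws X)
    output (peek X e f t) ws with Vec.lookup ws X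
    ... | []        = output e ws
    ... | false ∷ _ = output f ws
    ... | true ∷ _  = output t ws

    sweep : Fin n → Gen → Words → List Bool → List Bool
    sweep X g ws []      = []
    sweep X g ws (b ∷ w) = output g (ws [ X ]≔ (b ∷ w)) ++ sweep X g ws w


  -- `A` marks the tapes whose heads are on the first letter. A sweep ends by rewinding to the first
  -- letter, so it restores its tape only if it began there; in particular, sweeps over the same
  -- tape cannot be nested.
  scoped : Vec Bool n → Gen → Set
  scoped A (emit _)       = ⊤
  scoped A (g ∙ h)        = scoped A g × scoped A h
  scoped A (for X g)      = T (Vec.lookup A X) × scoped (A [ X ]≔ false) g
  scoped A (peek _ e f t) = scoped A e × scoped A f × scoped A t

  -- Bounds the running time and also the length of the output, for words of length at most `ℓ`.
  cost : Gen → ℕ → ℕ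
  cost (emit bs)      ℓ = suc (length bs)
  cost (g ∙ h)        ℓ = cost g ℓ + cost h ℓ
  cost (for X g)      ℓ = suc (ℓ * suc (cost g ℓ + 1)) + (4 + 2 * ℓ)
  cost (peek _ e f t) ℓ = 2 + (cost e ℓ + (cost f ℓ + cost t ℓ))

  lengths-update : ∀ {ℓ ws w} X → LengthsBelow ℓ ws → length w ≤ ℓ → LengthsBelow ℓ (ws [ X ]≔ w)
  lengths-update {ℓ} {ws} {w} X b h j with j Fin.≟ X
  ... | yes refl = subst (λ v → length v ≤ ℓ) (sym (lookup∘update X ws w)) h
  ... | no j≢X   = subst (λ v → length v ≤ ℓ) (sym (lookup∘update′ j≢X ws w)) (b j)

  output-length : ∀ g {ws ℓ} → LengthsBelow ℓ ws → length (output g ws) ≤ cost g ℓ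
  output-length (emit bs) b = n≤1+n _
  output-length (g ∙ h) {ws} b = ≤-trans (≤-reflexive (length-++ (output g ws)))
    (+-mono-≤ (output-length g b) (output-length h b))
  output-length (for X g) {ws} {ℓ} b = ≤-trans (sweep-length (Vec.lookup ws X) (b X))
    (≤-trans (*-monoˡ-≤ (suc (cost g ℓ + 1)) (b X)) (≤-trans (n≤1+n _) (m≤m+n _ _)))
    where
    sweep-length : ∀ w → length w ≤ ℓ → length (sweep X g ws w) ≤ length w * suc (cost g ℓ + 1)
    sweep-length []      _ = z≤n
    sweep-length (c ∷ w) h = ≤-trans (≤-reflexive (length-++ (output g (ws [ X ]≔ (c ∷ w)))))
      (+-mono-≤ (≤-trans (output-length g (lengths-update {ws = ws} X b h)) (≤-trans (m≤m+n _ 1) (n≤1+n _)))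
                (sweep-length w (≤-trans (n≤1+n _) h)))
  output-length (peek X e f t) {ws} b with Vec.lookup ws X
  ... | []        = ≤-trans (output-length e b) (≤-trans (m≤m+n _ _) (m≤n+m _ 2))
  ... | false ∷ _ = ≤-trans (output-length f b) (≤-trans (≤-trans (m≤m+n _ _) (m≤n+m _ (cost e _))) (m≤n+m _ 2))
  ... | true ∷ _  = ≤-trans (output-length t b) (≤-trans (≤-trans (m≤n+m _ (cost f _)) (m≤n+m _ (cost e _))) (m≤n+m _ 2))

  module Emission (Z : Fin n) where

    program : Gen → Program
    program (emit bs)      = emits Z bs
    program (g ∙ h)        = program g ⨾ program h
    program (for X g)      = while X isBit (program g ⨾ right-on X) ⨾ rewind X
    program (peek X e f t) = branch X isBit (branch X isTrue (program t) (program f)) (program e)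

    extend : Words → List Bool → Words
    extend us o = us [ Z ]≔ (o ʳ++ Vec.lookup us Z)

    extend-[] : ∀ us → extend us [] ≡ us
    extend-[] us = []≔-lookup us Z

    extend-++ : ∀ us o o′ → extend (extend us o) o′ ≡ extend us (o ++ o′)
    extend-++ us o o′ = trans ([]≔-idempotent us Z) (cong (us [ Z ]≔_)
      (trans (cong (o′ ʳ++_) (lookup∘update Z us _)) (sym (++-ʳ++ o))))

    extend-other : ∀ us o {X} → X ≢ Z → Vec.lookup (extend us o) X ≡ Vec.lookup us X
    extend-other us o X≢Z = lookup∘update′ X≢Z us _

    extend-update : ∀ us o {X x} → X ≢ Z → extend (us [ X ]≔ x) o ≡ extend us o [ X ]≔ x
    extend-update us o {X} {x} X≢Z =
      trans (cong (λ z → (us [ X ]≔ x) [ Z ]≔ (o ʳ++ z)) (lookup∘update′ (X≢Z ∘ sym) us x)) ([]≔-commutes us X Z X≢Z)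

    Home : Vec Bool n → Words → Set
    Home A us = ∀ j → T (Vec.lookup A j) → Vec.lookup us j ≡ []

    home-extend : ∀ {A us} o → Vec.lookup A Z ≡ false → Home A us → Home A (extend us o)
    home-extend {A} {us} o ¬Z h j a with j Fin.≟ Z
    ... | yes refl = ⊥-elim (subst T ¬Z a)
    ... | no j≢Z   = trans (extend-other us o j≢Z) (h j a)

    home-update : ∀ {A us x} X → Home A us → Home (A [ X ]≔ false) (us [ X ]≔ x)
    home-update {A} {us} {x} X h j a with j Fin.≟ X
    ... | yes refl = ⊥-elim (subst T (lookup∘update X A false) a)
    ... | no j≢X   = trans (lookup∘update′ j≢X us x) (h j (subst T (lookup∘update′ j≢X A false) a))

    available≢Z : ∀ {A X} → Vec.lookup A Z ≡ false → T (Vec.lookup A X) → X ≢ Z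
    available≢Z ¬Z a refl = subst T ¬Z a

    -- The output accumulates to the left of the head of Z, which stays on a blank; all other tapes
    -- are restored, so that generators can follow one another.
    effect-gen : ∀ g A {us ws ℓ} → Vec.lookup A Z ≡ false → scoped A g → Home A us →
                 Vec.lookup ws Z ≡ [] → LengthsBelow ℓ ws →
                 Effect (program g) (cost g ℓ) us ws (extend us (output g ws)) ws
    effect-gen (emit bs) A ¬Z sc home Z[] short = effect-emits Z bs Z[]
    effect-gen (g ∙ h) A {us} {ws} ¬Z (sg , sh) home Z[] short = effect-≡ (extend-++ us (output g ws) (output h ws)) refl
      (effect-⨾ (effect-gen g A ¬Z sg home Z[] short)
                (effect-gen h A ¬Z sh (home-extend {A} {us} (output g ws) ¬Z home) Z[] short))
    effect-gen (for X g) A {us} {ws} {ℓ} ¬Z (a , sg) home Z[] short = effect-≡ final-us final-ws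
      (effect-⨾
        (effect-weaken (s≤s (*-monoˡ-≤ (suc (cost g ℓ + 1)) (short X)))
          (effect-≡-initial (loop (Vec.lookup ws X) {us} home (short X))))
        (effect-weaken rewind-cost (effect-rewind X)))
      where
      X≢Z : X ≢ Z
      X≢Z = available≢Z {A} ¬Z a

      o : List Bool
      o = output (for X g) ws

      final-u : Vec.lookup (extend us o [ X ]≔ (Vec.lookup ws X ʳ++ [])) X ≡ Vec.lookup ws X ʳ++ []
      final-u = lookup∘update X (extend us o) _

      final-us : (extend us o [ X ]≔ (Vec.lookup ws X ʳ++ [])) [ X ]≔ [] ≡ extend us o
      final-us = trans ([]≔-idempotent (extend us o) X)
        (trans (cong (extend us o [ X ]≔_) (sym (trans (extend-other us o X≢Z) (home X a)))) ([]≔-lookup (extend us o) X))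

      -- The sweep leaves the letters of X reversed to the left of the head, and rewinding reverses
      -- them again.
      final-ws : (ws [ X ]≔ []) [ X ]≔ (Vec.lookup (extend us o [ X ]≔ (Vec.lookup ws X ʳ++ [])) X ʳ++ Vec.lookup (ws [ X ]≔ []) X) ≡ ws
      final-ws = trans ([]≔-idempotent ws X) (trans
        (cong₂ (λ u w → ws [ X ]≔ (u ʳ++ w)) final-u (lookup∘update X ws []))
        (trans (cong (ws [ X ]≔_) (reverse-involutive (Vec.lookup ws X))) ([]≔-lookup ws X)))

      rewind-cost : 4 + 2 * length (Vec.lookup (extend us o [ X ]≔ (Vec.lookup ws X ʳ++ [])) X) ≤ 4 + 2 * ℓ
      rewind-cost = +-monoʳ-≤ 4 (*-monoʳ-≤ 2 (≤-trans
        (≤-reflexive (trans (cong length final-u) (length-reverse (Vec.lookup ws X)))) (short X)))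

      effect-≡-initial : ∀ {P k us′ ws′} → Effect P k (us [ X ]≔ []) (ws [ X ]≔ Vec.lookup ws X) us′ ws′ → Effect P k us ws us′ ws′
      effect-≡-initial {P} {k} {us′} {ws′} = subst₂ (λ us ws → Effect P k us ws us′ ws′)
        (trans (cong (us [ X ]≔_) (sym (home X a))) ([]≔-lookup us X)) ([]≔-lookup ws X)

      loop : ∀ w {us x} → Home A us → length w ≤ ℓ →
             Effect (while X isBit (program g ⨾ right-on X)) (suc (length w * suc (cost g ℓ + 1)))
               (us [ X ]≔ x) (ws [ X ]≔ w) (extend us (sweep X g ws w) [ X ]≔ (w ʳ++ x)) (ws [ X ]≔ [])
      loop [] {us} home _ = effect-≡ (cong (_[ X ]≔ _) (sym (extend-[] us))) refl (effect-exit X (lookup∘update X ws []))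
      loop (b ∷ w) {us} {x} home h = effect-≡ (cong (_[ X ]≔ _) (extend-++ us o₁ (sweep X g ws w))) refl
        (effect-weaken (≤-reflexive (cong suc (+-suc _ _)))
          (effect-repeat X (lookup∘update X ws (b ∷ w))
            (effect-⨾
              (effect-≡ (extend-update us o₁ X≢Z) refl
                (effect-gen g (A [ X ]≔ false) (trans (lookup∘update′ (X≢Z ∘ sym) A false) ¬Z) sg (home-update {A} {us} X home)
                  (trans (lookup∘update′ (X≢Z ∘ sym) ws _) Z[]) (lengths-update {ws = ws} X short h)))
              (effect-≡
                (trans ([]≔-idempotent (extend us o₁) X)
                  (cong (λ u → extend us o₁ [ X ]≔ (b ∷ u)) (lookup∘update X (extend us o₁) x)))
                ([]≔-idempotent ws X)
                (effect-right X (lookup∘update X ws (b ∷ w)))))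
            (loop w (home-extend {A} {us} o₁ ¬Z home) (≤-trans (n≤1+n _) h))))
        where
        o₁ : List Bool
        o₁ = output g (ws [ X ]≔ (b ∷ w))
    effect-gen (peek X e f t) A {us} {ws} {ℓ} ¬Z (se , sf , st) home Z[] short with Vec.lookup ws X in eq
    ... | []        = effect-weaken (≤-trans (s≤s (m≤m+n _ _)) (n≤1+n _))
      (effect-branch X isBit false (λ h → cong isBit (scanned-[] (subst (λ w → Holds _ w _) eq h)))
        (effect-gen e A ¬Z se home Z[] short))
    ... | false ∷ _ = effect-weaken (s≤s (s≤s (≤-trans (m≤m+n _ _) (m≤n+m _ (cost e ℓ)))))
      (effect-branch X isBit true (λ h → cong isBit (scanned-∷ (subst (λ w → Holds _ w _) eq h)))
        (effect-branch X isTrue false (λ h → cong isTrue (scanned-∷ (subst (λ w → Holds _ w _) eq h)))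
          (effect-gen f A ¬Z sf home Z[] short)))
    ... | true ∷ _  = effect-weaken (s≤s (s≤s (≤-trans (m≤n+m _ (cost f ℓ)) (m≤n+m _ (cost e ℓ)))))
      (effect-branch X isBit true (λ h → cong isBit (scanned-∷ (subst (λ w → Holds _ w _) eq h)))
        (effect-branch X isTrue true (λ h → cong isTrue (scanned-∷ (subst (λ w → Holds _ w _) eq h)))
          (effect-gen t A ¬Z st home Z[] short)))

-- Pipelines: stages that use up one tape and fill another

module Pipelines (workTapes : ℕ) where
  open Programs workTapes
  open Generators workTapes
  open Stages workTapes

  -- Writes to the target the output of `first`, then that of `rest` each time a letter of the
  -- source has been deleted, until the source is empty.
  record Stage : Set where
    constructor stage
    field
      target : Fin n
      first  : Gen
      source : Fin n
      rest   : Gen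

  drain : Fin n → Gen → Words → List Bool → List Bool
  drain Y g ws []      = []
  drain Y g ws (b ∷ w) = output g (ws [ Y ]≔ w) ++ drain Y g ws w

  product : Stage → Words → List Bool
  product (stage Z g Y h) ws = output g ws ++ drain Y h ws (Vec.lookup ws Y)

  perform : Stage → Words → Words
  perform s@(stage Z g Y h) ws = (ws [ Y ]≔ []) [ Z ]≔ product s ws

  allBut : Fin n → Vec Bool n
  allBut Z = Vec.replicate n true [ Z ]≔ false

  Applicable : Stage → Words → Set
  Applicable (stage Z g Y h) ws = Y ≢ Z × Vec.lookup ws Z ≡ [] × scoped (allBut Z) g × scoped (allBut Z) h

  stageProgram : Stage → Program
  stageProgram (stage Z g Y h) =
    Emission.program Z g ⨾ while Y isBit (pop Y ⨾ Emission.program Z h) ⨾ rewind Z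

  productCost : Stage → ℕ → ℕ
  productCost (stage Z g Y h) ℓ = cost g ℓ + ℓ * cost h ℓ

  stageCost : Stage → ℕ → ℕ
  stageCost s@(stage Z g Y h) ℓ =
    cost g ℓ + (suc (ℓ * suc (1 + cost h ℓ)) + (4 + 2 * productCost s ℓ))

  home : Words
  home = Vec.replicate n []

  product-length : ∀ s {ws ℓ} → LengthsBelow ℓ ws → length (product s ws) ≤ productCost s ℓ
  product-length (stage Z g Y h) {ws} {ℓ} b = ≤-trans (≤-reflexive (length-++ (output g ws)))
    (+-mono-≤ (output-length g b)
      (≤-trans (drain-length (Vec.lookup ws Y) (b Y)) (*-monoˡ-≤ (cost h ℓ) (b Y))))
    where
    drain-length : ∀ w → length w ≤ ℓ → length (drain Y h ws w) ≤ length w * cost h ℓ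
    drain-length []      _ = z≤n
    drain-length (c ∷ w) l = ≤-trans (≤-reflexive (length-++ (output h (ws [ Y ]≔ w))))
      (+-mono-≤ (output-length h (lengths-update {ws = ws} Y b (≤-trans (n≤1+n _) l)))
                (drain-length w (≤-trans (n≤1+n _) l)))

  effect-stage : ∀ s {ws ℓ} → Applicable s ws → LengthsBelow ℓ ws →
                 Effect (stageProgram s) (stageCost s ℓ) home ws home (perform s ws)
  effect-stage s@(stage Z g Y h) {ws} {ℓ} (Y≢Z , Z[] , sg , sh) short =
    effect-⨾ (effect-gen g A ¬Z sg (λ j _ → lookup-replicate j []) Z[] short)
      (effect-⨾
        (effect-weaken (s≤s (*-monoˡ-≤ (suc (1 + cost h ℓ)) (short Y)))
          (effect-from (loop (Vec.lookup ws Y) {extend home (output g ws)}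
            (λ j j≢Z → trans (extend-other home (output g ws) j≢Z) (lookup-replicate j [])) (short Y))))
        (effect-≡ final-us final-ws (effect-weaken rewind-cost (effect-rewind Z))))
    where
    open Emission Z

    A : Vec Bool n
    A = allBut Z

    ¬Z : Vec.lookup A Z ≡ false
    ¬Z = lookup∘update Z (Vec.replicate n true) false

    us : Words
    us = extend (extend home (output g ws)) (drain Y h ws (Vec.lookup ws Y))

    us≡ : us ≡ extend home (product s ws)
    us≡ = extend-++ home (output g ws) (drain Y h ws (Vec.lookup ws Y))

    us-Z : Vec.lookup us Z ≡ product s ws ʳ++ []
    us-Z = trans (cong (λ us → Vec.lookup us Z) us≡)
      (trans (lookup∘update Z home _) (cong (product s ws ʳ++_) (lookup-replicate Z [])))

    final-us : us [ Z ]≔ [] ≡ home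
    final-us = trans (cong (_[ Z ]≔ []) us≡) (trans ([]≔-idempotent home Z)
      (trans (cong (home [ Z ]≔_) (sym (lookup-replicate Z []))) ([]≔-lookup home Z)))

    final-ws : (ws [ Y ]≔ []) [ Z ]≔ (Vec.lookup us Z ʳ++ Vec.lookup (ws [ Y ]≔ []) Z) ≡ perform s ws
    final-ws = cong ((ws [ Y ]≔ []) [ Z ]≔_) (trans
      (cong₂ _ʳ++_ us-Z (trans (lookup∘update′ (Y≢Z ∘ sym) ws []) Z[]))
      (reverse-involutive (product s ws)))

    rewind-cost : 4 + 2 * length (Vec.lookup us Z) ≤ 4 + 2 * productCost s ℓ
    rewind-cost = +-monoʳ-≤ 4 (*-monoʳ-≤ 2 (≤-trans
      (≤-reflexive (trans (cong length us-Z) (length-reverse (product s ws)))) (product-length s short)))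

    effect-from : ∀ {P k us us′ ws′} → Effect P k us (ws [ Y ]≔ Vec.lookup ws Y) us′ ws′ → Effect P k us ws us′ ws′
    effect-from {P} {k} {us} {us′} {ws′} = subst (λ ws → Effect P k us ws us′ ws′) ([]≔-lookup ws Y)

    loop : ∀ w {us} → (∀ j → j ≢ Z → Vec.lookup us j ≡ []) → length w ≤ ℓ →
           Effect (while Y isBit (pop Y ⨾ program h)) (suc (length w * suc (1 + cost h ℓ)))
             us (ws [ Y ]≔ w) (extend us (drain Y h ws w)) (ws [ Y ]≔ [])
    loop [] {us} _ _ = effect-≡ (sym (extend-[] us)) refl (effect-exit Y (lookup∘update Y ws []))
    loop (b ∷ w) {us} clear l = effect-≡ (extend-++ us o (drain Y h ws w)) refl
      (effect-weaken (≤-reflexive (cong suc (+-suc (1 + cost h ℓ) (length w * suc (1 + cost h ℓ)))))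
        (effect-repeat Y (lookup∘update Y ws (b ∷ w))
          (effect-⨾ (effect-≡ refl ([]≔-idempotent ws Y) (effect-pop Y (clear Y Y≢Z) (lookup∘update Y ws (b ∷ w))))
            (effect-gen h A ¬Z sh (λ j a → clear j (available≢Z {A} ¬Z a))
              (trans (lookup∘update′ (Y≢Z ∘ sym) ws w) Z[])
              (lengths-update {ws = ws} Y short (≤-trans (n≤1+n _) l))))
          (loop w (λ j j≢Z → trans (extend-other us o j≢Z) (clear j j≢Z)) (≤-trans (n≤1+n _) l))))
      where
      o : List Bool
      o = output h (ws [ Y ]≔ w)

  lengths-perform : ∀ s {ws ℓ} → LengthsBelow ℓ ws → LengthsBelow (ℓ + stageCost s ℓ) (perform s ws)
  lengths-perform s@(stage Z g Y h) {ws} {ℓ} b = lengths-update {ws = ws [ Y ]≔ []} Z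
    (lengths-update {ws = ws} Y (λ j → ≤-trans (b j) (m≤m+n _ _)) z≤n)
    (begin
      length (product s ws)                                   ≤⟨ product-length s b ⟩
      productCost s ℓ                                         ≤⟨ m≤m+n _ _ ⟩
      2 * productCost s ℓ                                     ≤⟨ m≤n+m _ 4 ⟩
      4 + 2 * productCost s ℓ                                 ≤⟨ m≤n+m _ (suc (ℓ * suc (1 + cost h ℓ))) ⟩
      suc (ℓ * suc (1 + cost h ℓ)) + (4 + 2 * productCost s ℓ) ≤⟨ m≤n+m _ (cost g ℓ) ⟩
      stageCost s ℓ                                           ≤⟨ m≤n+m _ ℓ ⟩
      ℓ + stageCost s ℓ                                       ∎)
    where open ≤-Reasoning

  performAll : List Stage → Words → Words
  performAll []       ws = ws
  performAll (s ∷ ss) ws = performAll ss (perform s ws)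

  ApplicableAll : List Stage → Words → Set
  ApplicableAll []       ws = ⊤
  ApplicableAll (s ∷ ss) ws = Applicable s ws × ApplicableAll ss (perform s ws)

  pipelineProgram : List Stage → Program
  pipelineProgram []       = skip
  pipelineProgram (s ∷ ss) = stageProgram s ⨾ pipelineProgram ss

  -- A stage lengthens the words by at most its own cost, so the bounds are nested. For a fixed list
  -- of stages this is a composition of polynomials.
  pipelineCost : List Stage → ℕ → ℕ
  pipelineCost []       ℓ = 1
  pipelineCost (s ∷ ss) ℓ = stageCost s ℓ + pipelineCost ss (ℓ + stageCost s ℓ)

  effect-pipeline : ∀ ss {ws ℓ} → ApplicableAll ss ws → LengthsBelow ℓ ws →
                    Effect (pipelineProgram ss) (pipelineCost ss ℓ) home ws home (performAll ss ws)
  effect-pipeline []       _        b = effect-skip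
  effect-pipeline (s ∷ ss) {ws} (a , as) b =
    effect-⨾ (effect-stage s a b) (effect-pipeline ss as (lengths-perform s {ws} b))

  cost-poly : ∀ g {f} → PolyBounded f → PolyBounded (cost g ∘ f)
  cost-poly (emit bs)      p = poly-const (suc (length bs))
  cost-poly (g ∙ h)        p = poly-+ (cost-poly g p) (cost-poly h p)
  cost-poly (for X g)      p = poly-+
    (poly-+ (poly-const 1) (poly-* p (poly-+ (poly-const 1) (poly-+ (cost-poly g p) (poly-const 1)))))
    (poly-+ (poly-const 4) (poly-* (poly-const 2) p))
  cost-poly (peek _ e f t) p =
    poly-+ (poly-const 2) (poly-+ (cost-poly e p) (poly-+ (cost-poly f p) (cost-poly t p)))

  stageCost-poly : ∀ s {f} → PolyBounded f → PolyBounded (stageCost s ∘ f)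
  stageCost-poly (stage Z g Y h) p = poly-+ (cost-poly g p)
    (poly-+ (poly-+ (poly-const 1) (poly-* p (poly-+ (poly-const 2) (cost-poly h p))))
      (poly-+ (poly-const 4) (poly-* (poly-const 2) (poly-+ (cost-poly g p) (poly-* p (cost-poly h p))))))

  pipelineCost-poly : ∀ ss {f} → PolyBounded f → PolyBounded (pipelineCost ss ∘ f)
  pipelineCost-poly []       p = poly-const 1
  pipelineCost-poly (s ∷ ss) p =
    poly-+ (stageCost-poly s p) (pipelineCost-poly ss (poly-+ p (stageCost-poly s p)))

  input : List Bool → Words
  input x = x ∷ Vec.replicate workTapes []

  pipeline-polytime : ∀ ss → (∀ x → ApplicableAll ss (input x)) → PolyTime (λ x → Vec.head (performAll ss (input x)))
  pipeline-polytime ss applicable with a , k , bound ← PolyBounded⇒poly (pipelineCost-poly ss poly-id) =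
    compile (pipelineProgram ss) , a , k , compile-deterministic (pipelineProgram ss) , computes
    where
    initial-state : ∀ x → State home (input x) (inputTape x ∷ Vec.replicate workTapes blankTape)
    initial-state x = state λ
      { zero    → holds-input x
      ; (suc j) → subst₂ (λ u w → Holds u w (Vec.lookup (Vec.replicate workTapes blankTape) j)) (sym (lookup-replicate j [])) (sym (lookup-replicate j []))
                    (subst (Holds [] []) (sym (lookup-replicate j blankTape)) (holds-input [])) }

    initial-lengths : ∀ x → LengthsBelow (length x) (input x)
    initial-lengths x zero    = ≤-refl
    initial-lengths x (suc j) = ≤-trans (≤-reflexive (cong length (lookup-replicate j []))) z≤n

    computes : ∀ x → ComputesWithin (compile (pipelineProgram ss)) x (Vec.head (performAll ss (input x))) (poly a k (length x))
    computes x
      with k , ts , k≤ , e , r ← effect-pipeline ss (applicable x) (initial-lengths x) (initial-state x)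
      with t , c , t≤ , run , halted , out ← compile-computes (pipelineProgram ss) x e
      = t , c , ≤-trans t≤ (≤-trans k≤ (bound (length x))) , run , halted
      , trans out (head-word r)
      where
      head-word : ∀ {us ws ts} → State us ws ts → outputWord (Vec.head ts) ≡ Vec.head ws
      head-word {ws = _ ∷ _} {_ ∷ _} r = holds-output (State.at r zero)

-- Tilings and subset sums

module Radix (B : ℕ) where

  -- One cell: three digits, least significant first, below the number `x` formed by all later
  -- cells.
  blk : ℕ → ℕ → ℕ → ℕ → ℕ
  blk a b c x = a + B * (b + B * (c + B * x))

  -- Multiplication by `B ^ (3 * n)`, the shift by n cells, in the nested form of `blk`.
  zeros : ℕ → ℕ → ℕ
  zeros zero    x = x
  zeros (suc n) x = blk 0 0 0 (zeros n x)

  blk-+ : ∀ a b c x a′ b′ c′ x′ → blk a b c x + blk a′ b′ c′ x′ ≡ blk (a + a′) (b + b′) (c + c′) (x + x′)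
  blk-+ = lemma B
    where
    lemma : ∀ B a b c x a′ b′ c′ x′ →
            a + B * (b + B * (c + B * x)) + (a′ + B * (b′ + B * (c′ + B * x′))) ≡
            a + a′ + B * (b + b′ + B * (c + c′ + B * (x + x′)))
    lemma = solve-∀

  zeros-+ : ∀ n x y → zeros n x + zeros n y ≡ zeros n (x + y)
  zeros-+ zero    x y = refl
  zeros-+ (suc n) x y = trans (blk-+ 0 0 0 _ 0 0 0 _) (cong (blk 0 0 0) (zeros-+ n x y))

  blk-0 : blk 0 0 0 0 ≡ 0
  blk-0 = trans (cong (λ x → B * (B * x)) (*-zeroʳ B)) (trans (cong (B *_) (*-zeroʳ B)) (*-zeroʳ B))

  zeros-0 : ∀ n → zeros n 0 ≡ 0
  zeros-0 zero    = refl
  zeros-0 (suc n) = trans (cong (blk 0 0 0) (zeros-0 n)) blk-0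

  zeros-∘ : ∀ m n x → zeros m (zeros n x) ≡ zeros (m + n) x
  zeros-∘ zero    n x = refl
  zeros-∘ (suc m) n x = cong (blk 0 0 0) (zeros-∘ m n x)

  blk-mono : ∀ {a b c x a′ b′ c′ x′} → a ≤ a′ → b ≤ b′ → c ≤ c′ → x ≤ x′ → blk a b c x ≤ blk a′ b′ c′ x′
  blk-mono a b c x = +-mono-≤ a (*-monoʳ-≤ B (+-mono-≤ b (*-monoʳ-≤ B (+-mono-≤ c (*-monoʳ-≤ B x)))))

  zeros-mono : ∀ n {x y} → x ≤ y → zeros n x ≤ zeros n y
  zeros-mono zero    h = h
  zeros-mono (suc n) h = blk-mono z≤n z≤n z≤n (zeros-mono n h)

  digit-< : ∀ {a x y} → a < B → x < y → a + B * x < B * y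
  digit-< {a} {x} {y} a<B x<y = begin-strict
    a + B * x      <⟨ +-monoˡ-< (B * x) a<B ⟩
    B + B * x      ≡⟨ *-suc B x ⟨
    B * suc x      ≤⟨ *-monoʳ-≤ B x<y ⟩
    B * y          ∎
    where open ≤-Reasoning

  blk-< : ∀ {a b c x y} → a < B → b < B → c < B → x < y → blk a b c x < blk 0 0 0 y
  blk-< a b c x = digit-< a (digit-< b (digit-< c x))

  digit-injective : ∀ {a b x y} → a < B → b < B → a + B * x ≡ b + B * y → a ≡ b × x ≡ y
  digit-injective {a} {b} {zero}  {zero}  _ _ eq =
    +-cancelʳ-≡ (B * 0) a b eq , refl
  digit-injective {a} {b} {zero} {suc y} a<B _ eq =
    contradiction eq (<⇒≢ (<-≤-trans (digit-< a<B (s≤s z≤n)) (m≤n+m (B * suc y) b)))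
  digit-injective {a} {b} {suc x} {zero} _ b<B eq =
    contradiction (sym eq) (<⇒≢ (<-≤-trans (digit-< b<B (s≤s z≤n)) (m≤n+m (B * suc x) a)))
  digit-injective {a} {b} {suc x} {suc y} a<B b<B eq with digit-injective {a} {b} {x} {y} a<B b<B
    (+-cancelˡ-≡ B _ _ (trans (trans (shuffle B a x) eq) (sym (shuffle B b y))))
    where
    shuffle : ∀ B a x → B + (a + B * x) ≡ a + B * suc x
    shuffle = solve-∀
  ... | a≡b , x≡y = a≡b , cong suc x≡y

  blk-injective : ∀ {a b c x a′ b′ c′ x′} → a < B → b < B → c < B → a′ < B → b′ < B → c′ < B →
                  blk a b c x ≡ blk a′ b′ c′ x′ → a ≡ a′ × b ≡ b′ × c ≡ c′ × x ≡ x′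
  blk-injective a b c a′ b′ c′ eq
    with refl , eq₁ ← digit-injective a a′ eq
    with refl , eq₂ ← digit-injective b b′ eq₁
    with refl , eq₃ ← digit-injective c c′ eq₂ = refl , refl , refl , eq₃

  queue : List ℕ → ℕ
  queue []       = 0
  queue (v ∷ vs) = blk 0 0 v (queue vs)

  queue-∷ʳ : ∀ vs v → queue (vs ∷ʳ v) ≡ queue vs + zeros (length vs) (blk 0 0 v 0)
  queue-∷ʳ []       v = refl
  queue-∷ʳ (u ∷ vs) v = trans
    (cong (blk 0 0 u) (queue-∷ʳ vs v))
    (trans (cong (λ u → blk 0 0 u (queue vs + zeros (length vs) (blk 0 0 v 0))) (sym (+-identityʳ u)))
      (sym (blk-+ 0 0 u _ 0 0 0 _)))

  queue-zeros : ∀ n → queue (replicate n 0) ≡ 0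
  queue-zeros zero    = refl
  queue-zeros (suc n) = trans (cong (blk 0 0 0) (queue-zeros n)) blk-0

  -- Not a carry between digits, but what the cells dealt with so far contribute to the cells ahead:
  -- `e` to the left digit of the next one, `vs` to the top digits of the next ones.
  carry : ℕ → List ℕ → ℕ
  carry e vs = blk 0 e 0 0 + queue vs

  carry-∷ : ∀ e v vs → carry e (v ∷ vs) ≡ blk 0 e v (queue vs)
  carry-∷ e v vs = trans (blk-+ 0 e 0 0 0 0 v (queue vs)) (cong (λ e → blk 0 e v (queue vs)) (+-identityʳ e))

  -- The digits of an item count itself once, announce its left and top colours, and pass
  -- the complements of its right and bottom colours on to the next cell and the cell below.
  loc : ℕ → ℕ → ℕ → ℕ → ℕ → ℕ → ℕ
  loc c n l t r b = blk n l t (blk 0 r 0 (zeros c (blk 0 0 b 0)))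

  loc-+ : ∀ c n l t r b n′ l′ t′ r′ b′ → loc c n l t r b + loc c n′ l′ t′ r′ b′ ≡
                                         loc c (n + n′) (l + l′) (t + t′) (r + r′) (b + b′)
  loc-+ c n l t r b n′ l′ t′ r′ b′ = trans (blk-+ n l t _ n′ l′ t′ _) (cong (blk _ _ _)
    (trans (blk-+ 0 r 0 _ 0 r′ 0 _) (cong (blk 0 _ 0)
      (trans (zeros-+ c _ _) (cong (zeros c) (blk-+ 0 0 b 0 0 0 b′ 0))))))

  -- The three digits of the current cell become final, and the rest is a `carry` again, with the
  -- new bottom value at the end of the queue. It lands there because `c` is C - 2: seen from the
  -- next cell, `suc c` entries are ahead of it.
  carry-step : ∀ {c} e v vs n l t r b y → length vs ≡ suc c →
               carry e (v ∷ vs) + (loc c n l t r b + blk 0 0 0 y) ≡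
               blk n (e + l) (v + t) (carry r (vs ∷ʳ b) + y)
  carry-step {c} e v vs n l t r b y len = begin
    carry e (v ∷ vs) + (loc c n l t r b + blk 0 0 0 y)
      ≡⟨ cong₂ _+_ (carry-∷ e v vs) (trans (blk-+ n l t _ 0 0 0 y)
           (cong₂ (λ n l → blk n l (t + 0) (moved + y)) (+-identityʳ n) (+-identityʳ l))) ⟩
    blk 0 e v (queue vs) + blk n l (t + 0) (moved + y)
      ≡⟨ blk-+ 0 e v _ n l (t + 0) _ ⟩
    blk n (e + l) (v + (t + 0)) (queue vs + (moved + y))
      ≡⟨ cong₂ (λ t x → blk n (e + l) (v + t) x) (+-identityʳ t) rest ⟩
    blk n (e + l) (v + t) (carry r (vs ∷ʳ b) + y)
      ∎
    where
    open ≡-Reasoning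

    down moved : ℕ
    down  = zeros c (blk 0 0 b 0)
    moved = blk 0 r 0 down

    moved≡ : moved ≡ blk 0 r 0 0 + zeros (length vs) (blk 0 0 b 0)
    moved≡ = trans (cong (λ r → blk 0 r 0 down) (sym (+-identityʳ r)))
      (trans (sym (blk-+ 0 r 0 0 0 0 0 down)) (cong (λ n → blk 0 r 0 0 + zeros n (blk 0 0 b 0)) (sym len)))

    shuffle : ∀ q r d y → q + (r + d + y) ≡ r + (q + d) + y
    shuffle = solve-∀

    rest : queue vs + (moved + y) ≡ carry r (vs ∷ʳ b) + y
    rest = trans (cong (λ m → queue vs + (m + y)) moved≡)
      (trans (shuffle (queue vs) (blk 0 r 0 0) (zeros (length vs) (blk 0 0 b 0)) y)
        (cong (λ q → blk 0 r 0 0 + q + y) (sym (queue-∷ʳ vs b))))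

  blocks : List (ℕ × ℕ × ℕ) → ℕ → ℕ
  blocks []                 x = x
  blocks ((a , b , c) ∷ bs) x = blk a b c (blocks bs x)

interleaving-prefix : ∀ {X Y : Set} (f : X → Y) xs {ys ls rs} → Interleaving ls rs (map f xs ++ ys) →
                      ∃₂ λ s ls′ → ∃ λ rs′ → ls ≡ map f s ++ ls′ × length s ≤ length xs × Interleaving ls′ rs′ ys
interleaving-prefix f []       i = [] , _ , _ , refl , z≤n , i
interleaving-prefix f (x ∷ xs) (consˡ i) with s , ls , rs , refl , h , i′ ← interleaving-prefix f xs i =
  x ∷ s , ls , rs , refl , s≤s h , i′
interleaving-prefix f (x ∷ xs) (consʳ i) with s , ls , rs , refl , h , i′ ← interleaving-prefix f xs i =
  s , ls , rs , refl , m≤n⇒m≤1+n h , i′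

interleaving-skip : ∀ {X : Set} (xs : List X) {ls rs ys} → Interleaving ls rs ys → Interleaving ls (xs ++ rs) (xs ++ ys)
interleaving-skip []       i = i
interleaving-skip (x ∷ xs) i = consʳ (interleaving-skip xs i)

interleaving-choose : ∀ {X Y : Set} (f : X → Y) {x xs ls rs ys} → x ∈ xs → Interleaving ls rs ys →
                      ∃ λ rs′ → Interleaving (f x ∷ ls) rs′ (map f xs ++ ys)
interleaving-choose f {xs = _ ∷ xs} (here refl) i = _ , consˡ (interleaving-skip (map f xs) i)
interleaving-choose f (there x∈) i = let _ , i′ = interleaving-choose f x∈ i in _ , consʳ i′

-- Items and targets are doubled because L₁ and L₂ have to differ by half the difference of the two
-- targets.
dbl : ℕ → ℕ
dbl x = x + x

dbl-+ : ∀ x y → dbl x + dbl y ≡ dbl (x + y)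
dbl-+ = lemma
  where
  lemma : ∀ x y → x + x + (y + y) ≡ x + y + (x + y)
  lemma = solve-∀

module Helix {Tile H V : Set} (l r : Tile → H) (t b : Tile → V) where

  -- A tiling of a strip wound up into a helix, one tile after the other: the colour to be matched
  -- on the left, and the queue of the colours exposed at the bottom, oldest first.
  data Path : ℕ → H → List V → H → List V → Set where
    done : ∀ {h vs} → Path 0 h vs h vs
    step : ∀ τ {n h v vs h′ ws} → l τ ≡ h → t τ ≡ v → Path n (r τ) (vs ∷ʳ b τ) h′ ws →
           Path (suc n) h (v ∷ vs) h′ ws

-- `tiles` lists the items of one cell, possibly with repetitions. `large` excludes carries: a digit
-- gets at most K from earlier cells and at most K from each item. `many` makes the sum of all items
-- at least twice the target.
record TileSet : Set₁ where
  field
    Tile H V : Set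
    l r : Tile → H
    t b : Tile → V
    hcode : H → ℕ
    vcode : V → ℕ
    hcode-injective : Injective _≡_ _≡_ hcode
    vcode-injective : Injective _≡_ _≡_ vcode
    K : ℕ
    hcode<K : ∀ h → hcode h < K
    vcode<K : ∀ v → vcode v < K
    0<hcode : ∀ h → 0 < hcode h
    0<vcode : ∀ v → 0 < vcode v
    tiles : List Tile
    many : K + K ≤ length tiles
    B : ℕ
    large : K + length tiles * K < B

module Tilings (Θ : TileSet) where
  open TileSet Θ
  open Radix B

  open Helix l r t b public

  hout : H → ℕ
  hout h = K ∸ hcode h

  vout : V → ℕ
  vout v = K ∸ vcode v

  pending : H → List V → ℕ
  pending h vs = carry (hout h) (map vout vs)

  -- The complements of the final colours fall on the cells beyond the strip, hence the last summand
  -- `pending`.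
  target : ℕ → H → List V → ℕ
  target zero    h ws = pending h ws
  target (suc n) h ws = blk 1 K K (target n h ws)

  K<B : K < B
  K<B = ≤-<-trans (m≤m+n K _) large

  hout+hcode : ∀ h → hout h + hcode h ≡ K
  hout+hcode h = m∸n+n≡m (<⇒≤ (hcode<K h))

  vout+vcode : ∀ v → vout v + vcode v ≡ K
  vout+vcode v = m∸n+n≡m (<⇒≤ (vcode<K v))

  hout<B : ∀ h → hout h < B
  hout<B h = ≤-<-trans (m∸n≤m K (hcode h)) K<B

  vout<B : ∀ v → vout v < B
  vout<B v = ≤-<-trans (m∸n≤m K (vcode v)) K<B

  0<B : 0 < B
  0<B = ≤-<-trans z≤n K<B

  private
    hout-injective : ∀ {g h} → hout g ≡ hout h → g ≡ h
    hout-injective {g} {h} eq = hcode-injective (∸-cancelˡ-≡ (<⇒≤ (hcode<K g)) (<⇒≤ (hcode<K h)) eq)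

    vout-injective : ∀ {u v} → vout u ≡ vout v → u ≡ v
    vout-injective {u} {v} eq = vcode-injective (∸-cancelˡ-≡ (<⇒≤ (vcode<K u)) (<⇒≤ (vcode<K v)) eq)

    queue-injective : ∀ vs ws → length vs ≡ length ws → queue (map vout vs) ≡ queue (map vout ws) → vs ≡ ws
    queue-injective []       []       _   _  = refl
    queue-injective (v ∷ vs) (w ∷ ws) len eq
      with _ , _ , eqv , eqs ← blk-injective 0<B 0<B (vout<B v) 0<B 0<B (vout<B w) eq =
      cong₂ _∷_ (vout-injective eqv) (queue-injective vs ws (suc-injective len) eqs)

    pending-injective : ∀ {c g h} vs ws → length vs ≡ suc c → length ws ≡ suc c →
                        pending g vs ≡ pending h ws → g ≡ h × vs ≡ ws
    pending-injective {c} {g} {h} (v ∷ vs) (w ∷ ws) lv lw eq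
      with _ , eqh , eqv , eqs ← blk-injective 0<B (hout<B g) (vout<B v) 0<B (hout<B h) (vout<B w)
             (trans (sym (carry-∷ _ _ (map vout vs))) (trans eq (carry-∷ _ _ (map vout ws))))
      = hout-injective eqh , cong₂ _∷_ (vout-injective eqv) (queue-injective vs ws (suc-injective (trans lv (sym lw))) eqs)

  module Width (c : ℕ) where

    single : Tile → ℕ
    single τ = loc c 1 (hcode (l τ)) (vcode (t τ)) (hout (r τ)) (vout (b τ))

    cell : List Tile → ℕ
    cell s = sum (map single s)

    cell-loc : ∀ s → cell s ≡ loc c (length s) (sum (map (hcode ∘ l) s)) (sum (map (vcode ∘ t) s))
                                    (sum (map (hout ∘ r) s)) (sum (map (vout ∘ b) s))
    cell-loc []      = sym (trans
      (cong (blk 0 0 0) (trans (cong (blk 0 0 0) (trans (cong (zeros c) blk-0) (zeros-0 c))) blk-0)) blk-0)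
    cell-loc (τ ∷ s) = trans (cong (single τ +_) (cell-loc s)) (loc-+ c 1 _ _ _ _ _ _ _ _ _)

    strip : List (List Tile) → ℕ
    strip []       = 0
    strip (s ∷ ss) = cell s + blk 0 0 0 (strip ss)

    strip-∷ʳ : ∀ ss s → strip (ss ∷ʳ s) ≡ strip ss + zeros (length ss) (cell s)
    strip-∷ʳ []        s = trans (cong (cell s +_) blk-0) (+-identityʳ (cell s))
    strip-∷ʳ (s′ ∷ ss) s = trans (cong (λ x → cell s′ + blk 0 0 0 x) (strip-∷ʳ ss s))
      (trans (cong (cell s′ +_) (sym (blk-+ 0 0 0 _ 0 0 0 _))) (sym (+-assoc (cell s′) _ _)))

    carry-strip : ∀ e v vs s ss → length vs ≡ suc c →
      carry e (v ∷ vs) + strip (s ∷ ss) ≡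
      blk (length s) (e + sum (map (hcode ∘ l) s)) (v + sum (map (vcode ∘ t) s))
        (carry (sum (map (hout ∘ r) s)) (vs ∷ʳ sum (map (vout ∘ b) s)) + strip ss)
    carry-strip e v vs s ss len = trans
      (cong (λ x → carry e (v ∷ vs) + (x + blk 0 0 0 (strip ss))) (cell-loc s))
      (carry-step e v vs (length s) _ _ _ _ (strip ss) len)

    strip-step : ∀ h v vs s ss → length vs ≡ suc c →
      pending h (v ∷ vs) + strip (s ∷ ss) ≡
      blk (length s) (hout h + sum (map (hcode ∘ l) s)) (vout v + sum (map (vcode ∘ t) s))
        (carry (sum (map (hout ∘ r) s)) (map vout vs ∷ʳ sum (map (vout ∘ b) s)) + strip ss)
    strip-step h v vs s ss len =
      carry-strip (hout h) (vout v) (map vout vs) s ss (trans (length-map vout vs) len)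

    strip-step₁ : ∀ τ vs ss → length vs ≡ suc c →
      pending (l τ) (t τ ∷ vs) + strip ([ τ ] ∷ ss) ≡ blk 1 K K (pending (r τ) (vs ∷ʳ b τ) + strip ss)
    strip-step₁ τ vs ss len = begin
      pending (l τ) (t τ ∷ vs) + strip ([ τ ] ∷ ss)
        ≡⟨ strip-step (l τ) (t τ) vs [ τ ] ss len ⟩
      blk 1 (hout (l τ) + (hcode (l τ) + 0)) (vout (t τ) + (vcode (t τ) + 0))
        (carry (hout (r τ) + 0) (map vout vs ∷ʳ (vout (b τ) + 0)) + strip ss)
        ≡⟨ cong₂ (λ x y → blk 1 x y (carry (hout (r τ) + 0) (map vout vs ∷ʳ (vout (b τ) + 0)) + strip ss))
             (trans (cong (hout (l τ) +_) (+-identityʳ _)) (hout+hcode (l τ)))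
             (trans (cong (vout (t τ) +_) (+-identityʳ _)) (vout+vcode (t τ))) ⟩
      blk 1 K K (carry (hout (r τ) + 0) (map vout vs ∷ʳ (vout (b τ) + 0)) + strip ss)
        ≡⟨ cong₂ (λ x y → blk 1 K K (carry x (map vout vs ∷ʳ y) + strip ss)) (+-identityʳ _) (+-identityʳ _) ⟩
      blk 1 K K (carry (hout (r τ)) (map vout vs ∷ʳ vout (b τ)) + strip ss)
        ≡⟨ cong (λ ws → blk 1 K K (carry (hout (r τ)) ws + strip ss)) (map-++ vout vs [ b τ ]) ⟨
      blk 1 K K (pending (r τ) (vs ∷ʳ b τ) + strip ss)
        ∎
      where open ≡-Reasoning

    private
      length-∷ʳ : ∀ {A : Set} (xs : List A) x → length (xs ∷ʳ x) ≡ suc (length xs)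
      length-∷ʳ xs x = trans (length-++ xs) (+-comm (length xs) 1)

    Short : List Tile → Set
    Short s = length s ≤ length tiles

    path-strip : ∀ {n h vs h′ ws} → length vs ≡ 2 + c → Path n h vs h′ ws →
                 ∃ λ τs → length τs ≡ n × pending h vs + strip (map [_] τs) ≡ target n h′ ws
    path-strip len done = [] , refl , +-identityʳ _
    path-strip {vs = _ ∷ vs} len (step τ refl refl π)
      with τs , eqn , eq ← path-strip (trans (length-∷ʳ vs (b τ)) len) π
      = τ ∷ τs , cong suc eqn
      , trans (strip-step₁ τ vs (map [_] τs) (suc-injective len)) (cong (blk 1 K K) eq)

    -- Without carries the digits can be compared one by one. The first digit of a cell forces a
    -- single tile, the other two force its left and top colours to be the ones pending; what
    -- remains is the same equation for the next cell.
    strip-path : ∀ {h vs h′ ws} ss → All Short ss → length vs ≡ 2 + c → length ws ≡ 2 + c →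
                 pending h vs + strip ss ≡ target (length ss) h′ ws → Path (length ss) h vs h′ ws
    strip-path {vs = vs} {ws = ws} [] _ lv lw eq
      with refl , refl ← pending-injective vs ws lv lw (trans (sym (+-identityʳ _)) eq) = done
    strip-path {h} {v ∷ vs} {h′} {ws} (s ∷ ss) (short ∷ shorts) lv lw eq =
      unique s short (trans (sym (strip-step h v vs s ss (suc-injective lv))) eq) eq
      where
      sum≤ : ∀ (f : Tile → ℕ) s → (∀ τ → f τ ≤ K) → sum (map f s) ≤ length s * K
      sum≤ f []      _ = z≤n
      sum≤ f (τ ∷ s) h = +-mono-≤ (h τ) (sum≤ f s h)

      fits : ∀ {e} (f : Tile → ℕ) s → Short s → e ≤ K → (∀ τ → f τ ≤ K) → e + sum (map f s) < B
      fits f s short e h = ≤-<-trans (+-mono-≤ e (≤-trans (sum≤ f s h) (*-monoˡ-≤ K short))) large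

      count : ∀ s → Short s → length s < B
      count s short = ≤-<-trans (≤-trans short
        (≤-trans (≤-trans (≤-reflexive (sym (*-identityʳ _))) (*-monoʳ-≤ (length tiles) (≤-trans (s≤s z≤n) (hcode<K h)))) (m≤n+m _ K))) large

      one<B : 1 < B
      one<B = ≤-<-trans (≤-trans (s≤s z≤n) (hcode<K h)) K<B

      unique : ∀ s → Short s →
        blk (length s) (hout h + sum (map (hcode ∘ l) s)) (vout v + sum (map (vcode ∘ t) s))
          (carry (sum (map (hout ∘ r) s)) (map vout vs ∷ʳ sum (map (vout ∘ b) s)) + strip ss)
        ≡ target (suc (length ss)) h′ ws →
        pending h (v ∷ vs) + strip (s ∷ ss) ≡ target (suc (length ss)) h′ ws →
        Path (suc (length ss)) h (v ∷ vs) h′ ws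
      unique s short eq₁ eq₂
        with blk-injective (count s short)
               (fits (hcode ∘ l) s short (m∸n≤m K (hcode h)) (λ τ → <⇒≤ (hcode<K (l τ))))
               (fits (vcode ∘ t) s short (m∸n≤m K (vcode v)) (λ τ → <⇒≤ (vcode<K (t τ))))
               one<B K<B K<B eq₁
      -- The first digit gives `length s ≡ 1`, which excludes all other shapes of `s`.
      unique (τ ∷ []) short eq₁ eq₂ | _ , eqh , eqv , _
        = step τ lτ≡h tτ≡v (strip-path ss shorts (trans (length-∷ʳ vs (b τ)) lv) lw
            (blk-injective one<B K<B K<B one<B K<B K<B (trans (sym (strip-step₁ τ vs ss (suc-injective lv)))
              (trans (cong₂ (λ h v → pending h (v ∷ vs) + strip ([ τ ] ∷ ss)) lτ≡h tτ≡v) eq₂)) .proj₂ .proj₂ .proj₂))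
        where
        lτ≡h : l τ ≡ h
        lτ≡h = hcode-injective (+-cancelˡ-≡ (hout h) _ _
          (trans (cong (hout h +_) (sym (+-identityʳ _))) (trans eqh (sym (hout+hcode h)))))

        tτ≡v : t τ ≡ v
        tτ≡v = vcode-injective (+-cancelˡ-≡ (vout v) _ _
          (trans (cong (vout v +_) (sym (+-identityʳ _))) (trans eqv (sym (vout+vcode v)))))

    -- The last cell, whose items are the largest, comes at the front, so the list can be
    -- descending.
    items : ℕ → List ℕ
    items zero    = []
    items (suc i) = map (dbl ∘ zeros i ∘ single) tiles ++ items i

    sum-cell : ∀ i s → sum (map (dbl ∘ zeros i ∘ single) s) ≡ dbl (zeros i (cell s))
    sum-cell i []      = sym (cong dbl (zeros-0 i))
    sum-cell i (τ ∷ s) = trans (cong (dbl (zeros i (single τ)) +_) (sum-cell i s))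
      (trans (dbl-+ (zeros i (single τ)) (zeros i (cell s))) (cong dbl (zeros-+ i (single τ) (cell s))))

    sum-snoc : ∀ ss s A → sum A ≡ dbl (strip ss) →
               sum (map (dbl ∘ zeros (length ss) ∘ single) s ++ A) ≡ dbl (strip (ss ∷ʳ s))
    sum-snoc ss s A eq = begin
      sum (map f s ++ A)                              ≡⟨ sum-++ (map f s) A ⟩
      sum (map f s) + sum A                           ≡⟨ cong₂ _+_ (sum-cell (length ss) s) eq ⟩
      dbl (zeros (length ss) (cell s)) + dbl (strip ss)  ≡⟨ +-comm _ (dbl (strip ss)) ⟩
      dbl (strip ss) + dbl (zeros (length ss) (cell s))  ≡⟨ dbl-+ (strip ss) _ ⟩
      dbl (strip ss + zeros (length ss) (cell s))     ≡⟨ cong dbl (strip-∷ʳ ss s) ⟨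
      dbl (strip (ss ∷ʳ s))                           ∎
      where
      open ≡-Reasoning
      f = dbl ∘ zeros (length ss) ∘ single

    selection : ∀ n {A A′} → Interleaving A A′ (items n) →
                ∃ λ ss → length ss ≡ n × All Short ss × sum A ≡ dbl (strip ss)
    selection zero    [] = [] , refl , [] , refl
    selection (suc i) mix
      with s , A , _ , refl , short , mix′ ← interleaving-prefix _ tiles mix
      with ss , refl , shorts , eq ← selection i mix′
      = ss ∷ʳ s , length-∷ʳ ss s , All.++⁺ shorts (short ∷ []) , sum-snoc ss s A eq

    select : (∀ τ → τ ∈ tiles) → ∀ n τs → length τs ≡ n →
             ∃₂ λ A A′ → Interleaving A A′ (items n) × sum A ≡ dbl (strip (map [_] τs))
    select all∈ zero    []       _   = [] , [] , [] , refl
    select all∈ (suc i) τs       len with initLast τs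
    ... | τs ∷ʳ′ τ
      with A , _ , mix , eq ← select all∈ i τs (suc-injective (trans (sym (length-∷ʳ τs τ)) len))
      with A′ , mix′ ← interleaving-choose (dbl ∘ zeros i ∘ single) (all∈ τ) mix
      = _ , A′ , mix′
      , trans (subst (λ k → sum (map (dbl ∘ zeros k ∘ single) [ τ ] ++ A) ≡ dbl (strip (map [_] τs ∷ʳ [ τ ])))
                     (trans (length-map [_] τs) (suc-injective (trans (sym (length-∷ʳ τs τ)) len)))
                     (sum-snoc (map [_] τs) [ τ ] A eq))
              (cong (dbl ∘ strip) (sym (map-++ [_] τs [ τ ])))

    sum-items : ∀ n → sum (items n) ≡ dbl (strip (replicate n tiles))
    sum-items zero    = refl
    sum-items (suc i) = trans
      (subst (λ k → sum (map (dbl ∘ zeros k ∘ single) tiles ++ items i) ≡ dbl (strip (replicate i tiles ∷ʳ tiles)))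
        (length-replicate i) (sum-snoc (replicate i tiles) tiles (items i) (sum-items i)))
      (cong (dbl ∘ strip) (replicate-∷ʳ i))
      where
      replicate-∷ʳ : ∀ i → replicate i tiles ∷ʳ tiles ≡ replicate (suc i) tiles
      replicate-∷ʳ zero    = refl
      replicate-∷ʳ (suc i) = cong (tiles ∷_) (replicate-∷ʳ i)

-- Digits of the target and of the sum of all items

module Layouts (Θ : TileSet) (h₀ h₁ : TileSet.H Θ) where
  open TileSet Θ
  open Radix B
  open Tilings Θ

  -- Cells differ in what they receive. Nothing comes from above in the first row, and nothing from
  -- the left in its first cell, so there the target has the colour code itself instead of K. After
  -- the strip come C cells that only receive the complements of the final colours; the first of
  -- these, `end`, also does so from the left.
  data BlockType : Set where
    corner top end bottom : V → BlockType
    inner                 : BlockType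

  -- The strip has the colours v ∷ vs on its top and w ∷ ws on its bottom edge.
  layout : V → List V → ℕ → V → List V → List BlockType
  layout v vs m w ws = corner v ∷ map top vs ++ replicate m inner ++ end w ∷ map bottom ws

  Block : Set
  Block = ℕ × ℕ × ℕ

  demand supply : BlockType → Block
  demand (corner v) = 1 , hcode h₀ , vcode v
  demand (top v)    = 1 , K , vcode v
  demand inner      = 1 , K , K
  demand (end w)    = 0 , hout h₁ , vout w
  demand (bottom w) = 0 , 0 , vout w

  private
    totals : (Tile → ℕ) → ℕ
    totals f = sum (map f tiles)

    Σl Σt Σr Σb : ℕ
    Σl = totals (hcode ∘ l)
    Σt = totals (vcode ∘ t)
    Σr = totals (hout ∘ r)
    Σb = totals (vout ∘ b)

  supply (corner _) = length tiles , Σl , Σt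
  supply (top _)    = length tiles , Σr + Σl , Σt
  supply inner      = length tiles , Σr + Σl , Σb + Σt
  supply (end _)    = 0 , Σr , Σb
  supply (bottom _) = 0 , 0 , Σb

  -- The given colours on the left and top boundary act like complements pending from imaginary
  -- cells; the items supply what is missing to 1, K, K.
  demand-target : ∀ v vs m w ws →
    pending h₀ (v ∷ vs) + blocks (map demand (layout v vs m w ws)) 0 ≡ target (suc (length vs + m)) h₁ (w ∷ ws)
  demand-target v vs m w ws = trans
    (cong (_+ blocks (map demand (layout v vs m w ws)) 0) (carry-∷ (hout h₀) (vout v) (map vout vs)))
    (trans (blk-+ 0 (hout h₀) (vout v) _ 1 (hcode h₀) (vcode v) _)
      (trans (cong₂ (λ x y → blk 1 x y (queue (map vout vs) + blocks (map demand (map top vs ++ replicate m inner ++ end w ∷ map bottom ws)) 0))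
        (hout+hcode h₀) (vout+vcode v)) (cong (blk 1 K K) (tops vs))))
    where
    bottoms : ∀ ws → blocks (map demand (map bottom ws)) 0 ≡ queue (map vout ws)
    bottoms []       = refl
    bottoms (w ∷ ws) = cong (blk 0 0 (vout w)) (bottoms ws)

    inners : ∀ m → blocks (map demand (replicate m inner ++ end w ∷ map bottom ws)) 0 ≡ target m h₁ (w ∷ ws)
    inners zero    = trans (cong (blk 0 (hout h₁) (vout w)) (bottoms ws)) (sym (carry-∷ (hout h₁) (vout w) (map vout ws)))
    inners (suc m) = cong (blk 1 K K) (inners m)

    tops : ∀ vs → queue (map vout vs) + blocks (map demand (map top vs ++ replicate m inner ++ end w ∷ map bottom ws)) 0
                  ≡ target (length vs + m) h₁ (w ∷ ws)
    tops []       = inners m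
    tops (v ∷ vs) = trans (blk-+ 0 0 (vout v) _ 1 K (vcode v) _)
      (trans (cong (λ y → blk 1 K y (queue (map vout vs) + blocks (map demand (map top vs ++ replicate m inner ++ end w ∷ map bottom ws)) 0))
        (vout+vcode v)) (cong (blk 1 K K) (tops vs)))

  private
    replicate-snoc : ∀ {A : Set} n (x : A) → replicate n x ∷ʳ x ≡ replicate (suc n) x
    replicate-snoc zero    x = refl
    replicate-snoc (suc n) x = cong (x ∷_) (replicate-snoc n x)

  module _ {c : ℕ} where
    open Width c

    -- Taking every item means putting all of `tiles` on every cell. The queue starts with zeros
    -- because nothing comes from above, so `carry-strip` also computes this sum cell by cell.
    supply-strip : ∀ v vs m w ws → length vs ≡ suc c → length ws ≡ suc c →
      strip (replicate (suc (length vs + m)) tiles) ≡ blocks (map supply (layout v vs m w ws)) 0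
    supply-strip v vs m w ws lv lw = begin
      strip (replicate (suc (length vs + m)) tiles)
        ≡⟨ cong (_+ strip (replicate (suc (length vs + m)) tiles)) empty ⟨
      carry 0 (0 ∷ replicate (length vs) 0) + strip (replicate (suc (length vs + m)) tiles)
        ≡⟨ carry-strip 0 0 (replicate (length vs) 0) tiles (replicate (length vs + m) tiles) (trans (length-replicate (length vs)) lv) ⟩
      blk (length tiles) Σl Σt (carry Σr (replicate (length vs) 0 ∷ʳ Σb) + strip (replicate (length vs + m) tiles))
        ≡⟨ cong (blk (length tiles) Σl Σt) (tops vs 1 (trans (+-comm (length vs) 1) (cong suc lv))) ⟩
      blocks (map supply (layout v vs m w ws)) 0
        ∎
      where
      open ≡-Reasoning

      empty : carry 0 (0 ∷ replicate (length vs) 0) ≡ 0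
      empty = trans (carry-∷ 0 0 (replicate (length vs) 0)) (trans (cong (blk 0 0 0) (queue-zeros (length vs))) blk-0)

      bottoms : ∀ ws → blocks (map supply (map bottom ws)) 0 ≡ queue (replicate (length ws) Σb)
      bottoms []       = refl
      bottoms (w ∷ ws) = cong (blk 0 0 Σb) (bottoms ws)

      inners : ∀ m → carry Σr (replicate (2 + c) Σb) + strip (replicate m tiles) ≡
                     blocks (map supply (replicate m inner ++ end w ∷ map bottom ws)) 0
      inners zero = trans (+-identityʳ _) (trans (carry-∷ Σr Σb (replicate (suc c) Σb))
        (cong (blk 0 Σr Σb) (trans (cong (λ n → queue (replicate n Σb)) (sym lw)) (sym (bottoms ws)))))
      inners (suc m) = trans (carry-strip Σr Σb (replicate (suc c) Σb) tiles (replicate m tiles) (length-replicate (suc c)))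
        (cong (blk (length tiles) (Σr + Σl) (Σb + Σt))
          (trans (cong (λ q → carry Σr q + strip (replicate m tiles)) (replicate-snoc (suc c) Σb)) (inners m)))

      -- The queue has a zero for every cell of the first row still to come and k totals from the
      -- cells already passed.
      tops : ∀ vs k → length vs + k ≡ 2 + c →
             carry Σr (replicate (length vs) 0 ++ replicate k Σb) + strip (replicate (length vs + m) tiles) ≡
             blocks (map supply (map top vs ++ replicate m inner ++ end w ∷ map bottom ws)) 0
      tops []       k refl = inners m
      tops (v ∷ vs) k len  = trans
        (carry-strip Σr 0 (replicate (length vs) 0 ++ replicate k Σb) tiles (replicate (length vs + m) tiles)
          (trans (length-++ (replicate (length vs) 0)) (trans (cong₂ _+_ (length-replicate (length vs)) (length-replicate k)) (suc-injective len))))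
        (cong (blk (length tiles) (Σr + Σl) Σt)
          (trans (cong (λ q → carry Σr q + strip (replicate (length vs + m) tiles))
                   (trans (++-assoc (replicate (length vs) 0) (replicate k Σb) (Σb ∷ []))
                     (cong (replicate (length vs) 0 ++_) (replicate-snoc k Σb))))
            (tops vs (suc k) (trans (+-suc (length vs) k) len))))

  _⊞_ : Block → Block → Block
  (a , b , c) ⊞ (a′ , b′ , c′) = a + a′ , b + b′ , c + c′

  blocks-+ : ∀ (f g : BlockType → Block) β x y →
             blocks (map f β) x + blocks (map g β) y ≡ blocks (map (λ τ → f τ ⊞ g τ) β) (x + y)
  blocks-+ f g []      x y = refl
  blocks-+ f g (τ ∷ β) x y with f τ | g τ
  ... | p , q , s | p′ , q′ , s′ = trans (blk-+ p q s (blocks (map f β) x) p′ q′ s′ (blocks (map g β) y))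
    (cong (blk (p + p′) (q + q′) (s + s′)) (blocks-+ f g β x y))

  blocks-tail : ∀ (f : BlockType → Block) β x → blocks (map f β) x ≡ blocks (map f β) 0 + zeros (length β) x
  blocks-tail f []      x = refl
  blocks-tail f (τ ∷ β) x with f τ
  ... | p , q , s = trans (cong₂ (λ p y → blk p q s y) (sym (+-identityʳ p)) (blocks-tail f β x))
    (trans (cong₂ (λ q s → blk (p + 0) q s (blocks (map f β) 0 + zeros (length β) x)) (sym (+-identityʳ q)) (sym (+-identityʳ s)))
      (sym (blk-+ p q s (blocks (map f β) 0) 0 0 0 (zeros (length β) x))))

  _⊑_ : Block → Block → Set
  (a , b , c) ⊑ (a′ , b′ , c′) = a ≤ a′ × b ≤ b′ × c ≤ c′

  blocks-mono : ∀ (f g : BlockType → Block) → (∀ τ → f τ ⊑ g τ) → ∀ β {x} → blocks (map f β) x ≤ blocks (map g β) x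
  blocks-mono f g h []      = ≤-refl
  blocks-mono f g h (τ ∷ β) with f τ | g τ | h τ
  ... | _ | _ | a , b , c = blk-mono a b c (blocks-mono f g h β)

  private
    0<hout : ∀ h → 0 < hout h
    0<hout h = m<n⇒0<n∸m (hcode<K h)

    0<vout : ∀ v → 0 < vout v
    0<vout v = m<n⇒0<n∸m (vcode<K v)

    0<K : 0 < K
    0<K = ≤-<-trans z≤n (hcode<K h₀)

    length≤total : ∀ (f : Tile → ℕ) → (∀ τ → 0 < f τ) → ∀ s → length s ≤ sum (map f s)
    length≤total f pos []      = z≤n
    length≤total f pos (τ ∷ s) = +-mono-≤ (pos τ) (length≤total f pos s)

    K+K≤ : ∀ f → (∀ τ → 0 < f τ) → K + K ≤ totals f
    K+K≤ f pos = ≤-trans many (length≤total f pos tiles)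

  -- A doubled colour digit of the target is at most 2 K, whereas a colour total sums at least 2 K
  -- positive terms: codes are positive, and their complements too since codes stay below K.
  demand-supply : ∀ τ → (demand τ ⊞ demand τ) ⊑ supply τ
  demand-supply τ = cases τ
    where
    tile : 2 ≤ length tiles
    tile = ≤-trans (+-mono-≤ 0<K 0<K) many

    H≤ : ∀ {x f} → x ≤ K → (∀ τ → 0 < f τ) → x + x ≤ totals f
    H≤ x≤K pos = ≤-trans (+-mono-≤ x≤K x≤K) (K+K≤ _ pos)

    l≤ r≤ t≤ b≤ : ∀ {x} → x ≤ K → _
    l≤ x≤K = H≤ x≤K (0<hcode ∘ l)
    r≤ x≤K = H≤ x≤K (0<hout ∘ r)
    t≤ x≤K = H≤ x≤K (0<vcode ∘ t)
    b≤ x≤K = H≤ x≤K (0<vout ∘ b)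

    cases : ∀ τ → (demand τ ⊞ demand τ) ⊑ supply τ
    cases (corner v) = tile , l≤ (<⇒≤ (hcode<K h₀)) , t≤ (<⇒≤ (vcode<K v))
    cases (top v)    = tile , ≤-trans (r≤ ≤-refl) (m≤m+n Σr Σl) , t≤ (<⇒≤ (vcode<K v))
    cases inner      = tile , ≤-trans (r≤ ≤-refl) (m≤m+n Σr Σl) , ≤-trans (b≤ ≤-refl) (m≤m+n Σb Σt)
    cases (end w)    = z≤n , r≤ (m∸n≤m K (hcode h₁)) , b≤ (m∸n≤m K (vcode w))
    cases (bottom w) = z≤n , z≤n , b≤ (m∸n≤m K (vcode w))

  -- Sizes and order of the items

  zeros-< : ∀ n {x y} → x < y → zeros n x < zeros n y
  zeros-< zero    h = h
  zeros-< (suc n) h = blk-< 0<B 0<B 0<B (zeros-< n h)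

  private
    1<B : 1 < B
    1<B = ≤-<-trans 0<K K<B

    hcode<B : ∀ h → hcode h < B
    hcode<B h = <-trans (hcode<K h) K<B

    vcode<B : ∀ v → vcode v < B
    vcode<B v = <-trans (vcode<K v) K<B

    -- Only the bottom digit of an item moves with the width of the strip. This is `high`; `low`
    -- collects the digits that stay in place, all of them below it.
    low high : Tile → ℕ
    low τ  = blk 1 (hcode (l τ)) (vcode (t τ)) (blk 0 (hout (r τ)) 0 0)
    high τ = blk 0 0 (vout (b τ)) 0

    low< : ∀ τ → low τ < zeros 2 1
    low< τ = blk-< 1<B (hcode<B (l τ)) (vcode<B (t τ)) (blk-< 0<B (hout<B (r τ)) 0<B (s≤s z≤n))

    high< : ∀ τ → high τ < zeros 1 1
    high< τ = blk-< 0<B 0<B (vout<B (b τ)) (s≤s z≤n)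

    0<high : ∀ τ → 0 < high τ
    0<high τ = subst (_< high τ) blk-0 (mono 0<B (0<vout (b τ)))
      where
      mono : ∀ {v} → 0 < B → 0 < v → blk 0 0 0 0 < blk 0 0 v 0
      mono {suc v} (s≤s {n = B′} _) _ = *-monoʳ-< (suc B′) (*-monoʳ-< (suc B′) (s≤s (≤-trans (≤-reflexive (*-zeroʳ B′)) z≤n)))

  module Order (c : ℕ) where
    open Width c

    single-split : ∀ τ → single τ ≡ low τ + zeros 2 (zeros c (high τ))
    single-split τ = sym (trans (blk-+ 1 (hcode (l τ)) (vcode (t τ)) (blk 0 (hout (r τ)) 0 0) 0 0 0 (zeros 1 (zeros c (high τ))))
      (trans (cong₂ (λ x y → blk 1 x y (blk 0 (hout (r τ)) 0 0 + zeros 1 (zeros c (high τ)))) (+-identityʳ _) (+-identityʳ _))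
        (cong (blk 1 (hcode (l τ)) (vcode (t τ))) (trans (blk-+ 0 (hout (r τ)) 0 0 0 0 0 (zeros c (high τ)))
          (cong (λ x → blk 0 x 0 (zeros c (high τ))) (+-identityʳ _))))))

    single-upper : ∀ τ → single τ < zeros (3 + c) 1
    single-upper τ = subst (single τ <_) (cong (zeros 2) (trans (zeros-∘ c 1 1) (cong (λ n → zeros n 1) (+-comm c 1))))
      (blk-< 1<B (hcode<B (l τ)) (vcode<B (t τ)) (blk-< 0<B (hout<B (r τ)) 0<B (zeros-< c (high< τ))))

    -- The complement of the bottom colour is positive, so every item reaches into the cell C places
    -- ahead. With `single-upper`, the sizes of items of different cells lie in disjoint ranges.
    single-lower : ∀ τ → zeros (2 + c) 1 ≤ single τ
    single-lower τ = blk-mono z≤n z≤n z≤n (blk-mono z≤n z≤n z≤n (zeros-mono c (0<high τ)))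

    item : ℕ → Tile → ℕ
    item i τ = dbl (zeros i (single τ))

    item-upper : ∀ {i n} τ → i < n → item i τ ≤ dbl (zeros (n + (2 + c)) 1)
    item-upper {i} {n} τ i<n = +-mono-≤ half half
      where
      zeros-grow : ∀ {i j} → i ≤ j → zeros i 1 ≤ zeros j 1
      zeros-grow {j = zero}  z≤n     = ≤-refl
      zeros-grow {j = suc j} z≤n     = ≤-<-trans z≤n (zeros-< (suc j) (s≤s z≤n))
      zeros-grow (s≤s h) = blk-mono z≤n z≤n z≤n (zeros-grow h)

      half : zeros i (single τ) ≤ zeros (n + (2 + c)) 1
      half = begin
        zeros i (single τ)           ≤⟨ zeros-mono i (<⇒≤ (single-upper τ)) ⟩
        zeros i (zeros (3 + c) 1)    ≡⟨ zeros-∘ i (3 + c) 1 ⟩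
        zeros (i + (3 + c)) 1        ≡⟨ cong (λ k → zeros k 1) (+-suc i (2 + c)) ⟩
        zeros (suc i + (2 + c)) 1    ≤⟨ zeros-grow (+-monoˡ-≤ (2 + c) i<n) ⟩
        zeros (n + (2 + c)) 1        ∎
        where open ≤-Reasoning

    item-lower : ∀ i τ → dbl (zeros (i + (2 + c)) 1) ≤ item i τ
    item-lower i τ = +-mono-≤ half half
      where
      half : zeros (i + (2 + c)) 1 ≤ zeros i (single τ)
      half = ≤-trans (≤-reflexive (sym (zeros-∘ i (2 + c) 1))) (zeros-mono i (single-lower τ))

    items-upper : ∀ n → All (_≤ dbl (zeros (n + (2 + c)) 1)) (items n)
    items-upper n = go n ≤-refl
      where
      go : ∀ i → i ≤ n → All (_≤ dbl (zeros (n + (2 + c)) 1)) (items i)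
      go zero    _ = []
      go (suc i) h = All.++⁺ (All.map⁺ (All.universal (λ τ → item-upper τ h) tiles)) (go i (<⇒≤ h))

    items-positive : ∀ n → All (0 <_) (items n)
    items-positive zero    = []
    items-positive (suc i) = All.++⁺
      (All.map⁺ (All.universal (λ τ → <-≤-trans (+-mono-<-≤ (zeros-pos (i + (2 + c))) z≤n) (item-lower i τ)) tiles))
      (items-positive i)
      where
      zeros-pos : ∀ n → 0 < zeros n 1
      zeros-pos n = ≤-<-trans z≤n (zeros-< n (s≤s z≤n))

  -- A tile list in this order is in the right order for strips of any width.
  Descending : Tile → Tile → Set
  Descending τ τ′ = Width.single 0 τ′ ≤ Width.single 0 τ

  module _ {c : ℕ} where
    open Width c
    open Order c

    -- For every width the order is the lexicographic one, by `high` and then by `low`.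
    descending-single : ∀ {τ τ′} → Descending τ τ′ → single τ′ ≤ single τ
    descending-single {τ} {τ′} h = subst₂ _≤_ (sym (single-split τ′)) (sym (single-split τ)) (split (<-cmp (high τ′) (high τ)))
      where
      open ≤-Reasoning

      exceeds : ∀ {σ ρ : Tile} {x y} → x < y → low σ + zeros 2 x < low ρ + zeros 2 y
      exceeds {σ} {ρ} {x} {y} x<y = begin-strict
        low σ + zeros 2 x         <⟨ +-monoˡ-< (zeros 2 x) (low< σ) ⟩
        zeros 2 1 + zeros 2 x     ≡⟨ zeros-+ 2 1 x ⟩
        zeros 2 (suc x)           ≤⟨ zeros-mono 2 x<y ⟩
        zeros 2 y                 ≤⟨ m≤n+m (zeros 2 y) (low ρ) ⟩
        low ρ + zeros 2 y         ∎

      h₀′ : low τ′ + zeros 2 (high τ′) ≤ low τ + zeros 2 (high τ)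
      h₀′ = subst₂ _≤_ (Order.single-split 0 τ′) (Order.single-split 0 τ) h

      split : Tri (high τ′ < high τ) (high τ′ ≡ high τ) (high τ < high τ′) →
              low τ′ + zeros 2 (zeros c (high τ′)) ≤ low τ + zeros 2 (zeros c (high τ))
      split (tri< lt _ _) = <⇒≤ (exceeds {τ′} {τ} (zeros-< c lt))
      split (tri≈ _ eq _) = subst (λ x → low τ′ + zeros 2 (zeros c (high τ′)) ≤ low τ + zeros 2 (zeros c x)) eq
        (+-monoˡ-≤ _ (+-cancelʳ-≤ (zeros 2 (high τ′)) _ _ (subst (λ x → low τ′ + zeros 2 (high τ′) ≤ low τ + zeros 2 x) (sym eq) h₀′)))
      split (tri> _ _ gt) = contradiction h₀′ (<⇒≱ (exceeds {τ} {τ′} gt))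

    items-descending : AllPairs Descending tiles → ∀ n → AllPairs _≥_ (items n)
    items-descending sorted zero    = []
    items-descending sorted (suc i) = AllPairs.++⁺
      (AllPairs.map⁺ (AllPairs.map (λ {τ} {τ′} h → +-mono-≤ (zeros-mono i (descending-single {τ} {τ′} h)) (zeros-mono i (descending-single {τ} {τ′} h))) sorted))
      (items-descending sorted i)
      (All.map⁺ (All.universal (λ τ → All.map (λ h → ≤-trans h (item-lower i τ)) (items-upper i)) tiles))

dbl-injective : ∀ {x y} → dbl x ≡ dbl y → x ≡ y
dbl-injective {x} {y} eq with <-cmp x y
... | tri< lt _ _ = contradiction eq (<⇒≢ (+-mono-< lt lt))
... | tri≈ _ e _  = e
... | tri> _ _ gt = contradiction (sym eq) (<⇒≢ (+-mono-< gt gt))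

-- The scheduling instance of a tiling problem

module Reductions (Θ : TileSet) (h₀ h₁ : TileSet.H Θ) where
  open TileSet Θ
  open Radix B
  open Tilings Θ
  open Layouts Θ h₀ h₁

  -- The digits of L₂, of half of q and of half of the threshold 3 q.
  twice both threefold : BlockType → Block
  twice τ   = demand τ ⊞ demand τ
  both τ    = supply τ ⊞ demand τ
  threefold τ = both τ ⊞ (both τ ⊞ both τ)

  module Strip (complete : ∀ τ → τ ∈ tiles) (sorted : AllPairs Descending tiles)
           {c : ℕ} (v : V) (vs : List V) (m : ℕ) (w : V) (ws : List V)
           (lv : length vs ≡ suc c) (lw : length ws ≡ suc c) where
    open Width c
    open Order c

    private
      β : List BlockType
      β = layout v vs m w ws

      N : ℕ
      N = suc (length vs + m)

      D S y : ℕ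
      D = blocks (map demand β) 0
      S = blocks (map supply β) 0
      -- A digit 2 beyond all others: one power of the base bounds the undoubled items, so `y`
      -- bounds the items, and it makes L₂ exceed tA = 2 D.
      y = zeros (length β) 2

      -- Abstract, so that the schedules in `Shop` are not evaluated.
      abstract
        L₁ L₂ q : ℕ
        L₁ = blocks (map supply β) 2
        L₂ = blocks (map twice β) 2
        q  = dbl (blocks (map both β) 2)

        L₁-def : L₁ ≡ blocks (map supply β) 2
        L₁-def = refl

        L₂-def : L₂ ≡ blocks (map twice β) 2
        L₂-def = refl

        q-def : q ≡ dbl (blocks (map both β) 2)
        q-def = refl

      L₁≡ : L₁ ≡ S + y
      L₁≡ = trans L₁-def (blocks-tail supply β 2)

      L₂≡ : L₂ ≡ D + D + y
      L₂≡ = trans L₂-def (trans (blocks-tail twice β 2) (cong (_+ y) (sym (blocks-+ demand demand β 0 0))))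

      q≡ : q ≡ dbl (S + D + y)
      q≡ = trans q-def (cong dbl (trans (blocks-tail both β 2) (cong (_+ y) (sym (blocks-+ supply demand β 0 0)))))

      2D≤S : D + D ≤ S
      2D≤S = ≤-trans (≤-reflexive (blocks-+ demand demand β 0 0)) (blocks-mono twice supply demand-supply β)

      S≡ : D + (S ∸ D) ≡ S
      S≡ = m+[n∸m]≡n (≤-trans (m≤m+n D D) 2D≤S)

      length-β : length β ≡ N + (2 + c)
      length-β = cong suc (trans (length-++ (map top vs)) (trans (cong₂ _+_ (length-map top vs)
        (trans (length-++ (replicate m inner)) (cong₂ _+_ (length-replicate m) (cong suc (trans (length-map bottom ws) lw)))))
        (sym (+-assoc (length vs) m (2 + c)))))

      y≡ : dbl (zeros (N + (2 + c)) 1) ≡ y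
      y≡ = trans (zeros-+ (N + (2 + c)) 1 1) (cong (λ n → zeros n 2) (sym length-β))

      0<y : 0 < y
      0<y = ≤-<-trans z≤n (zeros-< (length β) {0} {2} (s≤s z≤n))

      0<D : 0 < D
      0<D = s≤s z≤n

      q≡A : q ≡ L₁ + (L₁ + dbl D)
      q≡A = trans q≡ (trans (lemma S D y) (sym (cong (λ L → L + (L + dbl D)) L₁≡)))
        where
        lemma : ∀ s d y → (s + d + y) + (s + d + y) ≡ s + y + (s + y + (d + d))
        lemma = solve-∀

      q≡B : q ≡ L₂ + (L₂ + dbl (S ∸ D))
      q≡B = trans q≡ (trans (cong (λ s → dbl (s + D + y)) (sym S≡)) (trans (lemma D (S ∸ D) y)
        (sym (cong (λ L → L + (L + dbl (S ∸ D))) L₂≡))))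
        where
        lemma : ∀ d e y → (d + e + d + y) + (d + e + d + y) ≡ d + d + y + (d + d + y + (e + e))
        lemma = solve-∀

      balance : dbl D + dbl (S ∸ D) ≡ sum (items N)
      balance = trans (dbl-+ D (S ∸ D)) (trans (cong dbl (trans S≡ (sym (supply-strip v vs m w ws lv lw)))) (sym (sum-items N)))

      D<L₂ : dbl D < L₂
      D<L₂ = subst (dbl D <_) (sym L₂≡) (m<m+n (dbl D) 0<y)

      L₂≤L₁ : L₂ ≤ L₁
      L₂≤L₁ = subst₂ _≤_ (sym L₂≡) (sym L₁≡) (+-monoˡ-≤ y 2D≤S)

      items≤L₂ : All (_≤ L₂) (items N)
      items≤L₂ = All.map (λ h → ≤-trans h (≤-trans (≤-reflexive y≡) (≤-trans (m≤n+m y (D + D)) (≤-reflexive (sym L₂≡))))) (items-upper N)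

      module Shop = BalancedShop L₁ L₂ q (dbl D) (dbl (S ∸ D)) (items N) q≡A q≡B balance
        (+-mono-<-≤ 0<D z≤n) D<L₂ L₂≤L₁ items≤L₂ (items-positive N)

    reduced : ShopInstance × ℕ
    reduced = Shop.instanceOf

    reduced-numbers : List ℕ
    reduced-numbers = dbl (blocks (map threefold β) 6) ∷ dbl (blocks (map both β) 2) ∷
                      blocks (map supply β) 2 ∷ blocks (map twice β) 2 ∷ items N

    reduced-encode : DecisionProblem.encode MixedShop reduced ≡ encodeℕs reduced-numbers
    reduced-encode = cong encodeℕs (cong₂ _∷_
      (trans (cong (λ q → q + (q + q)) q-def) (trans (lemma Q)
        (cong dbl (trans (cong (Q +_) (blocks-+ both both β 2 2)) (blocks-+ both (λ τ → both τ ⊞ both τ) β 2 4)))))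
      (cong₂ _∷_ q-def (cong₂ _∷_ L₁-def (cong (_∷ items N) L₂-def))))
      where
      Q : ℕ
      Q = blocks (map both β) 2

      lemma : ∀ x → x + x + (x + x + (x + x)) ≡ x + (x + x) + (x + (x + x))
      lemma = solve-∀

    reduced-admissible : DecisionProblem.Admissible (restrict MixedShop OpenJobLargest) reduced
    reduced-admissible =
      ( (<-≤-trans (≤-<-trans z≤n D<L₂) L₂≤L₁) ∷ ≤-<-trans z≤n D<L₂ ∷ items-positive N
      , L₂≤L₁ ∷ Linked.AllPairs⇒Linked (items≤L₂ ∷ items-descending sorted N)
      , Shop.0<q)
      , Shop.largest

    private
      path⇒split : Path N h₀ (v ∷ vs) h₁ (w ∷ ws) → ∃₂ λ A A′ → Interleaving A A′ (items N) × sum A ≡ dbl D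
      path⇒split π =
        let τs , len , eq = path-strip (cong suc lv) π
            A , A′ , mix , eqA = select complete N τs len
        in A , A′ , mix , trans eqA (cong dbl (+-cancelˡ-≡ (pending h₀ (v ∷ vs)) _ _
             (trans eq (sym (demand-target v vs m w ws)))))

      split⇒path : (∃₂ λ A A′ → Interleaving A A′ (items N) × sum A ≡ dbl D) → Path N h₀ (v ∷ vs) h₁ (w ∷ ws)
      split⇒path (A , _ , mix , eqA) =
        let ss , len , shorts , eqs = selection N mix
        in subst (λ n → Path n h₀ (v ∷ vs) h₁ (w ∷ ws)) len
             (strip-path ss shorts (cong suc lv) (cong suc lw)
               (trans (cong (pending h₀ (v ∷ vs) +_) (dbl-injective (trans (sym eqs) eqA)))
                 (trans (demand-target v vs m w ws) (cong (λ n → target n h₁ (w ∷ ws)) (sym len)))))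

    reduced-correct : Path N h₀ (v ∷ vs) h₁ (w ∷ ws) ⇔ DecisionProblem.Yes MixedShop reduced
    reduced-correct = ⇔.trans (mk⇔ path⇒split split⇒path) Shop.correct

-- Computation tableaux

module Rows {T C W : Set} (l r : T → C) (t b : T → W) where

  data Row : C → List W → C → List W → Set where
    []   : ∀ {c} → Row c [] c []
    tile : ∀ τ {c v w vs c′ ws} → l τ ≡ c → t τ ≡ v → b τ ≡ w → Row (r τ) vs c′ ws → Row c (v ∷ vs) c′ (w ∷ ws)

  row-++ : ∀ {c vs c′ ws vs′ c″ ws′} → Row c vs c′ ws → Row c′ vs′ c″ ws′ → Row c (vs ++ vs′) c″ (ws ++ ws′)
  row-++ []                  ρ = ρ
  row-++ (tile τ l t b ρ) ρ′ = tile τ l t b (row-++ ρ ρ′)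

  row-split : ∀ vs {c vs′ c″ ws} → Row c (vs ++ vs′) c″ ws →
              ∃ λ c′ → ∃₂ λ ws₁ ws₂ → ws ≡ ws₁ ++ ws₂ × Row c vs c′ ws₁ × Row c′ vs′ c″ ws₂
  row-split []       ρ = _ , [] , _ , refl , [] , ρ
  row-split (v ∷ vs) (tile τ l t b ρ) =
    let c′ , ws₁ , ws₂ , eq , ρ₁ , ρ₂ = row-split vs ρ
    in c′ , _ ∷ ws₁ , ws₂ , cong (_ ∷_) eq , tile τ l t b ρ₁ , ρ₂

  row-uncons : ∀ {c v vs c′ ws} → Row c (v ∷ vs) c′ ws →
               ∃ λ τ → ∃ λ ws′ → l τ ≡ c × t τ ≡ v × ws ≡ b τ ∷ ws′ × Row (r τ) vs c′ ws′
  row-uncons (tile τ l t refl ρ) = τ , _ , l , t , refl , ρ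

module _ {S : Set} where

  off : S → S × Bool
  off x = x , false

  track : List S → S → List S → List (S × Bool)
  track ls x rs = map off (reverse ls) ++ (x , true) ∷ map off rs

  track-∷ : ∀ x ls y rs → track (x ∷ ls) y rs ≡ map off (reverse ls) ++ off x ∷ (y , true) ∷ map off rs
  track-∷ x ls y rs = trans
    (cong (λ ls → map off ls ++ (y , true) ∷ map off rs) (unfold-reverse x ls))
    (trans (cong (_++ (y , true) ∷ map off rs) (map-++ off (reverse ls) [ x ]))
      (++-assoc (map off (reverse ls)) [ off x ] _))

-- The part of a tableau row that belongs to one tape, for a step that reads a, writes s and moves
-- by d. The colours tell whether the head crosses the line between two cells.
module Track {S : Set} (a s : S) (d : Move) where

  -- The symbol of the cell (nothing under the head, where it is a) and a crossing bit.
  Loc : Set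
  Loc = Maybe S × Bool

  isHead : Loc → Bool
  isHead (nothing , _) = true
  isHead (just _  , _) = false

  -- The bit of a cell says that the head enters it: from the right when the move is `left`, from
  -- the left when it is `right`. The head leaves its old cell through the opposite side.
  leftCrossing rightCrossing headBelow : Move → Loc → Bool
  leftCrossing left  ρ = isHead ρ
  leftCrossing stay  ρ = false
  leftCrossing right ρ = proj₂ ρ
  rightCrossing left  ρ = proj₂ ρ
  rightCrossing stay  ρ = false
  rightCrossing right ρ = isHead ρ
  headBelow left  ρ = proj₂ ρ
  headBelow stay  ρ = isHead ρ
  headBelow right ρ = proj₂ ρ

  above below : Loc → S × Bool
  above ρ@(m , _) = Maybe.fromMaybe a m , isHead ρ
  below ρ@(m , _) = Maybe.fromMaybe s m , headBelow d ρ

  open Rows (leftCrossing d) (rightCrossing d) above below public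

  -- Partial, unlike `move`: the columns of a tableau are fixed, so a head cannot step beyond the
  -- listed cells.
  data Moved : Move → List S → List S → List S → S → List S → Set where
    moved-left  : ∀ {x ls rs} → Moved left (x ∷ ls) rs ls x (s ∷ rs)
    moved-stay  : ∀ {ls rs} → Moved stay ls rs ls s rs
    moved-right : ∀ {x ls rs} → Moved right ls (x ∷ rs) (s ∷ ls) x rs

  private
    pass : ∀ d → (∀ x → leftCrossing d (just x , false) ≡ false × rightCrossing d (just x , false) ≡ false × headBelow d (just x , false) ≡ false)
    pass left  x = refl , refl , refl
    pass stay  x = refl , refl , refl
    pass right x = refl , refl , refl

  off-row : ∀ xs → Row false (map off xs) false (map off xs)
  off-row []       = []
  off-row (x ∷ xs) with l , r , h ← pass d x =
    tile (just x , false) l refl (cong (x ,_) h) (subst (λ c → Row c (map off xs) false (map off xs)) (sym r) (off-row xs))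

module _ {S : Set} {a s : S} where

  private
    module L = Track a s left
    module C = Track a s stay
    module R = Track a s right

  track-row : ∀ {d ls rs ls′ x rs′} → let open Track a s d in
              Moved d ls rs ls′ x rs′ → Row false (track ls a rs) false (track ls′ x rs′)
  track-row {ls = _ ∷ ls} {rs} (Track.moved-left {x}) = subst (λ vs → L.Row false vs false (track ls x (s ∷ rs)))
    (sym (track-∷ x ls a rs))
    (L.row-++ (L.off-row (reverse ls)) (L.tile (just x , true) refl refl refl
      (L.tile (nothing , false) refl refl refl (L.off-row rs))))
  track-row {ls = ls} {rs} Track.moved-stay =
    C.row-++ (C.off-row (reverse ls)) (C.tile (nothing , false) refl refl refl (C.off-row rs))
  track-row {ls = ls} {_ ∷ rs} (Track.moved-right {x}) = subst (λ ws → R.Row false (track ls a (x ∷ rs)) false ws)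
    (sym (track-∷ s ls x rs))
    (R.row-++ (R.off-row (reverse ls)) (R.tile (nothing , false) refl refl refl
      (R.tile (just x , true) refl refl refl (R.off-row rs))))

  private
    off-left : ∀ xs {c ws} → L.Row c (map off xs) false ws → c ≡ false × ws ≡ map off xs
    off-left []       L.[] = refl , refl
    off-left (x ∷ xs) (L.tile (just _ , b) refl refl refl ρ) with refl , refl ← off-left xs ρ = refl , refl

    off-stay : ∀ xs {c c′ ws} → C.Row c (map off xs) c′ ws → ws ≡ map off xs
    off-stay []       C.[] = refl
    off-stay (x ∷ xs) (C.tile (just _ , b) refl refl refl ρ) = cong (_ ∷_) (off-stay xs ρ)

    off-right : ∀ xs {c ws} → R.Row false (map off xs) c ws → c ≡ false × ws ≡ map off xs
    off-right []       R.[] = refl , refl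
    off-right (x ∷ xs) (R.tile (just _ , false) refl refl refl ρ) with refl , refl ← off-right xs ρ = refl , refl

  -- A crossing needs a head on one side of the line and a receiving cell on the other, and the
  -- colours `false` let nothing cross the ends. As there is one head above, only its neighbour in
  -- the direction of the move can have it below.
  row-track : ∀ {d} ls x rs {ws} → let open Track a s d in Row false (track ls x rs) false ws →
              x ≡ a × ∃ λ ls′ → ∃₂ λ x′ rs′ → Moved d ls rs ls′ x′ rs′ × ws ≡ track ls′ x′ rs′
  row-track {left} ls x rs ρ with L.row-split (map off (reverse ls)) ρ
  -- A head in the first cell would leave through the left end, where the colour is `false`.
  row-track {left} [] x rs ρ | _ , _ , _ , _ , L.[] , L.tile (nothing , _) () _ _ _
  row-track {left} (y ∷ ls) x rs ρ | _ , _ , _ , _ , _ , _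
    with L.row-split (map off (reverse ls)) (subst (λ vs → L.Row false vs false _) (track-∷ y ls x rs) ρ)
  ... | _ , _ , _ , refl , ρ₁ , L.tile (just _ , true) l refl refl (L.tile (nothing , false) refl refl refl ρ₂)
    with refl ← l
    with refl , refl ← off-left rs ρ₂
    with _ , refl ← off-left (reverse ls) ρ₁
    = refl , ls , y , s ∷ rs , Track.moved-left , refl
  -- With its bit set, the cell of the head would have to receive a second head from its right,
  -- where there is none.
  ... | _ , _ , _ , refl , ρ₁ , L.tile (just _ , true) l refl refl (L.tile (nothing , true) refl refl refl ρ₂)
    with () , _ ← off-left rs ρ₂
  row-track {stay} ls x rs ρ
    with C.row-split (map off (reverse ls)) ρ
  ... | _ , _ , _ , refl , ρ₁ , C.tile (nothing , _) _ refl refl ρ₂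
    with refl ← off-stay (reverse ls) ρ₁ with refl ← off-stay rs ρ₂
    = refl , ls , s , rs , Track.moved-stay , refl
  row-track {right} ls x rs ρ
    with R.row-split (map off (reverse ls)) ρ
  ... | _ , _ , _ , refl , ρ₁ , R.tile (nothing , false) l refl refl ρ₂
    with refl , refl ← off-right (reverse ls) ρ₁
    with rs | ρ₂
  ...   | y ∷ rs′ | R.tile (just _ , true) refl refl refl ρ₃
    with refl , refl ← off-right rs′ ρ₃
    = refl , s ∷ ls , y , rs′ , Track.moved-right , sym (track-∷ s ls y rs′)
  row-track {right} ls x rs ρ | _ , _ , _ , refl , ρ₁ , R.tile (nothing , true) l refl refl ρ₂
    with () , _ ← off-right (reverse ls) (subst (λ c → R.Row false _ c _) (sym l) ρ₁)

vec-ext : ∀ {A : Set} {n} {xs ys : Vec A n} → (∀ j → Vec.lookup xs j ≡ Vec.lookup ys j) → xs ≡ ys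
vec-ext {xs = xs} {ys} h = trans (sym (tabulate∘lookup xs)) (trans (tabulate-cong h) (tabulate∘lookup ys))

-- ys is xs with blanks added at the far end.
Padded : ∀ {m} → List (Symbol m) → List (Symbol m) → Set
Padded xs ys = ∃ λ k → ys ≡ xs ++ replicate k blank

module _ {m : ℕ} {s : Symbol m} where

  padded-move : ∀ {a d ls rs ls′ x rs′} (t : Tape m) → Track.Moved a s d d ls rs ls′ x rs′ →
                Padded (before t) ls → Padded (after t) rs →
                let t′ = move d (write s t) in
                x ≡ scanned t′ × Padded (before t′) ls′ × Padded (after t′) rs′
  padded-move (tape []      _ _)  Track.moved-left (suc k , refl) (j , eq) = refl , (k , refl) , (j , cong (s ∷_) eq)
  padded-move (tape (_ ∷ _) _ _)  Track.moved-left (k , refl)     (j , eq) = refl , (k , refl) , (j , cong (s ∷_) eq)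
  padded-move (tape _ _ _)        Track.moved-stay p              q        = refl , p , q
  padded-move (tape _ _ [])       Track.moved-right (k , eq) (suc j , refl) = refl , (k , cong (s ∷_) eq) , (j , refl)
  padded-move (tape _ _ (_ ∷ _))  Track.moved-right (k , eq) (j , refl)     = refl , (k , cong (s ∷_) eq) , (j , refl)

-- The tiles of a machine

module Tableau (M : TM) where
  open TM M

  n : ℕ
  n = suc workTapes

  S : Set
  S = Symbol marks

  Transition : Set
  Transition = Σ (Fin states) λ q → Σ (Vec S n) λ as → Fin (length (δ q as))

  module Of (ρ : Transition) where
    source : Fin states
    source = proj₁ ρ

    reads : Vec S n
    reads = proj₁ (proj₂ ρ)

    sink : Fin states
    sink = proj₁ (lookup (δ source reads) (proj₂ (proj₂ ρ)))

    actions : Vec (S × Move) n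
    actions = proj₂ (lookup (δ source reads) (proj₂ (proj₂ ρ)))

    module Tr (j : Fin n) = Track (Vec.lookup reads j) (proj₁ (Vec.lookup actions j)) (proj₂ (Vec.lookup actions j))

  Column : Set
  Column = Vec (S × Bool) n

  Loc : Set
  Loc = Maybe S × Bool

  -- Horizontal colours: the transition made in this row together with the head crossings, or
  -- nothing once the machine has accepted. Vertical colours: the left margin, a blank region
  -- below an accepting row, or the state and the contents of a column.
  H V : Set
  H = Maybe (Transition × Vec Bool n)
  V = Maybe (Maybe (Fin states × Column))

  pattern margin   = nothing
  pattern fin      = just nothing
  pattern cell q x = just (just (q , x))

  -- `turn e e′` lies on the margin: it closes the row of `e` and opens that of `e′`, without a head
  -- crossing at either end, and it alone chooses transitions. `run` is a cell of a row that makes a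
  -- step, `halt` a cell of an accepting row that ends the computation, `rest` a cell below such a
  -- row.
  Tile : Set
  Tile = (Maybe Transition × Maybe Transition) ⊎ (Maybe Column ⊎ (Transition × Vec Loc n))

  pattern turn e e′ = inj₁ (e , e′)
  pattern rest      = inj₂ (inj₁ nothing)
  pattern halt x    = inj₂ (inj₁ (just x))
  pattern run ρ xs  = inj₂ (inj₂ (ρ , xs))

  edge : Maybe Transition → H
  edge = Maybe.map (_, Vec.replicate n false)

  module _ (ρ : Transition) (xs : Vec Loc n) (j : Fin n) where
    leftAt rightAt : Bool
    leftAt  = Of.Tr.leftCrossing ρ j (proj₂ (Vec.lookup (Of.actions ρ) j)) (Vec.lookup xs j)
    rightAt = Of.Tr.rightCrossing ρ j (proj₂ (Vec.lookup (Of.actions ρ) j)) (Vec.lookup xs j)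

    aboveAt belowAt : S × Bool
    aboveAt = Of.Tr.above ρ j (Vec.lookup xs j)
    belowAt = Of.Tr.below ρ j (Vec.lookup xs j)

  leftColour rightColour : Tile → H
  leftColour (turn e _) = edge e
  leftColour rest       = nothing
  leftColour (halt _)   = nothing
  leftColour (run ρ xs) = just (ρ , Vec.tabulate (leftAt ρ xs))
  rightColour (turn _ e) = edge e
  rightColour rest       = nothing
  rightColour (halt _)   = nothing
  rightColour (run ρ xs) = just (ρ , Vec.tabulate (rightAt ρ xs))

  topColour bottomColour : Tile → V
  topColour (turn _ _) = margin
  topColour rest       = fin
  topColour (halt x)   = cell accept x
  topColour (run ρ xs) = cell (Of.source ρ) (Vec.tabulate (aboveAt ρ xs))
  bottomColour (turn _ _) = margin
  bottomColour rest       = fin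
  bottomColour (halt _)   = fin
  bottomColour (run ρ xs) = cell (Of.sink ρ) (Vec.tabulate (belowAt ρ xs))

  finite-Transition : Finite Transition
  finite-Transition = finite-Σ (finite-Fin states) λ q → finite-Σ (finite-Vec (finite-Symbol marks) n) λ as → finite-Fin _

  finite-Column : Finite Column
  finite-Column = finite-Vec (finite-× (finite-Symbol marks) finite-Bool) n

  finite-H : Finite H
  finite-H = finite-Maybe (finite-× finite-Transition (finite-Vec finite-Bool n))

  finite-V : Finite V
  finite-V = finite-Maybe (finite-Maybe (finite-× (finite-Fin states) finite-Column))

  finite-Tile : Finite Tile
  finite-Tile = finite-⊎ (finite-× (finite-Maybe finite-Transition) (finite-Maybe finite-Transition))
    (finite-⊎ (finite-Maybe finite-Column)
      (finite-× finite-Transition (finite-Vec (finite-× (finite-Maybe (finite-Symbol marks)) finite-Bool) n)))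

  open Rows leftColour rightColour topColour bottomColour

  on-tape : Fin n → List Column → List (S × Bool)
  on-tape j = map (λ x → Vec.lookup x j)

  cells : Fin states → List Column → List V
  cells q = map (λ x → cell q x)

  fins : ℕ → List V
  fins k = replicate k fin

  TrackRow : Transition → Fin n → Bool → List (S × Bool) → Bool → List (S × Bool) → Set
  TrackRow ρ j = Of.Tr.Row ρ j

  -- The horizontal colour hands the transition on from cell to cell, so a whole row applies the
  -- same one and decomposes into independent rows, one for each tape.
  run-row : ∀ {ρ q} xs {fs h ws} → Row (just (ρ , fs)) (cells q xs) h ws →
            ∃₂ λ gs ys → h ≡ just (ρ , gs) × ws ≡ cells (Of.sink ρ) ys ×
            (∀ j → TrackRow ρ j (Vec.lookup fs j) (on-tape j xs) (Vec.lookup gs j) (on-tape j ys))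
  run-row []       [] = _ , [] , refl , refl , λ j → Rows.[]
  run-row {ρ} (x ∷ xs) (tile (run _ locs) refl refl refl π)
    with gs , ys , refl , refl , tracks ← run-row xs π =
    gs , _ ∷ ys , refl , refl , λ j → Rows.tile (Vec.lookup locs j)
      (sym (lookup∘tabulate (leftAt ρ locs) j)) (sym (lookup∘tabulate (aboveAt ρ locs) j))
      (sym (lookup∘tabulate (belowAt ρ locs) j))
      (subst (λ c → TrackRow ρ j c (on-tape j xs) (Vec.lookup gs j) (on-tape j ys)) (lookup∘tabulate (rightAt ρ locs) j) (tracks j))
  run-row (x ∷ xs) (tile (turn _ _) _ () _ _)
  run-row (x ∷ xs) (tile rest () _ _ _)
  run-row (x ∷ xs) (tile (halt _) () _ _ _)

  run-state : ∀ {ρ q x xs fs h ws} → Row (just (ρ , fs)) (cells q (x ∷ xs)) h ws → Of.source ρ ≡ q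
  run-state (tile (run _ _) refl refl _ _) = refl
  run-state (tile (turn _ _) _ () _ _)
  run-state (tile rest _ () _ _)
  run-state (tile (halt _) () _ _ _)

  row-run : ∀ ρ xs fs gs (ys : Fin n → List (S × Bool)) →
            (∀ j → TrackRow ρ j (Vec.lookup fs j) (on-tape j xs) (Vec.lookup gs j) (ys j)) →
            ∃ λ zs → (∀ j → on-tape j zs ≡ ys j) × Row (just (ρ , fs)) (cells (Of.source ρ) xs) (just (ρ , gs)) (cells (Of.sink ρ) zs)
  row-run ρ [] fs gs ys tracks = [] , (λ j → sym (proj₂ (row-[] (tracks j))))
    , subst (λ gs → Row _ _ (just (ρ , gs)) _) (vec-ext (λ j → proj₁ (row-[] (tracks j)))) []
    where
    row-[] : ∀ {j c c′ ws} → TrackRow ρ j c [] c′ ws → c ≡ c′ × ws ≡ []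
    row-[] Rows.[] = refl , refl
  row-run ρ (x ∷ xs) fs gs ys tracks =
    let zs , eqs , π = row-run ρ xs (Vec.tabulate (rightAt ρ locs)) gs (proj₁ ∘ others)
          (λ j → subst (λ c → TrackRow ρ j c (on-tape j xs) (Vec.lookup gs j) (proj₁ (others j)))
            (sym (trans (lookup∘tabulate (rightAt ρ locs) j) (cong (Of.Tr.rightCrossing ρ j (proj₂ (Vec.lookup (Of.actions ρ) j))) (locs≡ j))))
            (proj₂ (proj₂ (proj₂ (proj₂ (others j))))))
    in _ ∷ zs
      , (λ j → trans (cong₂ _∷_ (trans (lookup∘tabulate (belowAt ρ locs) j) (cong (Of.Tr.below ρ j) (locs≡ j))) (eqs j))
                 (sym (proj₁ (proj₂ (proj₂ (proj₂ (others j)))))))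
      , tile (run ρ locs)
          (cong (λ fs → just (ρ , fs)) (vec-ext λ j → trans (lookup∘tabulate (leftAt ρ locs) j)
            (trans (cong (Of.Tr.leftCrossing ρ j (proj₂ (Vec.lookup (Of.actions ρ) j))) (locs≡ j)) (proj₁ (proj₂ (others j))))))
          (cong (λ x → cell (Of.source ρ) x) (vec-ext λ j → trans (lookup∘tabulate (aboveAt ρ locs) j)
            (trans (cong (Of.Tr.above ρ j) (locs≡ j)) (proj₁ (proj₂ (proj₂ (others j)))))))
          refl π
    where
    here-loc : Fin n → Loc
    here-loc j = proj₁ (Of.Tr.row-uncons ρ j (tracks j))

    others : ∀ j → _
    others j = proj₂ (Of.Tr.row-uncons ρ j (tracks j))

    locs : Vec Loc n
    locs = Vec.tabulate here-loc

    locs≡ : ∀ j → Vec.lookup locs j ≡ here-loc j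
    locs≡ = lookup∘tabulate here-loc

module _ {T C W : Set} {l r : T → C} {t b : T → W} where
  open Rows l r t b
  open Helix l r t b

  -- The queue is used up at the front and refilled at the back. So `length vs` steps form a row
  -- below `vs`, whose bottom colours end up behind `us`; with `us` empty they are the top of the
  -- next row.
  path⇒row : ∀ {k} vs {us m h h′ ws} → length vs ≡ k → Path (k + m) h (vs ++ us) h′ ws →
             ∃₂ λ h₁ bs → Row h vs h₁ bs × Path m h₁ (us ++ bs) h′ ws
  path⇒row [] {us} {m} {h} {h′} {ws} refl π = _ , [] , [] , subst (λ us → Path m h us h′ ws) (sym (++-identityʳ us)) π
  path⇒row (v ∷ vs) {us} {m} {h} {h′} {ws} refl (step τ l≡ t≡ π)
    with h₁ , bs , ρ , π′ ← path⇒row vs {us ∷ʳ b τ} refl (subst (λ q → Path _ _ q h′ ws) (++-assoc vs us _) π)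
    = h₁ , b τ ∷ bs , tile τ l≡ t≡ refl ρ , subst (λ q → Path m h₁ q h′ ws) (++-assoc us [ b τ ] bs) π′

  row⇒path : ∀ {k vs us m h h₁ bs h′ ws} → length vs ≡ k → Row h vs h₁ bs → Path m h₁ (us ++ bs) h′ ws →
             Path (k + m) h (vs ++ us) h′ ws
  row⇒path {us = us} refl [] π = subst (λ us → Path _ _ us _ _) (++-identityʳ us) π
  row⇒path {vs = _ ∷ vs} {us} refl (tile τ {ws = bs} l≡ t≡ refl ρ) π = step τ l≡ t≡
    (subst (λ q → Path _ _ q _ _) (sym (++-assoc vs us _))
      (row⇒path {us = us ∷ʳ b τ} refl ρ (subst (λ q → Path _ _ q _ _) (sym (++-assoc us [ b τ ] bs)) π)))

  row-length : ∀ {c vs c′ ws} → Row c vs c′ ws → length ws ≡ length vs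
  row-length []               = refl
  row-length (tile _ _ _ _ ρ) = cong suc (row-length ρ)

-- Computations as stacks of rows

module Simulation (M : TM) where
  open TM M
  open Tableau M
  open Rows leftColour rightColour topColour bottomColour
  open Helix leftColour rightColour topColour bottomColour
  open Config

  -- k cells are left on either side of each head.
  Shows : Config M → List Column → ℕ → Set
  Shows c xs k = ∀ j → let u = Vec.lookup (tapes c) j in ∃₂ λ ls rs →
    on-tape j xs ≡ track ls (scanned u) rs × Padded (before u) ls × Padded (after u) rs × k ≤ length ls × k ≤ length rs

  after-transition : Transition → Vec (Tape marks) n → Config M
  after-transition ρ us = config (Of.sink ρ) (Vec.zipWith (act M) (Of.actions ρ) us)

  no-crossing : Vec Bool n
  no-crossing = Vec.replicate n false

  shows-after : ∀ {ρ q us xs ys} → Shows (config q us) xs 0 →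
                (∀ j → TrackRow ρ j false (on-tape j xs) false (on-tape j ys)) →
                Of.reads ρ ≡ Vec.map scanned us × Shows (after-transition ρ us) ys 0
  shows-after {ρ} {us = us} {xs} {ys} shows tracks = vec-ext (λ j → proj₁ (one j)) , λ j → proj₂ (one j)
    where
    one : ∀ j → Vec.lookup (Of.reads ρ) j ≡ Vec.lookup (Vec.map scanned us) j ×
                (let u = Vec.lookup (tapes (after-transition ρ us)) j in ∃₂ λ ls rs →
                 on-tape j ys ≡ track ls (scanned u) rs × Padded (before u) ls × Padded (after u) rs × 0 ≤ length ls × 0 ≤ length rs)
    one j with ls , rs , eq , pl , pr , _ ← shows j
          with x≡a , ls′ , x′ , rs′ , moved , eq′ ← row-track ls _ rs (subst (λ vs → TrackRow ρ j false vs false (on-tape j ys)) eq (tracks j))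
          with refl , pl′ , pr′ ← padded-move (Vec.lookup us j) moved pl pr
      rewrite lookup-zipWith (act M) j (Of.actions ρ) us | lookup-map j scanned us
      = sym x≡a , ls′ , rs′ , eq′ , pl′ , pr′ , z≤n , z≤n

  moved-exists : ∀ {k} (a s : S) d ls rs → suc k ≤ length ls → suc k ≤ length rs →
                 ∃ λ ls′ → ∃₂ λ x rs′ → Track.Moved a s d d ls rs ls′ x rs′ × k ≤ length ls′ × k ≤ length rs′
  moved-exists a s left  (x ∷ ls) rs (s≤s hl) hr = _ , _ , _ , Track.moved-left , hl , ≤-trans (n≤1+n _) (≤-trans hr (n≤1+n _))
  moved-exists a s stay  ls rs hl hr = _ , _ , _ , Track.moved-stay , ≤-trans (n≤1+n _) hl , ≤-trans (n≤1+n _) hr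
  moved-exists a s right ls (x ∷ rs) hl (s≤s hr) = _ , _ , _ , Track.moved-right , ≤-trans (n≤1+n _) (≤-trans hl (n≤1+n _)) , hr

  shows-step : ∀ ρ {q us xs k} → Shows (config q us) xs (suc k) → Of.reads ρ ≡ Vec.map scanned us →
               ∃ λ ys → Row (just (ρ , no-crossing)) (cells (Of.source ρ) xs) (just (ρ , no-crossing)) (cells (Of.sink ρ) ys) ×
                        Shows (after-transition ρ us) ys k
  shows-step ρ {q} {us} {xs} {k} shows reads≡ =
    let ys , eqs , π = row-run ρ xs no-crossing no-crossing (λ j → proj₁ (one j)) (λ j →
          subst (λ f → TrackRow ρ j f (on-tape j xs) f (proj₁ (one j))) (sym (lookup-replicate j false)) (proj₁ (proj₂ (one j))))
    in ys , π , λ j → let ls , rs , eq , sides = proj₂ (proj₂ (one j)) in ls , rs , trans (eqs j) eq , sides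
    where
    one : ∀ j → ∃ λ ws → TrackRow ρ j false (on-tape j xs) false ws ×
                (let u = Vec.lookup (tapes (after-transition ρ us)) j in ∃₂ λ ls rs →
                 ws ≡ track ls (scanned u) rs × Padded (before u) ls × Padded (after u) rs × k ≤ length ls × k ≤ length rs)
    one j with ls , rs , eq , pl , pr , hl , hr ← shows j
          with ls′ , x′ , rs′ , moved , hl′ , hr′ ← moved-exists (Vec.lookup (Of.reads ρ) j) (proj₁ (Vec.lookup (Of.actions ρ) j))
                 (proj₂ (Vec.lookup (Of.actions ρ) j)) ls rs hl hr
          with refl , pl′ , pr′ ← padded-move (Vec.lookup us j) moved pl pr
      rewrite lookup-zipWith (act M) j (Of.actions ρ) us
      = _ , subst (λ vs → TrackRow ρ j false vs false _)
              (trans (cong (λ x → track ls x rs) (trans (cong (λ v → Vec.lookup v j) reads≡) (lookup-map j scanned us))) (sym eq))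
              (track-row moved)
      , ls′ , rs′ , refl , pl′ , pr′ , hl′ , hr′

  successor : ∀ ρ {us} → Of.reads ρ ≡ Vec.map scanned us → after-transition ρ us ∈ successors M (config (Of.source ρ) us)
  successor (q , as , i) {us} refl = ∈-map⁺ (λ (q′ , actions) → config q′ (Vec.zipWith (act M) actions us)) (∈-lookup i)

  transition-of : ∀ {q us c′} → c′ ∈ successors M (config q us) →
                  ∃ λ ρ → Of.source ρ ≡ q × Of.reads ρ ≡ Vec.map scanned us × c′ ≡ after-transition ρ us
  transition-of {q} {us} c′∈ with _ , a∈ , refl ← ∈-map⁻ _ c′∈ =
    (q , Vec.map scanned us , Any.index a∈) , refl , refl
    , cong (λ (q′ , actions) → config q′ (Vec.zipWith (act M) actions us)) (lookup-index a∈)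

  private
    halt-row : ∀ q x xs {h ws} → Row nothing (cells q (x ∷ xs)) h ws → q ≡ accept
    halt-row q x xs (tile (halt _) _ refl _ _) = refl
    halt-row q x xs (tile (turn _ _) _ () _ _)
    halt-row q x xs (tile rest _ () _ _)
    halt-row q x xs (tile (run _ _) () _ _ _)

    row-halt : ∀ xs → Row nothing (cells accept xs) nothing (fins (length xs))
    row-halt []       = []
    row-halt (x ∷ xs) = tile (halt x) refl refl refl (row-halt xs)

    row-fins : ∀ k → Row nothing (fins k) nothing (fins k)
    row-fins zero    = []
    row-fins (suc k) = tile rest refl refl refl (row-fins k)

    -- The edge colour of `e` is absorbed by the first margin tile; without any row left it must
    -- already be the final colour `nothing`.
    path-fins : ∀ R e w → (R ≡ 0 → e ≡ nothing) → Path (R * suc w) (edge e) (margin ∷ fins w) nothing (margin ∷ fins w)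
    path-fins zero    e w h with refl ← h refl = done
    path-fins (suc R) e w _ = subst (λ vs → Path (suc R * suc w) (edge e) vs nothing (margin ∷ fins w)) (++-identityʳ _)
      (row⇒path {us = []} (cong suc (length-replicate w)) (tile (turn e nothing) refl refl refl (row-fins w))
        (path-fins R nothing w (λ _ → refl)))

  -- `e` is the transition of the row above, which the first margin tile closes. There have to be
  -- more rows than steps, because the accepting configuration takes a row of `halt` tiles.
  simulate : ∀ {t c c′} R xs e w → length xs ≡ w → Run M c t c′ → state c′ ≡ accept → t < R → Shows c xs t →
             Path (R * suc w) (edge e) (margin ∷ cells (state c) xs) nothing (margin ∷ fins w)
  simulate (suc R) xs e w refl done refl _ shows =
    subst (λ vs → Path (suc R * suc w) (edge e) vs nothing (margin ∷ fins w)) (++-identityʳ _)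
      (row⇒path {us = []} (cong suc (length-map _ xs)) (tile (turn e nothing) refl refl refl (row-halt xs))
        (path-fins R nothing w (λ _ → refl)))
  simulate {c = config q us} (suc R) xs e w refl (step c″∈ run′) acc (s≤s t<R) shows
    with ρ , refl , reads≡ , refl ← transition-of c″∈
    with ys , row , shows′ ← shows-step ρ {q} {us} {xs} shows reads≡
    = subst (λ vs → Path (suc R * suc w) (edge e) vs nothing (margin ∷ fins w)) (++-identityʳ _)
      (row⇒path {us = []} (cong suc (length-map _ xs)) (tile (turn e (just ρ)) refl refl refl row)
        (simulate R ys (just ρ) w (trans (sym (length-map _ ys)) (trans (row-length row) (length-map _ xs))) run′ acc t<R shows′))

  private
    -- The right end of a row is checked one cell later, by the margin tile of the next row or by
    -- the final colour.
    uncrossed : ∀ R ρ gs q y ys w → Path (R * suc w) (just (ρ , gs)) (margin ∷ cells q (y ∷ ys)) nothing (margin ∷ fins w) →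
                gs ≡ no-crossing
    uncrossed zero    ρ gs q y ys zero ()
    uncrossed zero    ρ gs q y ys (suc w) ()
    uncrossed (suc R) ρ gs q y ys w (step (turn (just _) _) refl _ _) = refl
    uncrossed (suc R) ρ gs q y ys w (step rest _ () _)
    uncrossed (suc R) ρ gs q y ys w (step (halt _) _ () _)
    uncrossed (suc R) ρ gs q y ys w (step (run _ _) _ () _)

  -- The tiles themselves keep the heads inside, so no spare cells are asked for. There is at least
  -- one column since only the cells record the state.
  extract : ∀ R {c h} xs w → length xs ≡ suc w → Shows c xs 0 →
            Path (R * suc (suc w)) h (margin ∷ cells (state c) xs) nothing (margin ∷ fins (suc w)) →
            ∃₂ λ t c′ → t < R × Run M c t c′ × state c′ ≡ accept
  extract zero (_ ∷ _) w len shows ()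
  extract (suc R) {config q us} {h} xs@(x ∷ xs′) w len shows π
    with path⇒row (margin ∷ cells q xs) {us = []} (cong suc (trans (length-map _ xs) len))
           (subst (λ vs → Path (suc R * suc (suc w)) h vs nothing (margin ∷ fins (suc w))) (sym (++-identityʳ _)) π)
  ... | _ , _ , tile (turn _ nothing) refl _ refl row , _ = 0 , _ , s≤s z≤n , done , halt-row q x xs′ row
  ... | _ , _ , tile rest _ () _ _ , _
  ... | _ , _ , tile (halt _) _ () _ _ , _
  ... | _ , _ , tile (run _ _) _ () _ _ , _
  ... | _ , _ , tile (turn _ (just ρ)) refl _ refl row , π′
    with refl ← run-state row
    with gs , ys , refl , refl , tracks ← run-row xs row
    with ys in ys≡ | trans (trans (sym (length-map _ ys)) (row-length row)) (trans (length-map _ xs) len)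
  ...   | y ∷ ys′ | len′
    with refl ← uncrossed R ρ gs (Of.sink ρ) y ys′ (suc w) π′
    with reads≡ , shows′ ← shows-after {ρ} {q} {us} {xs} {y ∷ ys′} shows (λ j →
           subst (λ f → TrackRow ρ j f (on-tape j xs) f (on-tape j (y ∷ ys′))) (lookup-replicate j false) (tracks j))
    with t , c′ , t<R , run′ , acc ← extract R (y ∷ ys′) w len′ shows′ π′
    = suc t , c′ , s≤s t<R , step (successor ρ reads≡) run′ , acc

module Acceptance (M : TM) where
  open TM M
  open Tableau M
  open Simulation M
  open Helix leftColour rightColour topColour bottomColour

  column : S → Bool → Column
  column x h = (x , h) ∷ Vec.replicate workTapes (blank , h)

  firstSymbol : List Bool → S
  firstSymbol []      = blank
  firstSymbol (b ∷ _) = bit b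

  inputColumns : List Bool → List Column
  inputColumns = map (λ b → column (bit b) false)

  initialColumns : ℕ → List Bool → List Column
  initialColumns k x = replicate k (column blank false) ++ column (firstSymbol x) true ∷
                       inputColumns (drop 1 x) ++ replicate k (column blank false)

  private
    reverse-replicate : ∀ {A : Set} k (x : A) → reverse (replicate k x) ≡ replicate k x
    reverse-replicate zero    x = refl
    reverse-replicate (suc k) x = trans (unfold-reverse x (replicate k x))
      (trans (cong (_∷ʳ x) (reverse-replicate k x)) (snoc k))
      where
      snoc : ∀ k → replicate k x ∷ʳ x ≡ replicate (suc k) x
      snoc zero    = refl
      snoc (suc k) = cong (x ∷_) (snoc k)

    on-tape-initial : ∀ k x j (y : S) zs → Vec.lookup (column blank false) j ≡ (blank , false) →
      Vec.lookup (column (firstSymbol x) true) j ≡ (y , true) → on-tape j (inputColumns (drop 1 x)) ≡ map off zs →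
      on-tape j (initialColumns k x) ≡ track (replicate k blank) y (zs ++ replicate k blank)
    on-tape-initial k x j y zs hb hx hz = trans (map-++ _ (replicate k (column blank false)) _)
      (cong₂ _++_ (trans blanks (cong (map off) (sym (reverse-replicate k blank))))
        (cong₂ _∷_ hx (trans (map-++ _ (inputColumns (drop 1 x)) _)
          (trans (cong₂ _++_ hz blanks) (sym (map-++ off zs (replicate k blank)))))))
      where
      blanks : on-tape j (replicate k (column blank false)) ≡ map off (replicate k blank)
      blanks = trans (map-replicate (λ x → Vec.lookup x j) k _) (trans (cong (replicate k) hb) (sym (map-replicate off k blank)))

    shown : ∀ k {xs y} zs (u : Tape marks) j → on-tape j xs ≡ track (replicate k blank) y (zs ++ replicate k blank) →
            scanned u ≡ y → before u ≡ [] → Padded (after u) (zs ++ replicate k blank) →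
            ∃₂ λ ls rs → on-tape j xs ≡ track ls (scanned u) rs × Padded (before u) ls × Padded (after u) rs × k ≤ length ls × k ≤ length rs
    shown k zs (tape _ _ _) j eq refl refl pad = replicate k blank , zs ++ replicate k blank , eq , (k , refl) , pad
      , ≤-reflexive (sym (length-replicate k))
      , ≤-trans (≤-trans (≤-reflexive (sym (length-replicate k))) (m≤n+m _ (length zs))) (≤-reflexive (sym (length-++ zs)))

  shows-initial : ∀ k x → Shows (initial M x) (initialColumns k x) k
  shows-initial k x zero = shown k {initialColumns k x} (map bit (drop 1 x)) (inputTape x) zero
    (on-tape-initial k x zero (firstSymbol x) (map bit (drop 1 x)) refl refl
      (trans (sym (map-∘ (drop 1 x))) (map-∘ (drop 1 x))))
    (first x) (left-empty x) (k , padding x)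
    where
    first : ∀ x → scanned (inputTape x) ≡ firstSymbol x
    first []      = refl
    first (b ∷ x) = refl

    left-empty : ∀ x → before (inputTape {marks} x) ≡ []
    left-empty []      = refl
    left-empty (b ∷ x) = refl

    padding : ∀ x → map bit (drop 1 x) ++ replicate k blank ≡ after (inputTape x) ++ replicate k blank
    padding []      = refl
    padding (b ∷ x) = refl
  shows-initial k x (suc j) = shown k {initialColumns k x} (replicate l blank) (Vec.lookup (Vec.replicate workTapes blankTape) j) (suc j)
    (on-tape-initial k x (suc j) blank (replicate l blank) (lookup-replicate j _) (lookup-replicate j _) others)
    (cong scanned (lookup-replicate j blankTape)) (cong before (lookup-replicate j blankTape))
    (l + k , trans (sym (replicate-+ l)) (cong (_++ replicate (l + k) blank) (sym (cong after (lookup-replicate j blankTape)))))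
    where
    l : ℕ
    l = length (drop 1 x)

    replicate-+ : ∀ l → replicate (l + k) blank ≡ replicate l blank ++ replicate k blank
    replicate-+ zero    = refl
    replicate-+ (suc l) = cong (blank ∷_) (replicate-+ l)

    others : on-tape (suc j) (inputColumns (drop 1 x)) ≡ map off (replicate l blank)
    others = all-blank (drop 1 x)
      where
      all-blank : ∀ bs → on-tape (suc j) (inputColumns bs) ≡ map off (replicate (length bs) blank)
      all-blank []       = refl
      all-blank (b ∷ bs) = cong₂ _∷_ (lookup-replicate j _) (all-blank bs)

  -- The last row starts in an accepting or a finished state, so there is one more row than steps.
  acceptance : ∀ x Q {w} → length (initialColumns (suc Q) x) ≡ suc w →
    AcceptsWithin M x Q ⇔ Path (suc Q * suc (suc w)) nothing (margin ∷ cells start (initialColumns (suc Q) x))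
                               nothing (margin ∷ fins (suc w))
  acceptance x Q len = mk⇔
    (λ (t , c , t≤ , run′ , acc) → simulate (suc Q) _ nothing _ len run′ acc (s≤s t≤)
      (λ j → let ls , rs , eq , pl , pr , hl , hr = shows-initial (suc Q) x j
             in ls , rs , eq , pl , pr , ≤-trans (m≤n⇒m≤1+n t≤) hl , ≤-trans (m≤n⇒m≤1+n t≤) hr))
    (λ π → let t , c , t< , run′ , acc = extract (suc Q) {initial M x} (initialColumns (suc Q) x) _ len
                 (λ j → let ls , rs , eq , pl , pr , _ = shows-initial (suc Q) x j in ls , rs , eq , pl , pr , z≤n , z≤n) π
           in t , c , ≤-pred t< , run′ , acc)

-- The reduction as a program

fromBit : Bool → ℕ
fromBit false = 0
fromBit true  = 1

val : List Bool → ℕ → ℕ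
val []       x = x
val (b ∷ bs) x = fromBit b + dbl (val bs x)

val-++ : ∀ xs ys x → val (xs ++ ys) x ≡ val xs (val ys x)
val-++ []       ys x = refl
val-++ (b ∷ xs) ys x = cong (λ y → fromBit b + dbl y) (val-++ xs ys x)

val-tail : ∀ bs x → val bs x ≡ val bs 0 + 2 ^ length bs * x
val-tail []       x = sym (+-identityʳ x)
val-tail (b ∷ bs) x = trans (cong (λ y → fromBit b + dbl y) (val-tail bs x))
  (lemma (fromBit b) (val bs 0) (2 ^ length bs) x)
  where
  lemma : ∀ b v p x → b + (v + p * x + (v + p * x)) ≡ b + (v + v) + 2 * p * x
  lemma = solve-∀

val-zeros : ∀ k x → val (replicate k false) x ≡ 2 ^ k * x
val-zeros zero    x = sym (+-identityʳ x)
val-zeros (suc k) x = trans (cong dbl (val-zeros k x)) (lemma (2 ^ k) x)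
  where
  lemma : ∀ p x → p * x + p * x ≡ 2 * p * x
  lemma = solve-∀

val-increment : ∀ bs → val (increment bs) 0 ≡ suc (val bs 0)
val-increment []           = refl
val-increment (false ∷ bs) = refl
val-increment (true  ∷ bs) = trans (cong dbl (val-increment bs)) (cong suc (+-suc (val bs 0) (val bs 0)))

val-binary : ∀ n → val (binary n) 0 ≡ n
val-binary zero    = refl
val-binary (suc n) = trans (val-increment (binary n)) (cong suc (val-binary n))

mutual
  binary-even : ∀ n → binary (dbl (suc n)) ≡ false ∷ binary (suc n)
  binary-even n = trans (cong (increment ∘ binary) (+-suc n n)) (cong increment (binary-odd n))

  binary-odd : ∀ n → binary (suc (dbl n)) ≡ true ∷ binary n
  binary-odd zero    = refl
  binary-odd (suc n) = cong increment (binary-even n)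

binary-val : ∀ bs {x} → 0 < x → binary (val bs x) ≡ bs ++ binary x
binary-val bs {suc x} _ = proj₂ (positive bs)
  where
  positive : ∀ bs → (∃ λ n → val bs (suc x) ≡ suc n) × binary (val bs (suc x)) ≡ bs ++ binary (suc x)
  positive []           = (x , refl) , refl
  positive (false ∷ bs) with (n , eq) , h ← positive bs =
    (n + suc n , cong dbl eq) , trans (cong (binary ∘ dbl) eq) (trans (binary-even n) (cong (false ∷_) (trans (cong binary (sym eq)) h)))
  positive (true ∷ bs)  with (n , eq) , h ← positive bs =
    (dbl (suc n) , cong (λ m → 1 + dbl m) eq) , trans (cong (λ m → binary (1 + dbl m)) eq) (trans (binary-odd (suc n)) (cong (true ∷_) (trans (cong binary (sym eq)) h)))

binary-length : ∀ n → length (binary n) ≤ n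
binary-length zero    = z≤n
binary-length (suc n) = ≤-trans (increment-length (binary n)) (s≤s (binary-length n))
  where
  increment-length : ∀ bs → length (increment bs) ≤ suc (length bs)
  increment-length []           = ≤-refl
  increment-length (false ∷ bs) = n≤1+n _
  increment-length (true ∷ bs)  = s≤s (increment-length bs)

-- `delimit` without its end mark is a homomorphism, so a number can be written in pieces.
open-delimit : List Bool → List Bool
open-delimit []       = []
open-delimit (b ∷ bs) = true ∷ b ∷ open-delimit bs

delimit-++ : ∀ xs ys → delimit (xs ++ ys) ≡ open-delimit xs ++ delimit ys
delimit-++ []       ys = refl
delimit-++ (b ∷ xs) ys = cong (λ r → true ∷ b ∷ r) (delimit-++ xs ys)

open-delimit-++ : ∀ xs ys → open-delimit (xs ++ ys) ≡ open-delimit xs ++ open-delimit ys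
open-delimit-++ []       ys = refl
open-delimit-++ (b ∷ xs) ys = cong (λ r → true ∷ b ∷ r) (open-delimit-++ xs ys)

delimit-binary-val : ∀ bs {x} → 0 < x → delimit (binary (val bs x)) ≡ open-delimit bs ++ delimit (binary x)
delimit-binary-val bs h = trans (cong delimit (binary-val bs h)) (delimit-++ bs _)

times : ℕ → List Bool → List Bool
times n u = concat (replicate n u)

times-+ : ∀ m n u → times (m + n) u ≡ times m u ++ times n u
times-+ zero    n u = refl
times-+ (suc m) n u = trans (cong (u ++_) (times-+ m n u)) (sym (++-assoc u (times m u) (times n u)))

times-open-delimit : ∀ n u → times n (open-delimit u) ≡ open-delimit (times n u)
times-open-delimit zero    u = refl
times-open-delimit (suc n) u = trans (cong (open-delimit u ++_) (times-open-delimit n u)) (sym (open-delimit-++ u (times n u)))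

module Words (width : ℕ) where
  open Radix (2 ^ width)

  -- Digits of equal length make concatenation act as positional notation. They never exceed
  -- `width`, so the crude `binary-length` shows that they fit.
  pad : ℕ → List Bool
  pad n = binary n ++ replicate (width ∸ length (binary n)) false

  val-pad : ∀ {n} x → n ≤ width → val (pad n) x ≡ n + 2 ^ width * x
  val-pad {n} x n≤w = begin
    val (pad n) x                                     ≡⟨ val-++ (binary n) _ x ⟩
    val (binary n) (val (replicate gap false) x)      ≡⟨ val-tail (binary n) _ ⟩
    val (binary n) 0 + 2 ^ l * val (replicate gap false) x  ≡⟨ cong₂ (λ a b → a + 2 ^ l * b) (val-binary n) (val-zeros gap x) ⟩
    n + 2 ^ l * (2 ^ gap * x)                         ≡⟨ cong (n +_) (*-assoc (2 ^ l) (2 ^ gap) x) ⟨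
    n + 2 ^ l * 2 ^ gap * x                           ≡⟨ cong (λ p → n + p * x) (^-distribˡ-+-* 2 l gap) ⟨
    n + 2 ^ (l + gap) * x                             ≡⟨ cong (λ e → n + 2 ^ e * x) (m+[n∸m]≡n (≤-trans (binary-length n) n≤w)) ⟩
    n + 2 ^ width * x                                 ∎
    where
    open ≡-Reasoning
    l gap : ℕ
    l   = length (binary n)
    gap = width ∸ l

  word : ℕ × ℕ × ℕ → List Bool
  word (a , b , c) = pad a ++ pad b ++ pad c

  Narrow : ℕ × ℕ × ℕ → Set
  Narrow (a , b , c) = a ≤ width × b ≤ width × c ≤ width

  val-word : ∀ {a b c} x → Narrow (a , b , c) → val (word (a , b , c)) x ≡ blk a b c x
  val-word {a} {b} {c} x (a≤ , b≤ , c≤) = trans (val-++ (pad a) _ x) (trans (val-pad _ a≤)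
    (cong (λ y → a + 2 ^ width * y) (trans (val-++ (pad b) _ x) (trans (val-pad _ b≤)
      (cong (λ y → b + 2 ^ width * y) (val-pad x c≤))))))

  val-words : ∀ {A : Set} (f : A → ℕ × ℕ × ℕ) → (∀ a → Narrow (f a)) → ∀ as x →
              val (concatMap (word ∘ f) as) x ≡ blocks (map f as) x
  val-words f narrow []       x = refl
  val-words f narrow (a ∷ as) x = trans (val-++ (word (f a)) _ x)
    (trans (val-word _ (narrow a)) (cong (blk _ _ _) (val-words f narrow as x)))

  zero-word : List Bool
  zero-word = word (0 , 0 , 0)

  val-zero-words : ∀ n x → val (times n zero-word) x ≡ zeros n x
  val-zero-words zero    x = refl
  val-zero-words (suc n) x = trans (val-++ zero-word _ x)
    (trans (val-word _ (z≤n , z≤n , z≤n)) (cong (blk 0 0 0) (val-zero-words n x)))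

-- Codes start at 1, so that every item adds a positive amount to its colour digits.
rank : ∀ {A : Set} → Finite A → A → ℕ
rank F a = suc (toℕ (code F a))

rank-injective : ∀ {A : Set} (F : Finite A) → Injective _≡_ _≡_ (rank F)
rank-injective F {x} {y} eq = index-injective (setoid _) (complete F x) (complete F y) (toℕ-injective (suc-injective eq))

rank-≤ : ∀ {A : Set} (F : Finite A) a → rank F a ≤ size F
rank-≤ F a = toℕ<n (code F a)

n<2^n : ∀ n → n < 2 ^ n
n<2^n zero    = s≤s z≤n
n<2^n (suc n) = +-mono-≤-< (≤-trans (s≤s z≤n) (n<2^n n)) (<-≤-trans (n<2^n n) (m≤m+n _ 0))

-- Codes, tile list and digit width for a machine

module Encoding (M : TM) where
  open TM M
  open Tableau M

  -- Abstract, because the enumerations behind these numbers must not be unfolded.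
  abstract
    hcode : H → ℕ
    hcode = rank finite-H

    vcode : V → ℕ
    vcode = rank finite-V

    K : ℕ
    K = suc (size finite-H + size finite-V)

    hcode-injective : Injective _≡_ _≡_ hcode
    hcode-injective = rank-injective finite-H

    vcode-injective : Injective _≡_ _≡_ vcode
    vcode-injective = rank-injective finite-V

    0<hcode : ∀ h → 0 < hcode h
    0<hcode h = s≤s z≤n

    0<vcode : ∀ v → 0 < vcode v
    0<vcode v = s≤s z≤n

    hcode<K : ∀ h → hcode h < K
    hcode<K h = s≤s (≤-trans (rank-≤ finite-H h) (m≤m+n (size finite-H) (size finite-V)))

    vcode<K : ∀ v → vcode v < K
    vcode<K v = s≤s (≤-trans (rank-≤ finite-V v) (m≤n+m (size finite-V) (size finite-H)))

    -- Every tile occurs 2K times, so that each digit sum over all items is at least twice the target digit.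
    copies : List Tile
    copies = concat (replicate (K + K) (elements finite-Tile))

    many-copies : K + K ≤ length copies
    many-copies = length-copies (K + K)
      where
      length-copies : ∀ k → k ≤ length (concat (replicate k (elements finite-Tile)))
      length-copies zero    = z≤n
      length-copies (suc k) = ≤-trans (+-mono-≤ (∈-length (complete finite-Tile rest)) (length-copies k))
        (≤-reflexive (sym (length-++ (elements finite-Tile))))

    all-copies : ∀ τ → τ ∈ copies
    all-copies τ = ∈-++⁺ˡ (complete finite-Tile τ)

  0<K : 0 < K
  0<K = ≤-<-trans z≤n (hcode<K nothing)

  private
    C X : ℕ
    C = length copies * K
    X = C + C

  abstract
    -- A digit of `supply` sums at most two colour totals, each at most `C`; a digit of `demand` is
    -- at most `K`. In `threefold` both occur three times.
    width : ℕ
    width = (X + K) + ((X + K) + (X + K))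

    width≥ : (X + K) + ((X + K) + (X + K)) ≤ width
    width≥ = ≤-refl

  B : ℕ
  B = 2 ^ width

  key : Tile → ℕ
  key τ = Radix.loc B 0 1 (hcode (leftColour τ)) (vcode (topColour τ)) (K ∸ hcode (rightColour τ)) (K ∸ vcode (bottomColour τ))

  private
    module Sort = Data.List.Sort (On.decTotalOrder (Flip.decTotalOrder ≤-decTotalOrder) key)

  -- The list depends on the machine only, so it is sorted once and for all, not during the
  -- reduction.
  tiles : List Tile
  tiles = Sort.sort copies

  tiles-length : length tiles ≡ length copies
  tiles-length = ↭-length (Sort.sort-↭ copies)

  private
    X+K≤ : X + K ≤ width
    X+K≤ = ≤-trans (m≤m+n (X + K) _) width≥

  large : K + length tiles * K < B
  large = subst (λ l → K + l * K < B) (sym tiles-length) (≤-<-trans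
    (≤-trans (≤-reflexive (+-comm K C)) (≤-trans (+-monoˡ-≤ K (m≤m+n C C)) X+K≤)) (n<2^n width))

  many : K + K ≤ length tiles
  many = ≤-trans many-copies (≤-reflexive (sym tiles-length))

  all-tiles : ∀ τ → τ ∈ tiles
  all-tiles τ = ∈-resp-↭ (↭-sym (Sort.sort-↭ copies)) (all-copies τ)

  tileSet : TileSet
  tileSet = record
    { l = leftColour ; r = rightColour ; t = topColour ; b = bottomColour
    ; hcode-injective = hcode-injective ; vcode-injective = vcode-injective
    ; hcode<K = hcode<K ; vcode<K = vcode<K ; 0<hcode = 0<hcode ; 0<vcode = 0<vcode
    ; tiles = tiles ; many = many ; large = large
    }

  open Reductions tileSet nothing nothing public
  open Layouts tileSet nothing nothing public
  open Tilings tileSet public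
  open Words width public

  tiles-descending : AllPairs Descending tiles
  tiles-descending = Linked.Linked⇒AllPairs (λ {i} {j} {k} h h′ → ≤-trans h′ h) (Sort.sort-↗ copies)

  private
    Below : ℕ → Block → Set
    Below m (a , b , c) = a ≤ m × b ≤ m × c ≤ m

    below-mono : ∀ {m n} x → m ≤ n → Below m x → Below n x
    below-mono x m≤n (a , b , c) = ≤-trans a m≤n , ≤-trans b m≤n , ≤-trans c m≤n

    below-⊞ : ∀ {m n} x y → Below m x → Below n y → Below (m + n) (x ⊞ y)
    below-⊞ x y (a , b , c) (a′ , b′ , c′) = +-mono-≤ a a′ , +-mono-≤ b b′ , +-mono-≤ c c′

    sum≤ : ∀ (f : Tile → ℕ) → (∀ τ → f τ ≤ K) → ∀ ts → sum (map f ts) ≤ length ts * K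
    sum≤ f h []       = z≤n
    sum≤ f h (τ ∷ ts) = +-mono-≤ (h τ) (sum≤ f h ts)

    total≤ : ∀ (f : Tile → ℕ) → (∀ τ → f τ ≤ K) → sum (map f tiles) ≤ C
    total≤ f h = ≤-trans (sum≤ f h tiles) (≤-reflexive (cong (_* K) tiles-length))

    l≤ : sum (map (hcode ∘ leftColour) tiles) ≤ C
    l≤ = total≤ (hcode ∘ leftColour) (λ τ → <⇒≤ (hcode<K (leftColour τ)))

    t≤ : sum (map (vcode ∘ topColour) tiles) ≤ C
    t≤ = total≤ (vcode ∘ topColour) (λ τ → <⇒≤ (vcode<K (topColour τ)))

    r≤ : sum (map (hout ∘ rightColour) tiles) ≤ C
    r≤ = total≤ (hout ∘ rightColour) (λ τ → m∸n≤m K (hcode (rightColour τ)))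

    b≤ : sum (map (vout ∘ bottomColour) tiles) ≤ C
    b≤ = total≤ (vout ∘ bottomColour) (λ τ → m∸n≤m K (vcode (bottomColour τ)))

    up : ∀ {x} → x ≤ C → x ≤ X
    up h = ≤-trans h (m≤m+n C C)

    count≤ : length tiles ≤ X
    count≤ = up (≤-trans (≤-reflexive tiles-length) (≤-trans (≤-reflexive (sym (*-identityʳ (length copies)))) (*-monoʳ-≤ (length copies) 0<K)))

    supply-below : ∀ τ → Below X (supply τ)
    supply-below (corner _) = count≤ , up l≤ , up t≤
    supply-below (top _)    = count≤ , +-mono-≤ r≤ l≤ , up t≤
    supply-below inner      = count≤ , +-mono-≤ r≤ l≤ , +-mono-≤ b≤ t≤
    supply-below (end _)    = z≤n , up r≤ , up b≤
    supply-below (bottom _) = z≤n , z≤n , up b≤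

    demand-below : ∀ τ → Below K (demand τ)
    demand-below (corner v) = 0<K , <⇒≤ (hcode<K nothing) , <⇒≤ (vcode<K v)
    demand-below (top v)    = 0<K , ≤-refl , <⇒≤ (vcode<K v)
    demand-below inner      = 0<K , ≤-refl , ≤-refl
    demand-below (end v)    = z≤n , m∸n≤m K (hcode nothing) , m∸n≤m K (vcode v)
    demand-below (bottom v) = z≤n , z≤n , m∸n≤m K (vcode v)

    both-below : ∀ τ → Below (X + K) (both τ)
    both-below τ = below-⊞ (supply τ) (demand τ) (supply-below τ) (demand-below τ)

  K≤width : K ≤ width
  K≤width = ≤-trans (m≤n+m K X) X+K≤

  supply-narrow : ∀ τ → Narrow (supply τ)
  supply-narrow τ = below-mono (supply τ) (≤-trans (m≤m+n X K) X+K≤) (supply-below τ)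

  twice-narrow : ∀ τ → Narrow (twice τ)
  twice-narrow τ = below-mono (twice τ) (≤-trans (+-mono-≤ (m≤n+m K X) (≤-trans (m≤n+m K X) (m≤m+n (X + K) (X + K)))) width≥)
    (below-⊞ (demand τ) (demand τ) (demand-below τ) (demand-below τ))

  both-narrow : ∀ τ → Narrow (both τ)
  both-narrow τ = below-mono (both τ) X+K≤ (both-below τ)

  threefold-narrow : ∀ τ → Narrow (threefold τ)
  threefold-narrow τ = below-mono (threefold τ) width≥ (below-⊞ (both τ) (both τ ⊞ both τ) (both-below τ) (below-⊞ (both τ) (both τ) (both-below τ) (both-below τ)))

-- Generators for the numbers of the instance

module Generation (M : TM) where
  open TM M using (start)
  open Tableau M
  open Acceptance M
  open Encoding M
  open Generators 7 using (Words)
  open Stages 7 using (Gen; emit; _∙_; for; peek; output; sweep; scoped)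
  open Pipelines 7 using (drain)

  pattern T₀ = zero
  pattern T₁ = suc zero
  pattern T₂ = suc (suc zero)
  pattern T₃ = suc (suc (suc zero))
  pattern T₄ = suc (suc (suc (suc zero)))
  pattern T₅ = suc (suc (suc (suc (suc zero))))
  pattern T₆ = suc (suc (suc (suc (suc (suc zero)))))
  pattern T₇ = suc (suc (suc (suc (suc (suc (suc zero))))))

  -- The generators below expect the input on tape 1, its tail on tape 2, and unary numbers on the
  -- tapes 5 (number of steps), 6 (one more) and 7 (number of cells).
  module Memory (io x p p′ q r : List Bool) where

    memory : List Bool → Words
    memory y = io ∷ x ∷ drop 1 x ∷ p ∷ p′ ∷ q ∷ r ∷ y ∷ []

    -- `columns` counts the cells of a row without the margin; `gap`, one less, is the parameter `c`
    -- of the strip.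
    gap columns : ℕ
    gap     = length r + (length (drop 1 x) + length r)
    columns = length r + suc (length (drop 1 x) + length r)

  times-replicate : ∀ {A : Set} (f : A → List Bool) n a → concatMap f (replicate n a) ≡ times n (f a)
  times-replicate f n a = cong concat (map-replicate f n a)

  sweep-emit : ∀ X u ws w → sweep X (emit u) ws w ≡ times (length w) u
  sweep-emit X u ws []      = refl
  sweep-emit X u ws (b ∷ w) = cong (u ++_) (sweep-emit X u ws w)

  gapGen columnsGen : List Bool → Gen
  gapGen u     = for T₆ (emit u) ∙ for T₂ (emit u) ∙ for T₆ (emit u)
  columnsGen u = for T₆ (emit u) ∙ emit u ∙ for T₂ (emit u) ∙ for T₆ (emit u)

  blockBits : (BlockType → Block) → BlockType → List Bool
  blockBits φ τ = open-delimit (word (φ τ))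

  columnBits : (BlockType → Block) → Column → List Bool
  columnBits φ x = blockBits φ (top (cell start x))

  initialGen layoutGen : (BlockType → Block) → Gen
  initialGen φ =
    for T₆ (emit (columnBits φ (column blank false))) ∙
    peek T₁ (emit (columnBits φ (column blank true)))
            (emit (columnBits φ (column (bit false) true)))
            (emit (columnBits φ (column (bit true) true))) ∙
    for T₂ (peek T₂ (emit []) (emit (columnBits φ (column (bit false) false)))
                              (emit (columnBits φ (column (bit true) false)))) ∙
    for T₆ (emit (columnBits φ (column blank false)))
  layoutGen φ =
    emit (blockBits φ (corner margin)) ∙
    initialGen φ ∙
    -- Corner and initial columns form the first of the Q + 1 rows, so Q rows of inner cells follow.
    for T₅ (emit (blockBits φ inner) ∙ columnsGen (blockBits φ inner)) ∙
    emit (blockBits φ (end margin)) ∙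
    columnsGen (blockBits φ (bottom fin))

  -- The least significant bit comes first, so a zero in front doubles the number.
  doubling : List Bool
  doubling = open-delimit (false ∷ [])

  headerGen : Gen
  headerGen =
    -- The leading digit is 2 in L₁, L₂ and half of q, from the summand `y`, and hence 6 in half of
    -- 3 q.
    (emit doubling ∙ layoutGen threefold ∙ emit (delimit (binary 6))) ∙
    (emit doubling ∙ layoutGen both ∙ emit (delimit (binary 2))) ∙
    (layoutGen supply ∙ emit (delimit (binary 2))) ∙
    (layoutGen twice ∙ emit (delimit (binary 2)))

  itemGen : Tile → Gen
  itemGen τ =
    emit doubling ∙
    -- A letter of tape 7 is deleted before each call, so its length runs down through the indices
    -- of the cells.
    for T₇ (emit (open-delimit zero-word)) ∙
    emit (open-delimit (word (1 , hcode (leftColour τ) , vcode (topColour τ)))) ∙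
    emit (open-delimit (word (0 , hout (rightColour τ) , 0))) ∙
    gapGen (open-delimit zero-word) ∙
    emit (open-delimit (pad 0 ++ pad 0)) ∙
    emit (delimit (binary (vout (bottomColour τ))))

  itemsGen : List Tile → Gen
  itemsGen []       = emit []
  itemsGen (τ ∷ τs) = itemGen τ ∙ itemsGen τs

  module _ (io x p p′ q r : List Bool) where
    open Memory io x p p′ q r

    output-gap : ∀ u {y} → output (gapGen u) (memory y) ≡ times gap u
    output-gap u {y} = trans
      (cong₂ _++_ (sweep-emit T₆ u (memory y) r)
        (cong₂ _++_ (sweep-emit T₂ u (memory y) (drop 1 x)) (sweep-emit T₆ u (memory y) r)))
      (sym (trans (times-+ (length r) _ u) (cong (times (length r) u ++_) (times-+ (length (drop 1 x)) (length r) u))))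

    output-columns : ∀ u ws → Vec.lookup ws T₂ ≡ drop 1 x → Vec.lookup ws T₆ ≡ r → output (columnsGen u) ws ≡ times columns u
    output-columns u ws eq₂ eq₆ rewrite eq₂ | eq₆ = trans
      (cong₂ _++_ (sweep-emit T₆ u ws r)
        (cong (u ++_) (cong₂ _++_ (sweep-emit T₂ u ws (drop 1 x)) (sweep-emit T₆ u ws r))))
      (sym (trans (times-+ (length r) _ u)
        (cong (λ v → times (length r) u ++ u ++ v) (times-+ (length (drop 1 x)) (length r) u))))

    output-initial : ∀ φ y → output (initialGen φ) (memory y) ≡ concatMap (columnBits φ) (initialColumns (length r) x)
    output-initial φ y = trans
      (cong₂ _++_ (blanks r) (cong₂ _++_ (first x) (cong₂ _++_ (tail (drop 1 x)) (blanks r))))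
      (sym (trans (concatMap-++ (columnBits φ) (replicate (length r) (column blank false)) _)
        (cong (λ v → concatMap (columnBits φ) (replicate (length r) (column blank false)) ++ columnBits φ (column (firstSymbol x) true) ++ v)
          (concatMap-++ (columnBits φ) (inputColumns (drop 1 x)) _))))
      where
      blanks : ∀ w → sweep T₆ (emit (columnBits φ (column blank false))) (memory y) w ≡
                     concatMap (columnBits φ) (replicate (length w) (column blank false))
      blanks w = trans (sweep-emit T₆ _ (memory y) w) (sym (times-replicate (columnBits φ) (length w) _))

      first : ∀ x → output (peek T₁ (emit (columnBits φ (column blank true)))
                                    (emit (columnBits φ (column (bit false) true)))
                                    (emit (columnBits φ (column (bit true) true)))) (io ∷ x ∷ drop 1 x ∷ p ∷ p′ ∷ q ∷ r ∷ y ∷ [])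
                    ≡ columnBits φ (column (firstSymbol x) true)
      first []          = refl
      first (false ∷ _) = refl
      first (true ∷ _)  = refl

      tail : ∀ w → sweep T₂ (peek T₂ (emit []) (emit (columnBits φ (column (bit false) false)))
                                              (emit (columnBits φ (column (bit true) false)))) (memory y) w
                   ≡ concatMap (columnBits φ) (inputColumns w)
      tail []          = refl
      tail (false ∷ w) = cong (_ ++_) (tail w)
      tail (true ∷ w)  = cong (_ ++_) (tail w)

    private
      β : List BlockType
      β = layout margin (cells start (initialColumns (length r) x)) (length q * suc columns) margin (fins columns)

    output-layout : ∀ φ y → output (layoutGen φ) (memory y) ≡ concatMap (blockBits φ) β
    output-layout φ y = cong (blockBits φ (corner margin) ++_) (begin
      output (initialGen φ) (memory y) ++ rows q ++ endBits ++ output (columnsGen (blockBits φ (bottom fin))) (memory y)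
        ≡⟨ cong₂ _++_ (trans (output-initial φ y) (sym tops))
             (cong₂ _++_ (trans (rows≡ q) (sym (times-replicate (blockBits φ) (length q * suc columns) inner)))
               (cong (endBits ++_) (trans (output-columns _ (memory y) refl refl) (sym bottoms)))) ⟩
      concatMap (blockBits φ) (map top (cells start (initialColumns (length r) x))) ++
      concatMap (blockBits φ) (replicate (length q * suc columns) inner) ++
      concatMap (blockBits φ) (end margin ∷ map bottom (fins columns))
        ≡⟨ cong (concatMap (blockBits φ) (map top (cells start (initialColumns (length r) x))) ++_)
             (concatMap-++ (blockBits φ) (replicate (length q * suc columns) inner) _) ⟨
      concatMap (blockBits φ) (map top (cells start (initialColumns (length r) x))) ++
      concatMap (blockBits φ) (replicate (length q * suc columns) inner ++ end margin ∷ map bottom (fins columns))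
        ≡⟨ concatMap-++ (blockBits φ) (map top (cells start (initialColumns (length r) x))) _ ⟨
      concatMap (blockBits φ) (map top (cells start (initialColumns (length r) x)) ++
        replicate (length q * suc columns) inner ++ end margin ∷ map bottom (fins columns))
        ∎)
      where
      open ≡-Reasoning

      endBits u : List Bool
      endBits = blockBits φ (end margin)
      u       = blockBits φ inner

      rows : List Bool → List Bool
      rows = sweep T₅ (emit u ∙ columnsGen u) (memory y)

      rows≡ : ∀ w → rows w ≡ times (length w * suc columns) u
      rows≡ []      = refl
      rows≡ (b ∷ w) = trans (cong₂ _++_ (cong (u ++_) (output-columns u (memory y [ T₅ ]≔ (b ∷ w)) refl refl)) (rows≡ w))
        (sym (times-+ (suc columns) (length w * suc columns) u))

      tops : concatMap (blockBits φ) (map top (cells start (initialColumns (length r) x))) ≡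
             concatMap (columnBits φ) (initialColumns (length r) x)
      tops = trans (concatMap-map (blockBits φ) top (cells start (initialColumns (length r) x)))
        (concatMap-map (blockBits φ ∘ top) (λ x → cell start x) (initialColumns (length r) x))

      bottoms : concatMap (blockBits φ) (map bottom (fins columns)) ≡ times columns (blockBits φ (bottom fin))
      bottoms = trans (concatMap-map (blockBits φ) bottom (fins columns)) (times-replicate (blockBits φ ∘ bottom) columns fin)

    number-bits : ∀ φ → (∀ τ → Narrow (φ τ)) → ∀ z y →
                  output (layoutGen φ) (memory y) ++ delimit (binary (suc z)) ≡ delimit (binary (Radix.blocks B (map φ β) (suc z)))
    number-bits φ narrow z y = trans (cong (_++ delimit (binary (suc z))) (trans (output-layout φ y) (flatten β)))
      (sym (trans (cong (delimit ∘ binary) (sym (val-words φ narrow β (suc z)))) (delimit-binary-val (concatMap (word ∘ φ) β) (s≤s z≤n))))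
      where
      flatten : ∀ τs → concatMap (blockBits φ) τs ≡ open-delimit (concatMap (word ∘ φ) τs)
      flatten []       = refl
      flatten (τ ∷ τs) = trans (cong (blockBits φ τ ++_) (flatten τs)) (sym (open-delimit-++ (word (φ τ)) _))

    doubled-number-bits : ∀ φ → (∀ τ → Narrow (φ τ)) → ∀ z y →
      doubling ++ output (layoutGen φ) (memory y) ++ delimit (binary (suc z)) ≡
      delimit (binary (dbl (Radix.blocks B (map φ β) (suc z))))
    doubled-number-bits φ narrow z y = trans (cong (doubling ++_) (number-bits φ narrow z y))
      (sym (trans (cong delimit (cong binary (cong dbl (sym (val-words φ narrow β (suc z))))))
        (trans (delimit-binary-val (false ∷ concatMap (word ∘ φ) β) (s≤s z≤n))
          (cong (λ v → true ∷ false ∷ v) (trans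
            (sym (delimit-binary-val (concatMap (word ∘ φ) β) (s≤s z≤n)))
            (cong (delimit ∘ binary) (val-words φ narrow β (suc z))))))))

    output-header : ∀ y → output headerGen (memory y) ≡
      delimit (binary (dbl (Radix.blocks B (map threefold β) 6))) ++ delimit (binary (dbl (Radix.blocks B (map both β) 2))) ++
      delimit (binary (Radix.blocks B (map supply β) 2)) ++ delimit (binary (Radix.blocks B (map twice β) 2))
    output-header y = cong₂ _++_ (doubled-number-bits threefold threefold-narrow 5 y)
      (cong₂ _++_ (doubled-number-bits both both-narrow 1 y)
        (cong₂ _++_ (number-bits supply supply-narrow 1 y) (number-bits twice twice-narrow 1 y)))

    open Width gap

    output-item : ∀ τ y → output (itemGen τ) (memory y) ≡ delimit (binary (dbl (Radix.zeros B (length y) (single τ))))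
    output-item τ y = sym (begin
      delimit (binary (dbl (Radix.zeros B (length y) (single τ))))
        ≡⟨ cong (delimit ∘ binary ∘ dbl) (sym value) ⟩
      delimit (binary (val (false ∷ bits) (vout (bottomColour τ))))
        ≡⟨ delimit-binary-val (false ∷ bits) (m<n⇒0<n∸m (vcode<K (bottomColour τ))) ⟩
      doubling ++ open-delimit bits ++ delimit (binary (vout (bottomColour τ)))
        ≡⟨ cong (doubling ++_) (cong (_++ delimit (binary (vout (bottomColour τ)))) spread) ⟩
      doubling ++ (Z ++ A ++ R ++ G ++ P) ++ delimit (binary (vout (bottomColour τ)))
        ≡⟨ cong (doubling ++_) (trans (++-assoc Z _ _) (cong (Z ++_) (trans (++-assoc A _ _)
             (cong (A ++_) (trans (++-assoc R _ _) (cong (R ++_) (++-assoc G P _))))))) ⟩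
      doubling ++ Z ++ A ++ R ++ G ++ P ++ delimit (binary (vout (bottomColour τ)))
        ≡⟨ cong (doubling ++_) (cong₂ _++_ (sweep-emit T₇ _ (memory y) y)
             (cong (λ g → A ++ R ++ g ++ P ++ delimit (binary (vout (bottomColour τ)))) (output-gap (open-delimit zero-word)))) ⟨
      output (itemGen τ) (memory y) ∎)
      where
      open ≡-Reasoning
      a r′ : List Bool
      a  = word (1 , hcode (leftColour τ) , vcode (topColour τ))
      r′ = word (0 , hout (rightColour τ) , 0)

      bits Z A R G P : List Bool
      bits = times (length y) zero-word ++ a ++ r′ ++ times gap zero-word ++ pad 0 ++ pad 0
      Z = times (length y) (open-delimit zero-word)
      A = open-delimit a
      R = open-delimit r′
      G = times gap (open-delimit zero-word)
      P = open-delimit (pad 0 ++ pad 0)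

      spread : open-delimit bits ≡ Z ++ A ++ R ++ G ++ P
      spread = trans (open-delimit-++ (times (length y) zero-word) _) (cong₂ _++_ (sym (times-open-delimit (length y) zero-word))
        (trans (open-delimit-++ a _) (cong (A ++_) (trans (open-delimit-++ r′ _) (cong (R ++_)
          (trans (open-delimit-++ (times gap zero-word) _) (cong (_++ P) (sym (times-open-delimit gap zero-word)))))))))

      ≤width : ∀ {z} → z ≤ K → z ≤ width
      ≤width h = ≤-trans h K≤width

      value : val bits (vout (bottomColour τ)) ≡ Radix.zeros B (length y) (single τ)
      value = trans (val-++ (times (length y) zero-word) _ _) (trans (val-zero-words (length y) _) (cong (Radix.zeros B (length y))
        (trans (val-++ a _ _) (trans (val-word _ (≤width 0<K , ≤width (<⇒≤ (hcode<K (leftColour τ))) , ≤width (<⇒≤ (vcode<K (topColour τ)))))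
          (cong (Radix.blk B 1 (hcode (leftColour τ)) (vcode (topColour τ)))
            (trans (val-++ r′ _ _) (trans (val-word _ (z≤n , ≤width (m∸n≤m K (hcode (rightColour τ))) , z≤n))
              (cong (Radix.blk B 0 (hout (rightColour τ)) 0)
                (trans (val-++ (times gap zero-word) _ _) (trans (val-zero-words gap _) (cong (Radix.zeros B gap)
                  (trans (val-++ (pad 0) (pad 0) _) (trans (val-pad _ z≤n) (cong (B *_) (trans (val-pad _ z≤n)
                    (cong (B *_) (sym (trans (cong (vout (bottomColour τ) +_) (*-zeroʳ B)) (+-identityʳ _)))))))))))))))))))

    output-items : ∀ τs y → output (itemsGen τs) (memory y) ≡ encodeℕs (map (λ τ → dbl (Radix.zeros B (length y) (single τ))) τs)
    output-items []       y = refl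
    output-items (τ ∷ τs) y = cong₂ _++_ (output-item τ y) (output-items τs y)

    drain-items : ∀ w y → drain T₇ (itemsGen tiles) (memory y) w ≡ encodeℕs (items (length w))
    drain-items []      y = refl
    drain-items (b ∷ w) y = trans (cong₂ _++_ (output-items tiles w) (drain-items w y))
      (sym (concatMap-++ (delimit ∘ binary) (map (λ τ → dbl (Radix.zeros B (length w) (single τ))) tiles) (items (length w))))

-- The pipeline and its correctness

length-times : ∀ n u → length (times n u) ≡ n * length u
length-times zero    u = refl
length-times (suc n) u = trans (length-++ u) (cong (length u +_) (length-times n u))

module Reduction (M : TM) (a k : ℕ) where
  open TM M using (start)
  open Tableau M hiding (n)
  open Acceptance M
  open Encoding M
  open Generation M
  open Generators 7 using (Words)
  open Stages 7 using (Gen; emit; _∙_; for; peek; output; sweep; scoped)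
  open Pipelines 7
  open Helix leftColour rightColour topColour bottomColour using () renaming (Path to Tiling)

  one : List Bool
  one = true ∷ []

  -- In a sweep over tape 0, `copyGen` copies the whole word. While tape 0 is being emptied, each
  -- letter is gone before `copyGen` looks, so it copies the tail.
  copyGen cellsGen : Gen
  copyGen  = peek T₀ (emit []) (emit (false ∷ [])) (emit (true ∷ []))
  cellsGen = (emit one ∙ columnsGen one) ∙ for T₅ (emit one ∙ columnsGen one)

  -- Each round multiplies the unary number on tape 3 by the input length. The product arises on
  -- tape 4 and is moved back, as a stage cannot write to its source.
  powerStages : ℕ → List Stage
  powerStages zero    = []
  powerStages (suc k) = stage T₄ (emit []) T₃ (for T₁ (emit one)) ∷ stage T₃ (emit []) T₄ (emit one) ∷ powerStages k

  module Preparation (header items : Gen) (scoped-header : scoped (allBut T₀) header) (scoped-items : scoped (allBut T₀) items) where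

    -- A stage with an empty source only performs its `first` generator. Tape 7 is such a source
    -- until it receives the number of cells, as is tape 4 after the powers.
    finalStages stages : List Stage
    finalStages =
      stage T₅ (for T₃ (emit (replicate a true)) ∙ emit (replicate a true)) T₇ (emit []) ∷
      stage T₆ (for T₅ (emit one) ∙ emit one) T₇ (emit []) ∷
      stage T₇ cellsGen T₄ (emit []) ∷
      stage T₀ header T₇ items ∷ []
    stages =
      stage T₁ (for T₀ copyGen) T₇ (emit []) ∷
      stage T₂ (emit []) T₀ copyGen ∷
      stage T₃ (emit one) T₇ (emit []) ∷
      powerStages k ++ finalStages

    module _ (x : List Bool) where

      mem : (p q r y : List Bool) → Words
      mem p q r y = Memory.memory [] x p [] q r y

      powers : ∀ k p ss → ∃ λ p′ → length p′ ≡ length p * length x ^ k ×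
        performAll (powerStages k ++ ss) (mem p [] [] []) ≡ performAll ss (mem p′ [] [] []) ×
        (ApplicableAll ss (mem p′ [] [] []) → ApplicableAll (powerStages k ++ ss) (mem p [] [] []))
      powers zero    p ss = p , sym (*-identityʳ (length p)) , refl , id
      powers (suc k) p ss =
        let p″ , len , eq , applicable = powers k p′ ss
        in p″ , trans len (trans (cong (_* length x ^ k) length-p′) (*-assoc (length p) (length x) (length x ^ k))) , eq
         , λ as → ((λ ()) , refl , tt , tt , tt) , ((λ ()) , refl , tt , tt) , applicable as
        where
        ws : Words
        ws = mem p [] [] []

        p⁺ : List Bool
        p⁺ = drain T₃ (for T₁ (emit one)) ws p

        ws⁺ : Words
        ws⁺ = Memory.memory [] x [] p⁺ [] [] []

        p′ : List Bool
        p′ = drain T₄ (emit one) ws⁺ p⁺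

        grown : ∀ w → length (drain T₃ (for T₁ (emit one)) ws w) ≡ length w * length x
        grown []      = refl
        grown (b ∷ w) = trans (length-++ (sweep T₁ (emit one) _ x)) (cong₂ _+_
          (trans (cong length (sweep-emit T₁ one _ x)) (trans (length-times (length x) one) (*-identityʳ (length x)))) (grown w))

        moved : ∀ w → length (drain T₄ (emit one) ws⁺ w) ≡ length w
        moved []      = refl
        moved (b ∷ w) = cong suc (moved w)

        length-p′ : length p′ ≡ length p * length x
        length-p′ = trans (moved p⁺) (grown p)

      record Prepared : Set where
        field
          p q r y    : List Bool
          length-q   : length q ≡ poly a k (length x)
          length-r   : length r ≡ suc (length q)
          length-y   : length y ≡ suc (Memory.columns [] x p [] q r) + length q * suc (Memory.columns [] x p [] q r)
          result     : Vec.head (performAll stages (input x)) ≡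
                       output header (mem p q r y) ++ drain T₇ items (mem p q r y) y
          applicable : ApplicableAll stages (input x)

      private
        copied : ∀ ws w → sweep T₀ copyGen (x ∷ ws) w ≡ w
        copied ws []          = refl
        copied ws (false ∷ w) = cong (false ∷_) (copied ws w)
        copied ws (true ∷ w)  = cong (true ∷_) (copied ws w)

        dropped : ∀ ws w → drain T₀ copyGen (x ∷ ws) w ≡ drop 1 w
        dropped ws []                  = refl
        dropped ws (_ ∷ [])            = refl
        dropped ws (_ ∷ w@(false ∷ _)) = cong (false ∷_) (dropped ws w)
        dropped ws (_ ∷ w@(true ∷ _))  = cong (true ∷_) (dropped ws w)

        tape₁ tape₂ : List Bool
        tape₁ = sweep T₀ copyGen (input x) x ++ []
        tape₂ = drain T₀ copyGen (x ∷ tape₁ ∷ Vec.replicate 6 []) x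

        tape₁≡ : tape₁ ≡ x
        tape₁≡ = trans (++-identityʳ _) (copied (Vec.replicate 7 []) x)

        tape₂≡ : tape₂ ≡ drop 1 x
        tape₂≡ = dropped (tape₁ ∷ Vec.replicate 6 []) x

        length-emitted : ∀ X ws w → length (sweep X (emit one) ws w ++ one) ≡ suc (length w)
        length-emitted X ws w = trans (length-++ (sweep X (emit one) ws w)) (trans (+-comm _ 1)
          (cong suc (trans (cong length (sweep-emit X one ws w)) (trans (length-times (length w) one) (*-identityʳ (length w))))))

      abstract
        prepared : Prepared
        prepared with p , length-p , eq , applicable ← powers k one finalStages = record
          { p = p ; q = q ; r = r ; y = y
          ; length-q = length-q
          ; length-r = trans (cong length (++-identityʳ (sweep T₅ (emit one) (mem p q [] []) q ++ one))) (length-emitted T₅ (mem p q [] []) q)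
          ; length-y = length-y
          ; result = cong Vec.head (trans (cong₂ (λ u v → performAll (powerStages k ++ finalStages) (after-copy u v)) tape₁≡ tape₂≡) eq)
          ; applicable = ((λ ()) , refl , _ , _) , ((λ ()) , refl , _ , _) , ((λ ()) , refl , _ , _)
              , subst₂ (λ u v → ApplicableAll (powerStages k ++ finalStages) (after-copy u v)) (sym tape₁≡) (sym tape₂≡)
                  (applicable (((λ ()) , refl , _ , _) , ((λ ()) , refl , _ , _) , ((λ ()) , refl , _ , _)
                    , ((λ ()) , refl , scoped-header , scoped-items) , tt))
          }
          where
          after-copy : List Bool → List Bool → Words
          after-copy u v = [] ∷ u ∷ v ∷ one ∷ [] ∷ [] ∷ [] ∷ [] ∷ []

          as q r y : List Bool
          as = replicate a true
          q  = (sweep T₃ (emit as) (mem p [] [] []) p ++ as) ++ []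
          r  = (sweep T₅ (emit one) (mem p q [] []) q ++ one) ++ []
          y  = output cellsGen (mem p q r []) ++ []

          length-q : length q ≡ poly a k (length x)
          length-q = begin
            length q                                              ≡⟨ cong length (++-identityʳ (sweep T₃ (emit as) (mem p [] [] []) p ++ as)) ⟩
            length (sweep T₃ (emit as) (mem p [] [] []) p ++ as)  ≡⟨ length-++ (sweep T₃ (emit as) (mem p [] [] []) p) ⟩
            length (sweep T₃ (emit as) (mem p [] [] []) p) + length as
              ≡⟨ cong₂ _+_ (trans (cong length (sweep-emit T₃ as (mem p [] [] []) p)) (length-times (length p) as)) (length-replicate a) ⟩
            length p * length as + a                              ≡⟨ cong₂ (λ m n → m * n + a) (trans length-p (+-identityʳ _)) (length-replicate a) ⟩
            length x ^ k * a + a                                  ≡⟨ cong (_+ a) (*-comm (length x ^ k) a) ⟩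
            a * length x ^ k + a                                  ∎
            where open ≡-Reasoning

          open Memory [] x p [] q r using (columns)

          row : ∀ ws → Vec.lookup ws T₂ ≡ drop 1 x → Vec.lookup ws T₆ ≡ r → length (output (emit one ∙ columnsGen one) ws) ≡ suc columns
          row ws eq₂ eq₆ = cong suc (trans (cong length (output-columns [] x p [] q r one ws eq₂ eq₆))
            (trans (length-times columns one) (*-identityʳ columns)))

          rows : ∀ w → length (sweep T₅ (emit one ∙ columnsGen one) (mem p q r []) w) ≡ length w * suc columns
          rows []      = refl
          rows (b ∷ w) = trans (length-++ (output (emit one ∙ columnsGen one) (mem p q r [] [ T₅ ]≔ (b ∷ w))))
            (cong₂ _+_ (row (mem p q r [] [ T₅ ]≔ (b ∷ w)) refl refl) (rows w))

          length-y : length y ≡ suc columns + length q * suc columns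
          length-y = trans (cong length (++-identityʳ (output cellsGen (mem p q r []))))
            (trans (length-++ (output (emit one ∙ columnsGen one) (mem p q r []))) (cong₂ _+_ (row (mem p q r []) refl refl) (rows q)))

  scoped-itemsGen : ∀ τs → scoped (allBut T₀) (itemsGen τs)
  scoped-itemsGen []       = tt
  scoped-itemsGen (τ ∷ τs) = _ , scoped-itemsGen τs

  open Preparation headerGen (itemsGen tiles) _ (scoped-itemsGen tiles)

  reduction : List Bool → List Bool
  reduction x = Vec.head (performAll stages (input x))

  reduction-polytime : PolyTime reduction
  reduction-polytime = pipeline-polytime stages (λ x → Prepared.applicable (prepared x))

  module _ (x : List Bool) where
    open Prepared (prepared x)
    open Memory [] x p [] q r using (gap; columns)

    private
      vs : List V
      vs = cells start (initialColumns (length r) x)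

      columns≡ : columns ≡ suc gap
      columns≡ = +-suc (length r) (length (drop 1 x) + length r)

      vs-length : length vs ≡ columns
      vs-length = trans (length-map _ (initialColumns (length r) x))
        (trans (length-++ (replicate (length r) (column blank false))) (cong₂ _+_ (length-replicate (length r))
          (cong suc (trans (length-++ (inputColumns (drop 1 x))) (cong₂ _+_ (length-map _ (drop 1 x)) (length-replicate (length r)))))))

      lv : length vs ≡ suc gap
      lv = trans vs-length columns≡

      lw : length (fins columns) ≡ suc gap
      lw = trans (length-replicate columns) columns≡

      -- The tableau counts its cells as Q + 1 rows, the layout as a corner, the other cells of the
      -- first row, and Q inner rows.
      rearrange : ∀ {R C l g Q} → R ≡ suc Q → C ≡ suc g → l ≡ C →
        Tiling (suc Q * suc (suc g)) nothing (margin ∷ cells start (initialColumns (suc Q) x)) nothing (margin ∷ fins (suc g)) ≡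
        Tiling (suc (l + Q * suc C)) nothing (margin ∷ cells start (initialColumns R x)) nothing (margin ∷ fins C)
      rearrange refl refl refl = refl

      cell-count : length y ≡ suc (length vs + length q * suc columns)
      cell-count = trans length-y (cong (λ l → suc (l + length q * suc columns)) (sym vs-length))

    open Strip all-tiles tiles-descending margin vs (length q * suc columns) margin (fins columns) lv lw public

    reduction-encodes : reduction x ≡ DecisionProblem.encode MixedShop reduced
    reduction-encodes = trans result (trans
      (cong₂ _++_ (output-header [] x p [] q r y) (trans (drain-items [] x p [] q r y y)
        (cong (λ n → encodeℕs (Width.items gap n)) cell-count)))
      (trans (encodeℕs-∷₄ (dbl (Radix.blocks B (map threefold β) 6)) (dbl (Radix.blocks B (map both β) 2))
               (Radix.blocks B (map supply β) 2) (Radix.blocks B (map twice β) 2)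
               (Width.items gap (suc (length vs + length q * suc columns))))
        (sym reduced-encode)))
      where
      β : List BlockType
      β = layout margin vs (length q * suc columns) margin (fins columns)

      encodeℕs-∷₄ : ∀ a b c d ns → (delimit (binary a) ++ delimit (binary b) ++ delimit (binary c) ++ delimit (binary d)) ++ encodeℕs ns ≡ encodeℕs (a ∷ b ∷ c ∷ d ∷ ns)
      encodeℕs-∷₄ a b c d ns = trans (++-assoc (delimit (binary a)) _ _) (cong (delimit (binary a) ++_)
        (trans (++-assoc (delimit (binary b)) _ _) (cong (delimit (binary b) ++_) (++-assoc (delimit (binary c)) (delimit (binary d)) _))))

    reduction-correct : AcceptsWithin M x (poly a k (length x)) ⇔ DecisionProblem.Yes MixedShop reduced
    reduction-correct = ⇔.trans
      (subst (λ Q → AcceptsWithin M x Q ⇔ Tiling (suc (length vs + length q * suc columns)) nothing (margin ∷ vs) nothing (margin ∷ fins columns))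
        length-q
        (subst (λ P → AcceptsWithin M x (length q) ⇔ P) (rearrange length-r columns≡ vs-length)
          (acceptance x (length q) (trans (sym (length-map _ (initialColumns (suc (length q)) x)))
            (subst (λ R → length (cells start (initialColumns R x)) ≡ suc gap) length-r lv)))))
      reduced-correct

theorem5p1 : NP-hard (restrict MixedShop OpenJobLargest)
theorem5p1 L (M , a , k , L⇔M) = reduction , reduction-polytime
  , λ x → reduced x , reduction-encodes x , reduced-admissible x , ⇔.trans (L⇔M x) (reduction-correct x)
  where open Reduction M a k
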